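{- Let $K_4$ denote the complete $3$-graph on $4$ vertices and $K_4^-$ the $3$-graph on $4$ vertices with exactly $3$ edges. Then \[\pi_{K_4^- }(\{K_4\}) = \frac{16}{27}.\]
   Context: A $3$-graph is a pair $G=(V,E)$ with $E$ a set of $3$-element subsets of $V$. For a $3$-graph $H$ on $h$ vertices and a $3$-graph $G$ on $n\ge h$ vertices, $e_H(G)$ is the number of $h$-element subsets of $V(G)$ that induce a subgraph of $G$ isomorphic to $H$. For a family $\mathcal{F}$ of $3$-graphs, $G$ is $\mathcal{F}$-free if it contains no member of $\mathcal{F}$ as a (not necessarily induced) subgraph. Let $\mathrm{ex}_H(n,\mathcal{F})$ be the maximum of $e_H(G)$ over all $\mathcal{F}$-free $3$-graphs $G$ on $n$ vertices, and define the Turán $H$-density $\pi_H(\mathcal{F})=\lim_{n\to\infty}\mathrm{ex}_H(n,\mathcal{F})/\binom{n}{h}$ (this limit exists). -}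

module Defs where

open import Data.Nat using (ℕ; zero; suc; _+_; _≤_)
open import Data.Fin using (Fin; zero; suc; _<?_) renaming (_≟_ to _≟F_)
open import Data.Fin.Subset using (Subset; ⁅_⁆; _∪_)
open import Data.Bool using (Bool; true; false; _∧_; not; _xor_; if_then_else_)
open import Data.Vec using (Vec; lookup; _∷_; [])
open import Data.Product using (Σ; _×_)
open import Data.Integer using (+_)
open import Data.Rational using (ℚ; _/_; 0ℚ)
open import Function using (_∘_)
open import Function.Definitions using (Injective)
open import Relation.Nullary using (¬_; does)
open import Relation.Binary.PropositionalEquality using (_≡_)

-- A 3-graph on vertex set Fin n: its edge set is the set of
-- 3-element subsets S with E S ≡ true (values on subsets of other sizes are ignored).
Graph3 : ℕ → Set
Graph3 n = Subset n → Bool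

allF : (n : ℕ) → (Fin n → Bool) → Bool
allF zero    p = true
allF (suc n) p = p zero ∧ allF n (p ∘ suc)

anyF : (n : ℕ) → (Fin n → Bool) → Bool
anyF zero    p = false
anyF (suc n) p = p zero Data.Bool.∨ anyF n (p ∘ suc)

sumF : (n : ℕ) → (Fin n → ℕ) → ℕ
sumF zero    f = 0
sumF (suc n) f = f zero + sumF n (f ∘ suc)

_==_ : {n : ℕ} → Fin n → Fin n → Bool
x == y = does (x ≟F y)

_<ᵇ_ : {n : ℕ} → Fin n → Fin n → Bool
x <ᵇ y = does (x <? y)

_⇔ᵇ_ : Bool → Bool → Bool
a ⇔ᵇ b = not (a xor b)

distinct3 : {n : ℕ} → Fin n → Fin n → Fin n → Bool
distinct3 x y z = not (x == y) ∧ not (y == z) ∧ not (x == z)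

hasEdge : {n : ℕ} → Graph3 n → Fin n → Fin n → Fin n → Bool
hasEdge G x y z = distinct3 x y z ∧ G (⁅ x ⁆ ∪ ⁅ y ⁆ ∪ ⁅ z ⁆)

K4 : Graph3 4
K4 S = true

-- K4⁻: 3-graph on 4 vertices with exactly 3 edges (all triples containing vertex 0)
K4⁻ : Graph3 4
K4⁻ S = lookup S zero

Contains : {n k : ℕ} → Graph3 n → Graph3 k → Set
Contains {n} {k} G F =
  Σ (Fin k → Fin n) λ f → Injective _≡_ _≡_ f ×
    (∀ x y z → hasEdge F x y z ≡ true → hasEdge G (f x) (f y) (f z) ≡ true)

Free : {n k : ℕ} → Graph3 n → Graph3 k → Set
Free G F = ¬ Contains G F

injB : (Fin 4 → Fin 4) → Bool
injB σ = allF 4 λ x → allF 4 λ y → (x == y) Data.Bool.∨ not (σ x == σ y)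

-- Does the subgraph of G induced on the image of v : Fin 4 → Fin n
-- (v injective) have an isomorphism from H?  H x ↦ v (σ x), σ a permutation.
isoInducedB : {n : ℕ} → Graph3 4 → Graph3 n → (Fin 4 → Fin n) → Bool
isoInducedB H G v =
  anyF 4 λ i → anyF 4 λ j → anyF 4 λ k → anyF 4 λ l →
    let σ = lookup (i ∷ j ∷ k ∷ l ∷ []) in
    injB σ ∧ (allF 4 λ x → allF 4 λ y → allF 4 λ z →
      hasEdge H x y z ⇔ᵇ hasEdge G (v (σ x)) (v (σ y)) (v (σ z)))

eH4 : {n : ℕ} → Graph3 4 → Graph3 n → ℕ
eH4 {n} H G =
  sumF n λ a → sumF n λ b → sumF n λ c → sumF n λ d →
    if (a <ᵇ b) ∧ (b <ᵇ c) ∧ (c <ᵇ d)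
         ∧ isoInducedB H G (lookup (a ∷ b ∷ c ∷ d ∷ []))
    then 1 else 0

IsEx : (H F : Graph3 4) → ℕ → ℕ → Set
IsEx H F n m =
  (Σ (Graph3 n) λ G → Free G F × eH4 H G ≡ m) ×
  (∀ (G : Graph3 n) → Free G F → eH4 H G ≤ m)

-- m / c as a rational (convention: 0 when c = 0; irrelevant for large n)
ratio : ℕ → ℕ → ℚ
ratio m zero    = 0ℚ
ratio m (suc c) = (+ m) / suc c

{-# OPTIONS --safe #-}
module Submission where

-- Upper bound. Allow repeated vertices: since hasEdge is false on repeated
-- vertices, a tuple with repetitions behaves like a tuple in a blow-up of the
-- graph, which is still K₄-free, so flag algebra inequalities hold exactly for
-- every n. Let c be the number of ordered quadruples whose first vertex is the
-- apex of an induced K₄⁻. A semidefinite certificate on six vertices gives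
-- 27 c ≤ 4 n⁴: for every K₄-free 3-graph H on six points,
--   82944 #{induced K₄⁻ in H} + Σ_τ Σ Q_τ(flag, flag′) ≤ 737280,
-- where Q_τ is a positive semidefinite form on the flags over each of three
-- types τ: an induced K₄⁻, a non-edge, and a pair of vertices. Summed over all 6-tuples
-- the forms contribute a nonnegative amount. The inequality on six points is
-- invariant under permutations, so it suffices to check it for the extensions
-- by one vertex of the 23 isomorphism types of K₄-free 3-graphs on five points.
--
-- Lower bound. In Turán's construction, with classes modulo 3 and edges of the
-- types 012, 001, 112, 220, at least 12 ⌊n/3⌋⁴ - 6 n³ ordered quadruples
-- have their first vertex as the apex of an induced K₄⁻.
--
-- Since c is six times the number of induced copies of K₄⁻, both bounds give
-- 16/27 up to O(1/n).

open import Defs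

-- On six points each form is summed over the placements of its roots and flags, that is, over
-- permutations of the points. All 720 would be costly to evaluate, so each term runs over the
-- cosets of its own symmetry group, which has order 12 for the types K₄⁻ and non-edge and 16 for
-- the pair: 60, 60 and 45 placements. The objective sits on the roots of the type K₄⁻ and shares
-- its 60 placements, and 60 · 82944 : 737280 = 27 : 4 is the ratio of the upper bound. Because the
-- bound is attained asymptotically by Turán's construction, every form must vanish on the flag
-- frequencies seen there from each copy of its type. The forms are therefore singular, and a
-- rounding that ignored these kernels would lose either positivity or the exact constant.

module Arithmetic where

  -- Binomial coefficients

  open import Data.Integer.Base as ℤ using (ℤ; +_; +[1+_]; -[1+_])
  import Data.Integer.Properties as ℤₚ
  open import Data.Nat.Base as ℕ using (ℕ; zero; suc; _≤_; _<_; z≤n; s≤s; _+_; _*_; _^_)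
  import Data.Nat.Properties as ℕₚ
  open import Data.Nat.Combinatorics using (_C_; nC1≡n; nCk+nC[k+1]≡[n+1]C[k+1])
  open import Data.Nat.Coprimality using (Coprime)
  open import Data.Nat.Solver using (module +-*-Solver)
  open +-*-Solver
  open import Data.Empty using (⊥-elim)
  open import Data.Sum.Base using (inj₁; inj₂)
  open import Data.Rational.Base as ℚ using (ℚ; mkℚ)
  import Data.Rational.Properties as ℚₚ
  open import Data.Rational.Unnormalised.Base as ℚᵘ using (mkℚᵘ)
  import Data.Rational.Unnormalised.Properties as ℚᵘₚ
  open import Relation.Binary.PropositionalEquality

  -- With n = 3 + j this is n(n-1)(n-2)(n-3); the shift by 3 keeps truncated subtraction out of the
  -- polynomial identities.
  falling : ℕ → ℕ
  falling j = (3 + j) * (2 + j) * (1 + j) * j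

  C₂ : ∀ j → 2 * ((1 + j) C 2) ≡ (1 + j) * j
  C₂ zero = refl
  C₂ (suc j) = begin
    2 * ((2 + j) C 2)                        ≡⟨ cong (2 *_) (nCk+nC[k+1]≡[n+1]C[k+1] (1 + j) 1) ⟨
    2 * ((1 + j) C 1 + (1 + j) C 2)          ≡⟨ cong (λ c → 2 * (c + (1 + j) C 2)) (nC1≡n (1 + j)) ⟩
    2 * (1 + j + (1 + j) C 2)                ≡⟨ ℕₚ.*-distribˡ-+ 2 (1 + j) _ ⟩
    2 * (1 + j) + 2 * ((1 + j) C 2)          ≡⟨ cong (λ c → 2 * (1 + j) + c) (C₂ j) ⟩
    2 * (1 + j) + (1 + j) * j                ≡⟨ lemma j ⟩
    (2 + j) * (1 + j)                        ∎
    where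
    open ≡-Reasoning
    lemma : ∀ j → 2 * (1 + j) + (1 + j) * j ≡ (2 + j) * (1 + j)
    lemma = solve 1 (λ j → con 2 :* (con 1 :+ j) :+ (con 1 :+ j) :* j := (con 2 :+ j) :* (con 1 :+ j)) refl

  C₃ : ∀ j → 6 * ((2 + j) C 3) ≡ (2 + j) * (1 + j) * j
  C₃ zero = refl
  C₃ (suc j) = begin
    6 * ((3 + j) C 3)                        ≡⟨ cong (6 *_) (nCk+nC[k+1]≡[n+1]C[k+1] (2 + j) 2) ⟨
    6 * ((2 + j) C 2 + (2 + j) C 3)          ≡⟨ expand ((2 + j) C 2) ((2 + j) C 3) ⟩
    3 * (2 * ((2 + j) C 2)) + 6 * ((2 + j) C 3)  ≡⟨ cong₂ (λ c d → 3 * c + d) (C₂ (suc j)) (C₃ j) ⟩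
    3 * ((2 + j) * (1 + j)) + (2 + j) * (1 + j) * j  ≡⟨ lemma j ⟩
    (3 + j) * (2 + j) * (1 + j)              ∎
    where
    open ≡-Reasoning
    expand : ∀ a b → 6 * (a + b) ≡ 3 * (2 * a) + 6 * b
    expand = solve 2 (λ a b → con 6 :* (a :+ b) := con 3 :* (con 2 :* a) :+ con 6 :* b) refl
    lemma : ∀ j → 3 * ((2 + j) * (1 + j)) + (2 + j) * (1 + j) * j ≡ (3 + j) * (2 + j) * (1 + j)
    lemma = solve 1 (λ j → con 3 :* ((con 2 :+ j) :* (con 1 :+ j)) :+ (con 2 :+ j) :* (con 1 :+ j) :* j :=
                           (con 3 :+ j) :* (con 2 :+ j) :* (con 1 :+ j)) refl

  C₄ : ∀ j → 24 * ((3 + j) C 4) ≡ falling j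
  C₄ zero = refl
  C₄ (suc j) = begin
    24 * ((4 + j) C 4)                        ≡⟨ cong (24 *_) (nCk+nC[k+1]≡[n+1]C[k+1] (3 + j) 3) ⟨
    24 * ((3 + j) C 3 + (3 + j) C 4)          ≡⟨ expand ((3 + j) C 3) ((3 + j) C 4) ⟩
    4 * (6 * ((3 + j) C 3)) + 24 * ((3 + j) C 4)  ≡⟨ cong₂ (λ c d → 4 * c + d) (C₃ (suc j)) (C₄ j) ⟩
    4 * ((3 + j) * (2 + j) * (1 + j)) + falling j  ≡⟨ lemma j ⟩
    falling (suc j)                           ∎
    where
    open ≡-Reasoning
    expand : ∀ a b → 24 * (a + b) ≡ 4 * (6 * a) + 24 * b
    expand = solve 2 (λ a b → con 24 :* (a :+ b) := con 4 :* (con 6 :* a) :+ con 24 :* b) refl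
    lemma : ∀ j → 4 * ((3 + j) * (2 + j) * (1 + j)) + falling j ≡ falling (suc j)
    lemma = solve 1 (λ j → con 4 :* ((con 3 :+ j) :* (con 2 :+ j) :* (con 1 :+ j)) :+ (con 3 :+ j) :* (con 2 :+ j) :* (con 1 :+ j) :* j :=
                           (con 4 :+ j) :* (con 3 :+ j) :* (con 2 :+ j) :* (con 1 :+ j)) refl

  -- Polynomial estimates and error terms

  ≤-by : ∀ {a b} c → a + c ≡ b → a ≤ b
  ≤-by {a} c refl = ℕₚ.m≤m+n a c

  power-falling : ∀ j → (3 + j) ^ 4 ≤ falling j + 6 * (3 + j) ^ 3
  power-falling j = ≤-by (11 * (j * j) + 60 * j + 81) (solve 1 (λ j →
    (con 3 :+ j) :^ 4 :+ (con 11 :* (j :* j) :+ con 60 :* j :+ con 81) :=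
    (con 3 :+ j) :* (con 2 :+ j) :* (con 1 :+ j) :* j :+ con 6 :* (con 3 :+ j) :^ 3) refl j)

  falling-power : ∀ j → falling j ≤ (3 + j) ^ 4
  falling-power j = ≤-by (6 * (j * j * j) + 43 * (j * j) + 102 * j + 81) (solve 1 (λ j →
    (con 3 :+ j) :* (con 2 :+ j) :* (con 1 :+ j) :* j :+ (con 6 :* (j :* j :* j) :+ con 43 :* (j :* j) :+ con 102 :* j :+ con 81) :=
    (con 3 :+ j) :^ 4) refl j)

  -- With n = 3 + j, n³ is less than six times n(n-1)(n-2) once n ≥ 4, and at j = 0 both sides
  -- vanish. Errors of order n³ thereby become negligible against `falling j`.
  falling-large : ∀ j → (3 + j) ^ 3 * j ≤ 6 * falling j
  falling-large j = ≤-by ((3 + j) * j * (3 + 12 * j + 5 * (j * j))) (solve 1 (λ j →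
    (con 3 :+ j) :^ 3 :* j :+ (con 3 :+ j) :* j :* (con 3 :+ con 12 :* j :+ con 5 :* (j :* j)) :=
    con 6 :* ((con 3 :+ j) :* (con 2 :+ j) :* (con 1 :+ j) :* j)) refl j)

  -- Writing n = 3k + r, the difference n⁴ - (n - r)⁴ is at most 4 r n³, and r ≤ 2. For each r the
  -- slack is a polynomial in k with nonnegative coefficients.
  power-thirds : ∀ k r → r < 3 → (k * 3 + r) ^ 4 ≤ 81 * k ^ 4 + 8 * (k * 3 + r) ^ 3
  power-thirds k 0 _ = ≤-by (8 * (k * 3 + 0) ^ 3) (solve 1 (λ k →
    (k :* con 3 :+ con 0) :^ 4 :+ con 8 :* (k :* con 3 :+ con 0) :^ 3 :=
    con 81 :* k :^ 4 :+ con 8 :* (k :* con 3 :+ con 0) :^ 3) refl k)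
  power-thirds k 1 _ = ≤-by (108 * (k * k * k) + 162 * (k * k) + 60 * k + 7) (solve 1 (λ k →
    (k :* con 3 :+ con 1) :^ 4 :+ (con 108 :* (k :* k :* k) :+ con 162 :* (k :* k) :+ con 60 :* k :+ con 7) :=
    con 81 :* k :^ 4 :+ con 8 :* (k :* con 3 :+ con 1) :^ 3) refl k)
  power-thirds k 2 _ = ≤-by (216 * (k * k) + 192 * k + 48) (solve 1 (λ k →
    (k :* con 3 :+ con 2) :^ 4 :+ (con 216 :* (k :* k) :+ con 192 :* k :+ con 48) :=
    con 81 :* k :^ 4 :+ con 8 :* (k :* con 3 :+ con 2) :^ 3) refl k)
  power-thirds k (suc (suc (suc r))) (s≤s (s≤s (s≤s ())))

  -- Comparing m / C(n,4) with 16/27 amounts to comparing 648 m with 16 `falling j`, as 648 = 24 ·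
  -- 27.
  count-upper : ∀ j m → 27 * (6 * m) ≤ 4 * (3 + j) ^ 4 → 648 * m ≤ 16 * falling j + 776 * (3 + j) ^ 3
  count-upper j m h = begin
    648 * m                            ≡⟨ split m ⟩
    4 * (27 * (6 * m))                 ≤⟨ ℕₚ.*-monoʳ-≤ 4 h ⟩
    4 * (4 * (3 + j) ^ 4)              ≤⟨ ℕₚ.*-monoʳ-≤ 4 (ℕₚ.*-monoʳ-≤ 4 (power-falling j)) ⟩
    4 * (4 * (falling j + 6 * p))      ≡⟨ collect (falling j) p ⟩
    -- 96 is enlarged to 776 = 108 · 6 + 16 · 8, the error that arises in `count-lower`, so that
    -- both directions share one bound.
    16 * falling j + 96 * p            ≤⟨ ℕₚ.+-monoʳ-≤ (16 * falling j) (ℕₚ.*-monoˡ-≤ p (ℕₚ.m≤m+n 96 680)) ⟩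
    16 * falling j + 776 * p           ∎
    where
    open ℕₚ.≤-Reasoning
    p : ℕ
    p = (3 + j) ^ 3
    split : ∀ m → 648 * m ≡ 4 * (27 * (6 * m))
    split = solve 1 (λ m → con 648 :* m := con 4 :* (con 27 :* (con 6 :* m))) refl
    collect : ∀ d p → 4 * (4 * (d + 6 * p)) ≡ 16 * d + 96 * p
    collect = solve 2 (λ d p → con 4 :* (con 4 :* (d :+ con 6 :* p)) := con 16 :* d :+ con 96 :* p) refl

  count-lower : ∀ j m k r → 3 + j ≡ k * 3 + r → r < 3 → 12 * k ^ 4 ≤ 6 * m + 6 * (3 + j) ^ 3 →
    16 * falling j ≤ 648 * m + 776 * (3 + j) ^ 3
  count-lower j m k r eq r<3 h = begin
    16 * falling j                      ≤⟨ ℕₚ.*-monoʳ-≤ 16 (falling-power j) ⟩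
    16 * (3 + j) ^ 4                    ≡⟨ cong (λ n → 16 * n ^ 4) eq ⟩
    16 * (k * 3 + r) ^ 4                ≤⟨ ℕₚ.*-monoʳ-≤ 16 (power-thirds k r r<3) ⟩
    16 * (81 * k ^ 4 + 8 * (k * 3 + r) ^ 3)  ≡⟨ cong (λ n → 16 * (81 * k ^ 4 + 8 * n ^ 3)) eq ⟨
    16 * (81 * k ^ 4 + 8 * p)           ≡⟨ collect (k ^ 4) p ⟩
    108 * (12 * k ^ 4) + 128 * p        ≤⟨ ℕₚ.+-monoˡ-≤ (128 * p) (ℕₚ.*-monoʳ-≤ 108 h) ⟩
    108 * (6 * m + 6 * p) + 128 * p     ≡⟨ regroup m p ⟩
    648 * m + 776 * p                   ∎
    where
    open ℕₚ.≤-Reasoning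
    p : ℕ
    p = (3 + j) ^ 3
    collect : ∀ q p → 16 * (81 * q + 8 * p) ≡ 108 * (12 * q) + 128 * p
    collect = solve 2 (λ q p → con 16 :* (con 81 :* q :+ con 8 :* p) := con 108 :* (con 12 :* q) :+ con 128 :* p) refl
    regroup : ∀ m p → 108 * (6 * m + 6 * p) + 128 * p ≡ 648 * m + 776 * p
    regroup = solve 2 (λ m p → con 108 :* (con 6 :* m :+ con 6 :* p) :+ con 128 :* p := con 648 :* m :+ con 776 :* p) refl

  -- 173 is the least integer whose product with 27 exceeds 6 · 776 = 4656; the factor 6 comes from
  -- `falling-large`.
  error-small : ∀ j P Q → 173 * suc Q ≤ j → 776 * (3 + j) ^ 3 * suc Q < 27 * falling j * suc P
  error-small j P Q h = ℕₚ.*-cancelˡ-< 6 _ _ (begin-strict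
    6 * (776 * p * suc Q)          ≡⟨ left p (suc Q) ⟩
    4656 * (p * suc Q)             <⟨ ℕₚ.*-monoˡ-< (p * suc Q) {{nonZero}} (ℕₚ.m≤m+n 4657 14) ⟩
    4671 * (p * suc Q)             ≡⟨ right p (suc Q) ⟩
    27 * (p * (173 * suc Q))       ≤⟨ ℕₚ.*-monoʳ-≤ 27 (ℕₚ.*-monoʳ-≤ p h) ⟩
    27 * (p * j)                   ≤⟨ ℕₚ.*-monoʳ-≤ 27 (falling-large j) ⟩
    27 * (6 * falling j)           ≡⟨ swap (falling j) ⟩
    6 * (27 * falling j)           ≤⟨ ℕₚ.*-monoʳ-≤ 6 (ℕₚ.m≤m*n (27 * falling j) (suc P)) ⟩
    6 * (27 * falling j * suc P)   ∎)
    where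
    open ℕₚ.≤-Reasoning
    p : ℕ
    p = (3 + j) ^ 3
    nonZero : ℕ.NonZero (p * suc Q)
    nonZero = ℕₚ.m*n≢0 p (suc Q) {{ℕₚ.m^n≢0 (3 + j) 3}}
    left : ∀ p q → 6 * (776 * p * q) ≡ 4656 * (p * q)
    left = solve 2 (λ p q → con 6 :* (con 776 :* p :* q) := con 4656 :* (p :* q)) refl
    right : ∀ p q → 4671 * (p * q) ≡ 27 * (p * (173 * q))
    right = solve 2 (λ p q → con 4671 :* (p :* q) := con 27 :* (p :* (con 173 :* q))) refl
    swap : ∀ d → 27 * (6 * d) ≡ 6 * (27 * d)
    swap = solve 1 (λ d → con 27 :* (con 6 :* d) := con 6 :* (con 27 :* d)) refl

  -- Distance to 16/27 in the rationals

  ∣⊖∣-bound : ∀ a b e → a ≤ b + e → b ≤ a + e → ℤ.∣ a ℤ.⊖ b ∣ ≤ e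
  ∣⊖∣-bound a b e a≤ b≤ with ℕₚ.≤-total a b
  ... | inj₁ a≤b = subst (_≤ e) (sym (ℤₚ.∣⊖∣-≤ a≤b)) (ℕₚ.m≤n+o⇒m∸n≤o b a b≤)
  ... | inj₂ b≤a = subst (_≤ e) (sym (cong ℤ.∣_∣ (ℤₚ.⊖-≥ b≤a))) (ℕₚ.m≤n+o⇒m∸n≤o a b a≤)

  ∣⊖∣-scale : ∀ c a b → c * ℤ.∣ a ℤ.⊖ b ∣ ≡ ℤ.∣ (c * a) ℤ.⊖ (c * b) ∣
  ∣⊖∣-scale c a b with ℕₚ.≤-total a b
  ... | inj₁ a≤b = trans (cong (c *_) (ℤₚ.∣⊖∣-≤ a≤b)) (trans (ℕₚ.*-distribˡ-∸ c b a)
                     (sym (ℤₚ.∣⊖∣-≤ (ℕₚ.*-monoʳ-≤ c a≤b))))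
  ... | inj₂ b≤a = trans (cong (λ z → c * ℤ.∣ z ∣) (ℤₚ.⊖-≥ b≤a)) (trans (ℕₚ.*-distribˡ-∸ c a b)
                     (sym (cong ℤ.∣_∣ (ℤₚ.⊖-≥ (ℕₚ.*-monoʳ-≤ c b≤a)))))

  -- A sum in `ℚ` is reduced by a gcd, which hides its numerator. The comparison therefore passes to
  -- unnormalised rationals, where the difference is 27 m - 16 (c + 1) over 27 (c + 1) and the
  -- hypothesis is the cross-multiplied inequality.
  ratio-close : ∀ m c P Q .(cop : Coprime (suc P) (suc Q)) →
    ℤ.∣ (m * 27) ℤ.⊖ (16 * suc c) ∣ * suc Q < suc P * (suc c * 27) →
    ℚ.∣ ratio m (suc c) ℚ.- (+ 16) ℚ./ 27 ∣ ℚ.< mkℚ +[1+ P ] Q cop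
  ratio-close m c P Q cop h = ℚₚ.toℚᵘ-cancel-< (ℚᵘₚ.<-respˡ-≃ (ℚᵘₚ.≃-sym unnormalise) (ℚᵘ.*<* cross))
    where
    x y : ℚ
    x = (+ m) ℚ./ suc c
    y = (+ 16) ℚ./ 27
    unnormalise : ℚ.toℚᵘ ℚ.∣ x ℚ.- y ∣ ℚᵘ.≃ ℚᵘ.∣ mkℚᵘ (+ m) c ℚᵘ.- mkℚᵘ (+ 16) 26 ∣
    unnormalise = ℚᵘₚ.≃-trans (ℚₚ.toℚᵘ-homo-∣-∣ (x ℚ.- y)) (ℚᵘₚ.∣-∣-cong
      (ℚᵘₚ.≃-trans (ℚₚ.toℚᵘ-homo-+ x (ℚ.- y)) (ℚᵘₚ.+-cong (ℚₚ.toℚᵘ-fromℚᵘ (mkℚᵘ (+ m) c)) ℚᵘₚ.≃-refl)))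
    numerator : + m ℤ.* + 27 ℤ.+ (ℤ.- + 16) ℤ.* + suc c ≡ (m * 27) ℤ.⊖ (16 * suc c)
    numerator = trans (cong₂ ℤ._+_ (sym (ℤₚ.pos-* m 27))
      (trans (sym (ℤₚ.neg-distribˡ-* (+ 16) (+ suc c))) (cong ℤ.-_ (sym (ℤₚ.pos-* 16 (suc c))))))
      (ℤₚ.m-n≡m⊖n (m * 27) (16 * suc c))
    cross : + ℤ.∣ + m ℤ.* + 27 ℤ.+ (ℤ.- + 16) ℤ.* + suc c ∣ ℤ.* + suc Q ℤ.< +[1+ P ] ℤ.* + (suc c * 27)
    cross = subst₂ ℤ._<_
      (trans (ℤₚ.pos-* ℤ.∣ (m * 27) ℤ.⊖ (16 * suc c) ∣ (suc Q)) (cong (λ z → + ℤ.∣ z ∣ ℤ.* + suc Q) (sym numerator)))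
      (ℤₚ.pos-* (suc P) (suc c * 27)) (ℤ.+<+ h)

  ratio-bound : ∀ j m k r P Q .(cop : Coprime (suc P) (suc Q)) → 3 + j ≡ k * 3 + r → r < 3 → 173 * suc Q ≤ j →
    27 * (6 * m) ≤ 4 * (3 + j) ^ 4 → 12 * k ^ 4 ≤ 6 * m + 6 * (3 + j) ^ 3 →
    ℚ.∣ ratio m ((3 + j) C 4) ℚ.- (+ 16) ℚ./ 27 ∣ ℚ.< mkℚ +[1+ P ] Q cop
  ratio-bound j m k r P Q cop eq r<3 large upper lower with (3 + j) C 4 | C₄ j
  -- A zero binomial coefficient, the case in which `ratio` takes its default value, is impossible:
  -- the size hypothesis gives j ≥ 1, so `falling j` is positive.
  ... | zero | none = ⊥-elim (ℕₚ.<⇒≢ positive none)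
    where
    positive : 0 < falling j
    positive = falling-positive j (ℕₚ.≤-trans (s≤s z≤n) large)
      where
      falling-positive : ∀ j → 1 ≤ j → 0 < falling j
      falling-positive (suc j) _ = s≤s z≤n
  -- Multiplying by 24 = 4! turns the binomial coefficient into `falling j`, against which m is
  -- bounded from both sides.
  ... | suc c | total = ratio-close m c P Q cop (ℕₚ.*-cancelˡ-< 24 _ _ (begin-strict
    24 * (d * suc Q)                      ≡⟨ ℕₚ.*-assoc 24 d (suc Q) ⟨
    24 * d * suc Q                        ≡⟨ cong (_* suc Q) (∣⊖∣-scale 24 (m * 27) (16 * suc c)) ⟩
    ℤ.∣ (24 * (m * 27)) ℤ.⊖ (24 * (16 * suc c)) ∣ * suc Q
      ≡⟨ cong₂ (λ a b → ℤ.∣ a ℤ.⊖ b ∣ * suc Q) (scale-m m) scale-c ⟩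
    ℤ.∣ (648 * m) ℤ.⊖ (16 * falling j) ∣ * suc Q
      ≤⟨ ℕₚ.*-monoˡ-≤ (suc Q) (∣⊖∣-bound (648 * m) (16 * falling j) (776 * (3 + j) ^ 3)
           (count-upper j m upper) (count-lower j m k r eq r<3 lower)) ⟩
    776 * (3 + j) ^ 3 * suc Q             <⟨ error-small j P Q large ⟩
    27 * falling j * suc P                ≡⟨ cong (λ t → 27 * t * suc P) total ⟨
    27 * (24 * suc c) * suc P             ≡⟨ regroup (suc c) (suc P) ⟩
    24 * (suc P * (suc c * 27))           ∎))
    where
    open ℕₚ.≤-Reasoning
    d : ℕ
    d = ℤ.∣ (m * 27) ℤ.⊖ (16 * suc c) ∣
    scale-m : ∀ m → 24 * (m * 27) ≡ 648 * m
    scale-m = solve 1 (λ m → con 24 :* (m :* con 27) := con 648 :* m) refl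
    exchange : ∀ c → 24 * (16 * c) ≡ 16 * (24 * c)
    exchange = solve 1 (λ c → con 24 :* (con 16 :* c) := con 16 :* (con 24 :* c)) refl
    scale-c : 24 * (16 * suc c) ≡ 16 * falling j
    scale-c = trans (exchange (suc c)) (cong (16 *_) total)
    regroup : ∀ c p → 27 * (24 * c) * p ≡ 24 * (p * (c * 27))
    regroup = solve 2 (λ c p → con 27 :* (con 24 :* c) :* p := con 24 :* (p :* (c :* con 27))) refl

module Extremal where

  import Algebra.Properties.CommutativeSemigroup as CommSemigroupₚ
  import Data.Bool.Properties as Boolₚ
  import Data.Fin.Properties as Finₚ
  import Data.Fin.Subset.Properties as Subsetₚ
  import Data.Integer.Properties as ℤₚ
  import Data.List.Membership.Propositional as Membership
  import Data.List.Membership.Propositional.Properties as Membershipₚ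
  import Data.List.Relation.Unary.All.Properties as Allₚ
  import Data.List.Relation.Unary.Any.Properties as Anyₚ
  import Data.Nat.DivMod as DivMod
  import Data.Nat.Properties as ℕₚ
  import Data.Product.Properties as Productₚ
  import Data.Vec.Properties as Vecₚ
  open import Algebra.Properties.Semiring.Sum ℤₚ.+-*-semiring using (sum; sum-cong-≗; ∑-distrib-+; ∑-comm; *-distribˡ-sum)
  open import Data.Bool.Base using (Bool; true; false; _∧_; _∨_; not; if_then_else_; T)
  open import Data.Bool.ListAction using (all; any)
  open import Data.Empty using (⊥-elim)
  open import Data.Fin.Base as Fin using (Fin; zero; suc; _↑ˡ_)
  open import Data.Fin.Patterns
  open import Data.Fin.Subset using (⁅_⁆; _∪_)
  open import Data.Integer.Base as ℤ using (ℤ; +_; +[1+_]; 0ℤ; 1ℤ; _+_; _*_; -_; _≤_; _^_; _≤ᵇ_)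
  open import Data.Integer.Solver using (module +-*-Solver)
  open import Data.List.Base using (List; []; _∷_; _++_; map; foldr; filter; length; cartesianProductWith; inits)
  open import Data.List.Extrema ℕₚ.≤-totalOrder using (argmax; argmax-all; f[xs]≤f[argmax])
  open import Data.List.Relation.Unary.All as All using (All; []; _∷_)
  open import Data.List.Relation.Unary.Any using (Any; here; there)
  open import Data.Maybe.Base as Maybe using (Maybe; just; nothing)
  open import Data.Nat.Base as ℕ using (ℕ; zero; suc)
  open import Data.Nat.Combinatorics using (_C_)
  open import Data.Nat.Coprimality using (Coprime)
  open import Data.Product.Base using (_×_; _,_; proj₁; proj₂; Σ)
  open import Data.Rational.Base as ℚ using (ℚ; mkℚ)
  open import Data.Sum.Base using (_⊎_; inj₁; inj₂)
  open import Data.Unit.Base using (tt)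
  open import Data.Vec.Base as Vec using (Vec; []; _∷_; lookup; allFin)
  open import Function.Base using (_∘_)
  open import Function.Definitions using (Injective)
  open import Relation.Binary.Definitions using (tri<; tri≈; tri>)
  open import Relation.Binary.PropositionalEquality
  open import Relation.Nullary using (¬_)
  open import Relation.Nullary.Decidable using (Dec; yes; no; does; from-yes; map′; dec-true; dec-false)
  open +-*-Solver using (solve; _:=_; con; _:+_; _:*_; _:^_)

  -- Sums over tuples

  square-nonneg : ∀ i → 0ℤ ≤ i * i
  square-nonneg (+ zero) = ℤₚ.≤-refl
  square-nonneg (+ suc n) = ℤ.+≤+ ℕ.z≤n
  square-nonneg (ℤ.-[1+ n ]) = ℤ.+≤+ ℕ.z≤n

  sum-mono : ∀ {n} {f g : Fin n → ℤ} → (∀ i → f i ≤ g i) → sum f ≤ sum g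
  sum-mono {zero} f≤g = ℤₚ.≤-refl
  sum-mono {suc n} f≤g = ℤₚ.+-mono-≤ (f≤g zero) (sum-mono (f≤g ∘ suc))

  sum-const : ∀ n c → sum {n} (λ _ → c) ≡ + n * c
  sum-const zero c = sym (ℤₚ.*-zeroˡ c)
  sum-const (suc n) c = trans (cong (_+_ c) (sum-const n c)) (sym (ℤₚ.suc-* (+ n) c))

  module _ {A : Set} where

    ∑ₗ : List A → (A → ℤ) → ℤ
    ∑ₗ xs f = foldr (λ x s → f x + s) 0ℤ xs

    ∑ₗ-cong : ∀ xs {f g : A → ℤ} → (∀ x → f x ≡ g x) → ∑ₗ xs f ≡ ∑ₗ xs g
    ∑ₗ-cong [] f≗g = refl
    ∑ₗ-cong (x ∷ xs) f≗g = cong₂ _+_ (f≗g x) (∑ₗ-cong xs f≗g)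

    ∑ₗ-const : ∀ (xs : List A) c → ∑ₗ xs (λ _ → c) ≡ + length xs * c
    ∑ₗ-const [] c = sym (ℤₚ.*-zeroˡ c)
    ∑ₗ-const (x ∷ xs) c = trans (cong (_+_ c) (∑ₗ-const xs c)) (sym (ℤₚ.suc-* (+ length xs) c))

    ∑ₗ-nonneg : ∀ xs {f : A → ℤ} → (∀ x → 0ℤ ≤ f x) → 0ℤ ≤ ∑ₗ xs f
    ∑ₗ-nonneg [] 0≤f = ℤₚ.≤-refl
    ∑ₗ-nonneg (x ∷ xs) 0≤f = ℤₚ.+-mono-≤ (0≤f x) (∑ₗ-nonneg xs 0≤f)

  gramForm : ∀ {I : Set} → List (ℕ × (I → ℤ)) → I → I → ℤ
  gramForm squares i j = ∑ₗ squares (λ s → + proj₁ s * (proj₂ s i * proj₂ s j))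

  ∑ᵛ : ∀ {n} k → (Vec (Fin n) k → ℤ) → ℤ
  ∑ᵛ zero F = F []
  ∑ᵛ (suc k) F = sum (λ a → ∑ᵛ k (λ x → F (a ∷ x)))

  -- Adjacent transpositions serve as generators throughout: on a sum over tuples each of them
  -- exchanges two consecutive summations.
  swapAt : ∀ {A : Set} {k} → Fin k → Vec A (suc k) → Vec A (suc k)
  swapAt zero (x ∷ y ∷ xs) = y ∷ x ∷ xs
  swapAt (suc i) (x ∷ xs) = x ∷ swapAt i xs

  module _ {n : ℕ} where

    private
      V : ℕ → Set
      V = Vec (Fin n)

    ∑ᵛ-cong : ∀ k {F G : V k → ℤ} → (∀ x → F x ≡ G x) → ∑ᵛ k F ≡ ∑ᵛ k G
    ∑ᵛ-cong zero F≗G = F≗G []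
    ∑ᵛ-cong (suc k) F≗G = sum-cong-≗ λ a → ∑ᵛ-cong k λ x → F≗G (a ∷ x)

    ∑ᵛ-mono : ∀ k {F G : V k → ℤ} → (∀ x → F x ≤ G x) → ∑ᵛ k F ≤ ∑ᵛ k G
    ∑ᵛ-mono zero F≤G = F≤G []
    ∑ᵛ-mono (suc k) F≤G = sum-mono λ a → ∑ᵛ-mono k λ x → F≤G (a ∷ x)

    ∑ᵛ-+ : ∀ k (F G : V k → ℤ) → ∑ᵛ k (λ x → F x + G x) ≡ ∑ᵛ k F + ∑ᵛ k G
    ∑ᵛ-+ zero F G = refl
    ∑ᵛ-+ (suc k) F G = trans (sum-cong-≗ λ a → ∑ᵛ-+ k (λ x → F (a ∷ x)) (λ x → G (a ∷ x)))
      (∑-distrib-+ (λ a → ∑ᵛ k (λ x → F (a ∷ x))) (λ a → ∑ᵛ k (λ x → G (a ∷ x))))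

    *-distribˡ-∑ᵛ : ∀ k c (F : V k → ℤ) → c * ∑ᵛ k F ≡ ∑ᵛ k (λ x → c * F x)
    *-distribˡ-∑ᵛ zero c F = refl
    *-distribˡ-∑ᵛ (suc k) c F = trans (*-distribˡ-sum c (λ a → ∑ᵛ k (λ x → F (a ∷ x))))
      (sum-cong-≗ λ a → *-distribˡ-∑ᵛ k c (λ x → F (a ∷ x)))

    *-distribʳ-∑ᵛ : ∀ k c (F : V k → ℤ) → ∑ᵛ k F * c ≡ ∑ᵛ k (λ x → F x * c)
    *-distribʳ-∑ᵛ k c F = begin
      ∑ᵛ k F * c              ≡⟨ ℤₚ.*-comm (∑ᵛ k F) c ⟩
      c * ∑ᵛ k F              ≡⟨ *-distribˡ-∑ᵛ k c F ⟩
      ∑ᵛ k (λ x → c * F x)    ≡⟨ ∑ᵛ-cong k (λ x → ℤₚ.*-comm c (F x)) ⟩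
      ∑ᵛ k (λ x → F x * c)    ∎
      where open ≡-Reasoning

    ∑ᵛ-const : ∀ k c → ∑ᵛ k (λ (_ : V k) → c) ≡ (+ n) ^ k * c
    ∑ᵛ-const zero c = sym (ℤₚ.*-identityˡ c)
    ∑ᵛ-const (suc k) c = begin
      sum {n} (λ _ → ∑ᵛ k (λ (_ : V k) → c))  ≡⟨ sum-cong-≗ {n} (λ _ → ∑ᵛ-const k c) ⟩
      sum {n} (λ _ → (+ n) ^ k * c)           ≡⟨ sum-const n _ ⟩
      + n * ((+ n) ^ k * c)                   ≡⟨ ℤₚ.*-assoc (+ n) ((+ n) ^ k) c ⟨
      (+ n) ^ suc k * c                       ∎
      where open ≡-Reasoning

    ∑ᵛ-nonneg : ∀ k {F : V k → ℤ} → (∀ x → 0ℤ ≤ F x) → 0ℤ ≤ ∑ᵛ k F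
    ∑ᵛ-nonneg k {F} 0≤F = subst (_≤ ∑ᵛ k F)
      (trans (∑ᵛ-const k 0ℤ) (ℤₚ.*-zeroʳ ((+ n) ^ k))) (∑ᵛ-mono k 0≤F)

    ∑ᵛ-∑ₗ : ∀ k {A : Set} (xs : List A) (F : A → V k → ℤ) →
            ∑ᵛ k (λ x → ∑ₗ xs (λ t → F t x)) ≡ ∑ₗ xs (λ t → ∑ᵛ k (F t))
    ∑ᵛ-∑ₗ k [] F = trans (∑ᵛ-const k 0ℤ) (ℤₚ.*-zeroʳ ((+ n) ^ k))
    ∑ᵛ-∑ₗ k (t ∷ ts) F = trans (∑ᵛ-+ k (F t) _) (cong (_+_ (∑ᵛ k (F t))) (∑ᵛ-∑ₗ k ts F))

    ∑ᵛ-swapAt : ∀ {k} i (F : V (suc k) → ℤ) → ∑ᵛ (suc k) (λ x → F (swapAt i x)) ≡ ∑ᵛ (suc k) F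
    ∑ᵛ-swapAt zero F = ∑-comm (λ a b → ∑ᵛ _ (λ x → F (b ∷ a ∷ x)))
    ∑ᵛ-swapAt (suc i) F = sum-cong-≗ λ a → ∑ᵛ-swapAt i (λ x → F (a ∷ x))

    -- x and y run independently, so a square with weight w and vector v contributes w times the
    -- square of the single sum of v (class x). The factor L + 1 clears the denominators of the
    -- decomposition, and as a successor it can be cancelled.
    gram-nonneg : ∀ {I : Set} (W : I → I → ℤ) (L : ℕ) (squares : List (ℕ × (I → ℤ))) →
      (∀ i j → + suc L * W i j ≡ gramForm squares i j) →
      ∀ k (class : V k → I) → 0ℤ ≤ ∑ᵛ k (λ x → ∑ᵛ k (λ y → W (class x) (class y)))
    gram-nonneg W L squares W≡ k class = ℤₚ.*-cancelˡ-≤-pos 0ℤ _ (+ suc L) (begin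
      + suc L * 0ℤ            ≡⟨ ℤₚ.*-zeroʳ (+ suc L) ⟩
      0ℤ                      ≤⟨ ∑ₗ-nonneg squares nonneg ⟩
      ∑ₗ squares (λ s → + proj₁ s * (total s * total s)) ≡⟨ expand ⟨
      + suc L * ∑ᵛ k (λ x → ∑ᵛ k (λ y → W (class x) (class y))) ∎)
      where
      open ℤₚ.≤-Reasoning
      total : ℕ × (_ → ℤ) → ℤ
      total s = ∑ᵛ k (λ x → proj₂ s (class x))
      nonneg : ∀ s → 0ℤ ≤ + proj₁ s * (total s * total s)
      nonneg (w , v) = subst (_≤ + w * (total (w , v) * total (w , v))) (ℤₚ.*-zeroʳ (+ w))
        (ℤₚ.*-monoˡ-≤-nonNeg (+ w) (square-nonneg (total (w , v))))
      term : ∀ s → ∑ᵛ k (λ x → ∑ᵛ k (λ y → + proj₁ s * (proj₂ s (class x) * proj₂ s (class y))))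
                 ≡ + proj₁ s * (total s * total s)
      term (w , v) = begin-equality
        ∑ᵛ k (λ x → ∑ᵛ k (λ y → + w * (v (class x) * v (class y))))
          ≡⟨ ∑ᵛ-cong k (λ x → sym (*-distribˡ-∑ᵛ k (+ w) _)) ⟩
        ∑ᵛ k (λ x → + w * ∑ᵛ k (λ y → v (class x) * v (class y)))
          ≡⟨ *-distribˡ-∑ᵛ k (+ w) _ ⟨
        + w * ∑ᵛ k (λ x → ∑ᵛ k (λ y → v (class x) * v (class y)))
          ≡⟨ cong (+ w *_) (∑ᵛ-cong k (λ x → sym (*-distribˡ-∑ᵛ k (v (class x)) _))) ⟩
        + w * ∑ᵛ k (λ x → v (class x) * total (w , v))
          ≡⟨ cong (+ w *_) (sym (*-distribʳ-∑ᵛ k (total (w , v)) _)) ⟩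
        + w * (total (w , v) * total (w , v)) ∎
      expand : + suc L * ∑ᵛ k (λ x → ∑ᵛ k (λ y → W (class x) (class y)))
             ≡ ∑ₗ squares (λ s → + proj₁ s * (total s * total s))
      expand = begin-equality
        + suc L * ∑ᵛ k (λ x → ∑ᵛ k (λ y → W (class x) (class y)))
          ≡⟨ *-distribˡ-∑ᵛ k (+ suc L) _ ⟩
        ∑ᵛ k (λ x → + suc L * ∑ᵛ k (λ y → W (class x) (class y)))
          ≡⟨ ∑ᵛ-cong k (λ x → trans (*-distribˡ-∑ᵛ k (+ suc L) _) (∑ᵛ-cong k λ y → W≡ (class x) (class y))) ⟩
        ∑ᵛ k (λ x → ∑ᵛ k (λ y → ∑ₗ squares (λ s → + proj₁ s * (proj₂ s (class x) * proj₂ s (class y)))))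
          ≡⟨ ∑ᵛ-cong k (λ x → ∑ᵛ-∑ₗ k squares _) ⟩
        ∑ᵛ k (λ x → ∑ₗ squares (λ s → ∑ᵛ k (λ y → + proj₁ s * (proj₂ s (class x) * proj₂ s (class y)))))
          ≡⟨ ∑ᵛ-∑ₗ k squares _ ⟩
        ∑ₗ squares (λ s → ∑ᵛ k (λ x → ∑ᵛ k (λ y → + proj₁ s * (proj₂ s (class x) * proj₂ s (class y)))))
          ≡⟨ ∑ₗ-cong squares term ⟩
        ∑ₗ squares (λ s → + proj₁ s * (total s * total s)) ∎

    -- Used at each induced K₄⁻, where the objective is a constant added to the form of that type.
    shifted-gram : ∀ {I : Set} (W : I → I → ℤ) (L : ℕ) (squares : List (ℕ × (I → ℤ))) →
      (∀ i j → + suc L * W i j ≡ gramForm squares i j) →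
      ∀ k (class : V k → I) c → (+ n) ^ k * ((+ n) ^ k * c) ≤ ∑ᵛ k (λ x → ∑ᵛ k (λ y → c + W (class x) (class y)))
    shifted-gram W L squares W≡ k class c = begin
      (+ n) ^ k * ((+ n) ^ k * c)          ≡⟨ constant ⟨
      ∑ᵛ k (λ _ → s)                       ≡⟨ ℤₚ.+-identityʳ _ ⟨
      ∑ᵛ k (λ _ → s) + 0ℤ                  ≤⟨ ℤₚ.+-monoʳ-≤ (∑ᵛ k (λ _ → s)) (gram-nonneg W L squares W≡ k class) ⟩
      ∑ᵛ k (λ _ → s) + ∑ᵛ k rest           ≡⟨ ∑ᵛ-+ k (λ _ → s) rest ⟨
      ∑ᵛ k (λ x → s + rest x)              ≡⟨ ∑ᵛ-cong k (λ x → sym (∑ᵛ-+ k (λ _ → c) (λ y → W (class x) (class y)))) ⟩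
      ∑ᵛ k (λ x → ∑ᵛ k (λ y → c + W (class x) (class y)))  ∎
      where
      open ℤₚ.≤-Reasoning
      s : ℤ
      s = ∑ᵛ k (λ (_ : V k) → c)
      rest : V k → ℤ
      rest x = ∑ᵛ k (λ y → W (class x) (class y))
      constant : ∑ᵛ k (λ (_ : V k) → s) ≡ (+ n) ^ k * ((+ n) ^ k * c)
      constant = trans (∑ᵛ-const k s) (cong ((+ n) ^ k *_) (∑ᵛ-const k c))

  -- The certificate

  count₂ : Bool → Bool → Fin 3
  count₂ false false = 0F
  count₂ false true  = 1F
  count₂ true  false = 1F
  count₂ true  true  = 2F

  count₃ : Bool → Bool → Bool → Fin 4
  count₃ false false false = 0F
  count₃ false false true  = 1F
  count₃ false true  false = 1F
  count₃ false true  true  = 2F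
  count₃ true  false false = 1F
  count₃ true  false true  = 2F
  count₃ true  true  false = 2F
  count₃ true  true  true  = 3F

  count₂-comm : ∀ p q → count₂ p q ≡ count₂ q p
  count₂-comm false false = refl
  count₂-comm false true  = refl
  count₂-comm true  false = refl
  count₂-comm true  true  = refl

  count₃-swapˡ : ∀ p q r → count₃ p q r ≡ count₃ q p r
  count₃-swapˡ false false r = refl
  count₃-swapˡ false true  false = refl
  count₃-swapˡ false true  true  = refl
  count₃-swapˡ true  false false = refl
  count₃-swapˡ true  false true  = refl
  count₃-swapˡ true  true  r = refl

  count₃-swapʳ : ∀ p q r → count₃ p q r ≡ count₃ p r q
  count₃-swapʳ p false false = refl
  count₃-swapʳ false false true  = refl
  count₃-swapʳ true  false true  = refl
  count₃-swapʳ false true  false = refl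
  count₃-swapʳ true  true  false = refl
  count₃-swapʳ p true  true  = refl

  -- The tables of the forms Q_τ, found by semidefinite programming and rounded
  -- within the space of forms that are tight on Turán's construction. A flag over
  -- an induced K₄⁻ is recorded by the numbers of edges in which its new vertex meets
  -- two points of the K₄⁻, counted with and without the apex; a flag over a
  -- non-edge by one such number; a flag {c, d} over a pair {x, y} by the numbers of
  -- edges among xyc, xyd and among xcd, ycd.
  W₄ : Fin 4 → Fin 4 → Fin 4 → Fin 4 → ℤ
  W₄ 2F 0F 2F 0F = + 64260
  W₄ 2F 0F 3F 0F = + 29466
  W₄ 2F 0F 0F 1F = + 74232
  W₄ 2F 0F 1F 1F = + 3492
  W₄ 2F 0F 1F 2F = + 16992
  W₄ 2F 0F 2F 2F = - + 11538
  W₄ 2F 0F 0F 3F = - + 58932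
  W₄ 2F 0F 1F 3F = - + 17928
  W₄ 3F 0F 2F 0F = + 29466
  W₄ 3F 0F 3F 0F = + 13869
  W₄ 3F 0F 0F 1F = + 29394
  W₄ 3F 0F 1F 1F = - + 1602
  W₄ 3F 0F 1F 2F = + 12168
  W₄ 3F 0F 2F 2F = - + 3969
  W₄ 3F 0F 0F 3F = - + 27738
  W₄ 3F 0F 1F 3F = - + 9900
  W₄ 0F 1F 2F 0F = + 74232
  W₄ 0F 1F 3F 0F = + 29394
  W₄ 0F 1F 0F 1F = + 233712
  W₄ 0F 1F 1F 1F = + 31788
  W₄ 0F 1F 1F 2F = - + 50112
  W₄ 0F 1F 2F 2F = - + 24930
  W₄ 0F 1F 0F 3F = - + 58788
  W₄ 0F 1F 1F 3F = - + 4464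
  W₄ 1F 1F 2F 0F = + 3492
  W₄ 1F 1F 3F 0F = - + 1602
  W₄ 1F 1F 0F 1F = + 31788
  W₄ 1F 1F 1F 1F = + 38808
  W₄ 1F 1F 1F 2F = - + 43092
  W₄ 1F 1F 2F 2F = - + 16866
  W₄ 1F 1F 0F 3F = + 3204
  W₄ 1F 1F 1F 3F = + 18468
  W₄ 1F 2F 2F 0F = + 16992
  W₄ 1F 2F 3F 0F = + 12168
  W₄ 1F 2F 0F 1F = - + 50112
  W₄ 1F 2F 1F 1F = - + 43092
  W₄ 1F 2F 1F 2F = + 66168
  W₄ 1F 2F 2F 2F = + 15444
  W₄ 1F 2F 0F 3F = - + 24336
  W₄ 1F 2F 1F 3F = - + 27612
  W₄ 2F 2F 2F 0F = - + 11538
  W₄ 2F 2F 3F 0F = - + 3969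
  W₄ 2F 2F 0F 1F = - + 24930
  W₄ 2F 2F 1F 1F = - + 16866
  W₄ 2F 2F 1F 2F = + 15444
  W₄ 2F 2F 2F 2F = + 8973
  W₄ 2F 2F 0F 3F = + 7938
  W₄ 2F 2F 1F 3F = - + 5004
  W₄ 0F 3F 2F 0F = - + 58932
  W₄ 0F 3F 3F 0F = - + 27738
  W₄ 0F 3F 0F 1F = - + 58788
  W₄ 0F 3F 1F 1F = + 3204
  W₄ 0F 3F 1F 2F = - + 24336
  W₄ 0F 3F 2F 2F = + 7938
  W₄ 0F 3F 0F 3F = + 55476
  W₄ 0F 3F 1F 3F = + 19800
  W₄ 1F 3F 2F 0F = - + 17928
  W₄ 1F 3F 3F 0F = - + 9900
  W₄ 1F 3F 0F 1F = - + 4464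
  W₄ 1F 3F 1F 1F = + 18468
  W₄ 1F 3F 1F 2F = - + 27612
  W₄ 1F 3F 2F 2F = - + 5004
  W₄ 1F 3F 0F 3F = + 19800
  W₄ 1F 3F 1F 3F = + 14904
  W₄ _ _ _ _ = 0ℤ

  W₂ : Fin 3 → Fin 3 → Fin 3 → Fin 3 → ℤ
  W₂ 0F 0F 0F 0F = + 9468
  W₂ 0F 0F 0F 1F = + 11712
  W₂ 0F 0F 0F 2F = + 8596
  W₂ 0F 0F 1F 0F = + 4032
  W₂ 0F 0F 1F 1F = + 1518
  W₂ 0F 0F 1F 2F = - + 5292
  W₂ 0F 0F 2F 0F = - + 15832
  W₂ 0F 0F 2F 1F = - + 480
  W₂ 0F 1F 0F 0F = + 11712
  W₂ 0F 1F 0F 1F = + 43968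
  W₂ 0F 1F 0F 2F = - + 9024
  W₂ 0F 1F 1F 0F = - + 9936
  W₂ 0F 1F 1F 1F = + 10848
  W₂ 0F 1F 1F 2F = + 7392
  W₂ 0F 1F 2F 0F = - + 55680
  W₂ 0F 1F 2F 1F = - + 12048
  W₂ 0F 2F 0F 0F = + 8596
  W₂ 0F 2F 0F 1F = - + 9024
  W₂ 0F 2F 0F 2F = + 97748
  W₂ 0F 2F 1F 0F = + 22608
  W₂ 0F 2F 1F 1F = + 3054
  W₂ 0F 2F 1F 2F = - + 25592
  W₂ 0F 2F 2F 0F = - + 21168
  W₂ 0F 2F 2F 1F = + 9120
  W₂ 1F 0F 0F 0F = + 4032
  W₂ 1F 0F 0F 1F = - + 9936
  W₂ 1F 0F 0F 2F = + 22608
  W₂ 1F 0F 1F 0F = + 11856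
  W₂ 1F 0F 1F 1F = - + 4416
  W₂ 1F 0F 1F 2F = - + 11712
  W₂ 1F 0F 2F 0F = + 12144
  W₂ 1F 0F 2F 1F = + 7056
  W₂ 1F 1F 0F 0F = + 1518
  W₂ 1F 1F 0F 1F = + 10848
  W₂ 1F 1F 0F 2F = + 3054
  W₂ 1F 1F 1F 0F = - + 4416
  W₂ 1F 1F 1F 1F = + 5091
  W₂ 1F 1F 1F 2F = + 3270
  W₂ 1F 1F 2F 0F = - + 20688
  W₂ 1F 1F 2F 1F = - + 4560
  W₂ 1F 2F 0F 0F = - + 5292
  W₂ 1F 2F 0F 1F = + 7392
  W₂ 1F 2F 0F 2F = - + 25592
  W₂ 1F 2F 1F 0F = - + 11712
  W₂ 1F 2F 1F 1F = + 3270
  W₂ 1F 2F 1F 2F = + 12048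
  W₂ 1F 2F 2F 0F = - + 6724
  W₂ 1F 2F 2F 1F = - + 6336
  W₂ 2F 0F 0F 0F = - + 15832
  W₂ 2F 0F 0F 1F = - + 55680
  W₂ 2F 0F 0F 2F = - + 21168
  W₂ 2F 0F 1F 0F = + 12144
  W₂ 2F 0F 1F 1F = - + 20688
  W₂ 2F 0F 1F 2F = - + 6724
  W₂ 2F 0F 2F 0F = + 95560
  W₂ 2F 0F 2F 1F = + 17664
  W₂ 2F 1F 0F 0F = - + 480
  W₂ 2F 1F 0F 1F = - + 12048
  W₂ 2F 1F 0F 2F = + 9120
  W₂ 2F 1F 1F 0F = + 7056
  W₂ 2F 1F 1F 1F = - + 4560
  W₂ 2F 1F 1F 2F = - + 6336
  W₂ 2F 1F 2F 0F = + 17664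
  W₂ 2F 1F 2F 1F = + 5568
  W₂ _ _ _ _ = 0ℤ

  W₃ : Fin 4 → Fin 4 → ℤ
  W₃ 0F 0F = + 5187
  W₃ 0F 2F = + 5187
  W₃ 0F 3F = - + 10374
  W₃ 2F 0F = + 5187
  W₃ 2F 2F = + 5187
  W₃ 2F 3F = - + 10374
  W₃ 3F 0F = - + 10374
  W₃ 3F 2F = - + 10374
  W₃ 3F 3F = + 20748
  W₃ _ _ = 0ℤ

  onK₄⁻ : Vec ℤ 8 → Fin 4 × Fin 4 → ℤ
  onK₄⁻ (p ∷ _ ∷ _ ∷ _ ∷ _ ∷ _ ∷ _ ∷ _ ∷ []) (2F , 0F) = p
  onK₄⁻ (_ ∷ q ∷ _ ∷ _ ∷ _ ∷ _ ∷ _ ∷ _ ∷ []) (3F , 0F) = q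
  onK₄⁻ (_ ∷ _ ∷ r ∷ _ ∷ _ ∷ _ ∷ _ ∷ _ ∷ []) (0F , 1F) = r
  onK₄⁻ (_ ∷ _ ∷ _ ∷ s ∷ _ ∷ _ ∷ _ ∷ _ ∷ []) (1F , 1F) = s
  onK₄⁻ (_ ∷ _ ∷ _ ∷ _ ∷ t ∷ _ ∷ _ ∷ _ ∷ []) (1F , 2F) = t
  onK₄⁻ (_ ∷ _ ∷ _ ∷ _ ∷ _ ∷ u ∷ _ ∷ _ ∷ []) (2F , 2F) = u
  onK₄⁻ (_ ∷ _ ∷ _ ∷ _ ∷ _ ∷ _ ∷ v ∷ _ ∷ []) (0F , 3F) = v
  onK₄⁻ (_ ∷ _ ∷ _ ∷ _ ∷ _ ∷ _ ∷ _ ∷ w ∷ []) (1F , 3F) = w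
  onK₄⁻ _ _ = 0ℤ

  onPair : Vec ℤ 8 → Fin 3 × Fin 3 → ℤ
  onPair (p ∷ _ ∷ _ ∷ _ ∷ _ ∷ _ ∷ _ ∷ _ ∷ []) (0F , 0F) = p
  onPair (_ ∷ q ∷ _ ∷ _ ∷ _ ∷ _ ∷ _ ∷ _ ∷ []) (0F , 1F) = q
  onPair (_ ∷ _ ∷ r ∷ _ ∷ _ ∷ _ ∷ _ ∷ _ ∷ []) (0F , 2F) = r
  onPair (_ ∷ _ ∷ _ ∷ s ∷ _ ∷ _ ∷ _ ∷ _ ∷ []) (1F , 0F) = s
  onPair (_ ∷ _ ∷ _ ∷ _ ∷ t ∷ _ ∷ _ ∷ _ ∷ []) (1F , 1F) = t
  onPair (_ ∷ _ ∷ _ ∷ _ ∷ _ ∷ u ∷ _ ∷ _ ∷ []) (1F , 2F) = u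
  onPair (_ ∷ _ ∷ _ ∷ _ ∷ _ ∷ _ ∷ v ∷ _ ∷ []) (2F , 0F) = v
  onPair (_ ∷ _ ∷ _ ∷ _ ∷ _ ∷ _ ∷ _ ∷ w ∷ []) (2F , 1F) = w
  onPair _ _ = 0ℤ

  -- A rational triangular decomposition with denominators cleared. Six squares on eight flags leave
  -- a kernel of dimension two, spanned by the flag frequencies over the two kinds of induced K₄⁻ in
  -- Turán's construction: 2 (3,0) + (0,3) for an apex in class 1 over base classes 000, and (3,0) +
  -- (2,2) + (1,3) for the same apex over base classes 002.
  squares₄ : List (ℕ × (Fin 4 × Fin 4 → ℤ))
  squares₄ =
    (1478839154180353863614369816325639 , onK₄⁻ (+ 3570 ∷ + 1637 ∷ + 4124 ∷ + 194 ∷ + 944 ∷ - + 641 ∷ - + 3274 ∷ - + 996 ∷ [])) ∷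
    (83413568400944997665653438791 , onK₄⁻ (+ 0 ∷ + 35458 ∷ - + 460589 ∷ - + 317654 ∷ + 433996 ∷ + 131066 ∷ - + 70916 ∷ - + 166524 ∷ [])) ∷
    (862556025583538748132705 , onK₄⁻ (+ 0 ∷ + 0 ∷ + 172618607 ∷ - + 27292730 ∷ - + 25396420 ∷ + 10965676 ∷ + 0 ∷ - + 10965676 ∷ [])) ∷
    (1650070790028791820 , onK₄⁻ (+ 0 ∷ + 0 ∷ + 0 ∷ + 37070544779 ∷ - + 32831555351 ∷ - + 16871146281 ∷ + 0 ∷ + 16871146281 ∷ [])) ∷
    (46823435837595900 , onK₄⁻ (+ 0 ∷ + 0 ∷ + 0 ∷ + 0 ∷ + 30415636543 ∷ + 4291769044 ∷ + 0 ∷ - + 4291769044 ∷ [])) ∷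
    (17028537646318369682305366824331193100 , onK₄⁻ (+ 0 ∷ + 0 ∷ + 0 ∷ + 0 ∷ + 0 ∷ + 1 ∷ + 0 ∷ - + 1 ∷ [])) ∷
    []

  -- Again the kernel has dimension two. It is spanned by the flag frequencies in Turán's
  -- construction over a pair inside one class, 3 (0,0) + 4 (1,2) + (0,2) + (2,0), and over a pair
  -- from two classes, (0,0) + 2 (1,1) + 2 (1,2) + 4 (2,1).
  squares₂ : List (ℕ × (Fin 3 × Fin 3 → ℤ))
  squares₂ =
    (193938526378959355329685889663844214255 , onPair (+ 4734 ∷ + 5856 ∷ + 4298 ∷ + 2016 ∷ + 759 ∷ - + 2646 ∷ - + 7916 ∷ - + 240 ∷ [])) ∷
    (6403517318220623396085216547570076 , onPair (+ 0 ∷ + 1453740 ∷ - + 969352 ∷ - + 735921 ∷ + 442344 ∷ + 687330 ∷ - + 1779968 ∷ - + 564837 ∷ [])) ∷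
    (723707234630750743016202366 , onPair (+ 0 ∷ + 0 ∷ + 6981241754 ∷ + 817392132 ∷ + 695718087 ∷ - + 1044274455 ∷ - + 2804143934 ∷ + 174278184 ∷ [])) ∷
    (3543820495793617861620 , onPair (+ 0 ∷ + 0 ∷ + 0 ∷ + 445316921323 ∷ - + 412480460510 ∷ - + 307400204320 ∷ + 1229600817280 ∷ + 359940332415 ∷ [])) ∷
    (18016853165338293990 , onPair (+ 0 ∷ + 0 ∷ + 0 ∷ + 0 ∷ + 1029880220489 ∷ + 1085049219951 ∷ - + 4340196879804 ∷ - + 1057464720220 ∷ [])) ∷
    (594897730092279598043979280995738675960240 , onPair (+ 0 ∷ + 0 ∷ + 0 ∷ + 0 ∷ + 0 ∷ + 2 ∷ - + 8 ∷ - + 1 ∷ [])) ∷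
    []

  -- The vector is orthogonal to 2 (0) + (3) and to (0) + (2) + (3), the frequencies of edge counts
  -- over the non-edges of classes 000 and 002 in Turán's construction.
  squares₃ : List (ℕ × (Fin 4 → ℤ))
  squares₃ = (5187 , λ { 0F → + 1 ; 1F → 0ℤ ; 2F → + 1 ; 3F → - + 2 }) ∷ []

  ∀₂-≟ : ∀ {m n} (f g : Fin m → Fin n → ℤ) → Dec (∀ a b → f a b ≡ g a b)
  ∀₂-≟ f g = Finₚ.all? λ a → Finₚ.all? λ b → f a b ℤₚ.≟ g a b

  ∀₄-≟ : ∀ {m} (f g : Fin m → Fin m → Fin m → Fin m → ℤ) → Dec (∀ a b c d → f a b c d ≡ g a b c d)
  ∀₄-≟ f g = Finₚ.all? λ a → Finₚ.all? λ b → ∀₂-≟ (f a b) (g a b)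

  L₄ L₂ : ℕ
  L₄ = 293303098912436849616850013571251734
  L₂ = 459052491938996794065366500834319255141584

  pair₄ : Fin 4 × Fin 4 → Fin 4 × Fin 4 → ℤ
  pair₄ (a , b) (c , d) = W₄ a b c d

  pair₂ : Fin 3 × Fin 3 → Fin 3 × Fin 3 → ℤ
  pair₂ (a , b) (c , d) = W₂ a b c d

  gram₄ : ∀ i j → + suc L₄ * pair₄ i j ≡ gramForm squares₄ i j
  gram₄ (a , b) (c , d) = from-yes (∀₄-≟ (λ a b c d → + suc L₄ * pair₄ (a , b) (c , d))
                                         (λ a b c d → gramForm squares₄ (a , b) (c , d))) a b c d

  gram₂ : ∀ i j → + suc L₂ * pair₂ i j ≡ gramForm squares₂ i j
  gram₂ (a , b) (c , d) = from-yes (∀₄-≟ (λ a b c d → + suc L₂ * pair₂ (a , b) (c , d))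
                                         (λ a b c d → gramForm squares₂ (a , b) (c , d))) a b c d

  gram₃ : ∀ a b → 1ℤ * W₃ a b ≡ gramForm squares₃ a b
  gram₃ = from-yes (∀₂-≟ (λ a b → 1ℤ * W₃ a b) (gramForm squares₃))

  W₄-sym : ∀ a b c d → W₄ a b c d ≡ W₄ c d a b
  W₄-sym = from-yes (∀₄-≟ W₄ (λ a b c d → W₄ c d a b))

  W₂-sym : ∀ a b c d → W₂ a b c d ≡ W₂ c d a b
  W₂-sym = from-yes (∀₄-≟ W₂ (λ a b c d → W₂ c d a b))

  W₃-sym : ∀ a b → W₃ a b ≡ W₃ b a
  W₃-sym = from-yes (∀₂-≟ W₃ (λ a b → W₃ b a))

  -- Colourings of the triples of six points

  Arrangement : Set
  Arrangement = Vec (Fin 6) 6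

  identity : Arrangement
  identity = allFin 6

  -- The triples are in colexicographic order: the first ten describe the points 0 to 4, the last
  -- ten the sixth point, and `base` and `apex` split a colouring there.
  record Colouring : Set where
    constructor colouring
    field
      e012 e013 e023 e123 e014 e024 e124 e034 e134 e234 : Bool
      e015 e025 e125 e035 e135 e235 e045 e145 e245 e345 : Bool

  open Colouring

  colouringOf : (Fin 6 → Fin 6 → Fin 6 → Bool) → Colouring
  colouringOf f = colouring
    (f 0F 1F 2F) (f 0F 1F 3F) (f 0F 2F 3F) (f 1F 2F 3F) (f 0F 1F 4F)
    (f 0F 2F 4F) (f 1F 2F 4F) (f 0F 3F 4F) (f 1F 3F 4F) (f 2F 3F 4F)
    (f 0F 1F 5F) (f 0F 2F 5F) (f 1F 2F 5F) (f 0F 3F 5F) (f 1F 3F 5F)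
    (f 2F 3F 5F) (f 0F 4F 5F) (f 1F 4F 5F) (f 2F 4F 5F) (f 3F 4F 5F)

  colouringOf-cong : ∀ {f g} → (∀ i j k → f i j k ≡ g i j k) → colouringOf f ≡ colouringOf g
  colouringOf-cong f≗g
    rewrite f≗g 0F 1F 2F | f≗g 0F 1F 3F | f≗g 0F 2F 3F | f≗g 1F 2F 3F | f≗g 0F 1F 4F
          | f≗g 0F 2F 4F | f≗g 1F 2F 4F | f≗g 0F 3F 4F | f≗g 1F 3F 4F | f≗g 2F 3F 4F
          | f≗g 0F 1F 5F | f≗g 0F 2F 5F | f≗g 1F 2F 5F | f≗g 0F 3F 5F | f≗g 1F 3F 5F
          | f≗g 2F 3F 5F | f≗g 0F 4F 5F | f≗g 1F 4F 5F | f≗g 2F 4F 5F | f≗g 3F 4F 5F = refl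

  Triple : Set
  Triple = Fin 6 × Fin 6 × Fin 6

  _≟ₜ_ : (s t : Triple) → Dec (s ≡ t)
  _≟ₜ_ = Productₚ.≡-dec Finₚ._≟_ (Productₚ.≡-dec Finₚ._≟_ Finₚ._≟_)

  fields : List (Triple × (Colouring → Bool))
  fields =
    ((0F , 1F , 2F) , e012) ∷ ((0F , 1F , 3F) , e013) ∷ ((0F , 2F , 3F) , e023) ∷ ((1F , 2F , 3F) , e123) ∷
    ((0F , 1F , 4F) , e014) ∷ ((0F , 2F , 4F) , e024) ∷ ((1F , 2F , 4F) , e124) ∷ ((0F , 3F , 4F) , e034) ∷
    ((1F , 3F , 4F) , e134) ∷ ((2F , 3F , 4F) , e234) ∷ ((0F , 1F , 5F) , e015) ∷ ((0F , 2F , 5F) , e025) ∷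
    ((1F , 2F , 5F) , e125) ∷ ((0F , 3F , 5F) , e035) ∷ ((1F , 3F , 5F) , e135) ∷ ((2F , 3F , 5F) , e235) ∷
    ((0F , 4F , 5F) , e045) ∷ ((1F , 4F , 5F) , e145) ∷ ((2F , 4F , 5F) , e245) ∷ ((3F , 4F , 5F) , e345) ∷ []

  find : List (Triple × (Colouring → Bool)) → Triple → Colouring → Bool
  -- A triple with a repeated point sorts to something outside `fields` and reaches this default, in
  -- agreement with the irreflexivity of edges.
  find [] t = λ _ → false
  find ((s , f) ∷ fs) t = if does (t ≟ₜ s) then f else find fs t

  sort₃ : Fin 6 → Fin 6 → Fin 6 → Triple
  sort₃ i j k =
    if i <ᵇ j then (if j <ᵇ k then i , j , k else if i <ᵇ k then i , k , j else k , i , j)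
              else (if i <ᵇ k then j , i , k else if j <ᵇ k then j , k , i else k , j , i)

  edge : Fin 6 → Fin 6 → Fin 6 → Colouring → Bool
  edge i j k = find fields (sort₃ i j k)

  relabelBy : (f₀ f₁ f₂ f₃ f₄ f₅ f₆ f₇ f₈ f₉ g₀ g₁ g₂ g₃ g₄ g₅ g₆ g₇ g₈ g₉ : Colouring → Bool) →
              Colouring → Colouring
  relabelBy f₀ f₁ f₂ f₃ f₄ f₅ f₆ f₇ f₈ f₉ g₀ g₁ g₂ g₃ g₄ g₅ g₆ g₇ g₈ g₉ c = colouring
    (f₀ c) (f₁ c) (f₂ c) (f₃ c) (f₄ c) (f₅ c) (f₆ c) (f₇ c) (f₈ c) (f₉ c)
    (g₀ c) (g₁ c) (g₂ c) (g₃ c) (g₄ c) (g₅ c) (g₆ c) (g₇ c) (g₈ c) (g₉ c)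

  -- The argument c is not bound here, so that the tables of a partially applied
  -- relabel t are evaluated once and shared by all colourings.
  relabel : Arrangement → Colouring → Colouring
  relabel (p ∷ q ∷ r ∷ s ∷ t ∷ u ∷ []) = relabelBy
    (edge p q r) (edge p q s) (edge p r s) (edge q r s) (edge p q t)
    (edge p r t) (edge q r t) (edge p s t) (edge q s t) (edge r s t)
    (edge p q u) (edge p r u) (edge q r u) (edge p s u) (edge q s u)
    (edge r s u) (edge p t u) (edge q t u) (edge r t u) (edge s t u)

  -- The objective is the constant r added to the form of the type K₄⁻: both live on the same roots,
  -- so they share their arrangements.
  weight₄ : ℤ → Bool → Fin 4 → Fin 4 → Fin 4 → Fin 4 → ℤ
  weight₄ r false a b c d = 0ℤ
  weight₄ r true  a b c d = r + W₄ a b c d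

  weight₃ : Bool → Fin 4 → Fin 4 → ℤ
  weight₃ true  a b = 0ℤ
  weight₃ false a b = W₃ a b

  -- Roles of the six points: apex 0, base 123, flags 4 and 5 in apexTerm; non-edge
  -- 012, flags 3 and 4 in q₃; pair 01, flags 23 and 45 in q₂.
  apexTerm : ℤ → Colouring → ℤ
  apexTerm r c = weight₄ r (e012 c ∧ e013 c ∧ e023 c ∧ not (e123 c))
    (count₃ (e014 c) (e024 c) (e034 c)) (count₃ (e124 c) (e134 c) (e234 c))
    (count₃ (e015 c) (e025 c) (e035 c)) (count₃ (e125 c) (e135 c) (e235 c))

  q₄ q₃ q₂ : Colouring → ℤ
  q₄ = apexTerm (+ 82944)
  q₃ c = weight₃ (e012 c) (count₃ (e013 c) (e023 c) (e123 c)) (count₃ (e014 c) (e024 c) (e124 c))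
  q₂ c = W₂ (count₂ (e012 c) (e013 c)) (count₂ (e023 c) (e123 c))
            (count₂ (e014 c) (e015 c)) (count₂ (e045 c) (e145 c))

  Move : Set
  Move = (Fin 6 × Fin 6) × (Arrangement → Arrangement)

  -- A sorting network made of the symmetries of a term. Permuting positions by a move leaves the
  -- term unchanged, so arrangements with the same tidied form give the same value, and the fixed
  -- arrangements represent the cosets.
  tidy : List Move → Arrangement → Arrangement
  tidy [] t = t
  tidy (((i , j) , m) ∷ ms) t = tidy ms (if lookup t j <ᵇ lookup t i then m t else t)

  tidy-reflects : ∀ {ℓ} (Φ : Arrangement → Set ℓ) ms →
    All (λ m → ∀ t → Φ (proj₂ m t) → Φ t) ms → ∀ t → Φ (tidy ms t) → Φ t
  tidy-reflects Φ [] [] t Φt = Φt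
  tidy-reflects Φ (((i , j) , m) ∷ ms) (h ∷ hs) t Φt
    with lookup t j <ᵇ lookup t i
  ... | true  = h t (tidy-reflects Φ ms hs (m t) Φt)
  ... | false = tidy-reflects Φ ms hs t Φt

  exchange : Arrangement → Arrangement
  exchange (x ∷ y ∷ c ∷ d ∷ e ∷ h ∷ []) = x ∷ y ∷ e ∷ h ∷ c ∷ d ∷ []

  moves₄ moves₃ moves₂ : List Move
  moves₄ = ((1F , 2F) , swapAt 1F) ∷ ((2F , 3F) , swapAt 2F) ∷ ((1F , 2F) , swapAt 1F) ∷ ((4F , 5F) , swapAt 4F) ∷ []
  moves₃ = ((0F , 1F) , swapAt 0F) ∷ ((1F , 2F) , swapAt 1F) ∷ ((0F , 1F) , swapAt 0F) ∷ ((3F , 4F) , swapAt 3F) ∷ []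
  moves₂ = ((0F , 1F) , swapAt 0F) ∷ ((2F , 3F) , swapAt 2F) ∷ ((4F , 5F) , swapAt 4F) ∷ ((2F , 4F) , exchange) ∷ []

  swaps : ∀ {A : Set} {k} → List (Fin k) → Vec A (suc k) → Vec A (suc k)
  swaps [] x = x
  swaps (i ∷ w) x = swaps w (swapAt i x)

  -- Every permutation of the first k + 1 positions is a product of descending
  -- runs of adjacent transpositions, one from each coset list.
  words₅ words₆ : List (List (Fin 5))
  words₅ = cartesianProductWith _++_ (inits (0F ∷ []))
    (cartesianProductWith _++_ (inits (1F ∷ 0F ∷ []))
    (cartesianProductWith _++_ (inits (2F ∷ 1F ∷ 0F ∷ [])) (inits (3F ∷ 2F ∷ 1F ∷ 0F ∷ []))))
  words₆ = cartesianProductWith _++_ words₅ (inits (4F ∷ 3F ∷ 2F ∷ 1F ∷ 0F ∷ []))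

  _≟ₐ_ : (s t : Arrangement) → Dec (s ≡ t)
  _≟ₐ_ = Vecₚ.≡-dec Finₚ._≟_

  representatives : List (List (Fin 5)) → List Move → List Arrangement
  representatives ws ms = filter (λ t → tidy ms t ≟ₐ t) (map (λ w → swaps w identity) ws)

  arrangements₄ arrangements₃ arrangements₂ : List Arrangement
  arrangements₄ = representatives words₆ moves₄
  arrangements₃ = representatives words₆ moves₃
  arrangements₂ = representatives words₆ moves₂

  -- With q ∘ r in place of after q r, the table of r would be recomputed at every c.
  after : (Colouring → ℤ) → (Colouring → Colouring) → Colouring → ℤ
  after q r c = q (r c)

  terms : (l₄ l₂ l₃ : List Arrangement) → List (Colouring → ℤ)
  terms l₄ l₂ l₃ = map (λ t → after q₄ (relabel t)) l₄ ++
                   map (λ t → after q₂ (relabel t)) l₂ ++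
                   map (λ t → after q₃ (relabel t)) l₃

  evaluate : List (Colouring → ℤ) → Colouring → ℤ
  evaluate fs c = ∑ₗ fs (λ f → f c)

  quads₅ quads₆ : List (Colouring → Bool)
  quads₅ = quad e012 e013 e023 e123 ∷ quad e012 e014 e024 e124 ∷ quad e013 e014 e034 e134 ∷
           quad e023 e024 e034 e234 ∷ quad e123 e124 e134 e234 ∷ []
    where
    quad : (p q r s : Colouring → Bool) → Colouring → Bool
    quad p q r s c = p c ∧ q c ∧ r c ∧ s c
  quads₆ = quads₅ ++
    quad e012 e015 e025 e125 ∷ quad e013 e015 e035 e135 ∷ quad e014 e015 e045 e145 ∷
    quad e023 e025 e035 e235 ∷ quad e024 e025 e045 e245 ∷ quad e034 e035 e045 e345 ∷
    quad e123 e125 e135 e235 ∷ quad e124 e125 e145 e245 ∷ quad e134 e135 e145 e345 ∷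
    quad e234 e235 e245 e345 ∷ []
    where
    quad : (p q r s : Colouring → Bool) → Colouring → Bool
    quad p q r s c = p c ∧ q c ∧ r c ∧ s c

  -- Exhaustive checks

  fromBits : Vec Bool 10 → Vec Bool 10 → Colouring
  fromBits (a ∷ b ∷ c ∷ d ∷ e ∷ f ∷ g ∷ h ∷ i ∷ j ∷ []) (a′ ∷ b′ ∷ c′ ∷ d′ ∷ e′ ∷ f′ ∷ g′ ∷ h′ ∷ i′ ∷ j′ ∷ []) =
    colouring a b c d e f g h i j a′ b′ c′ d′ e′ f′ g′ h′ i′ j′

  base apex : Colouring → Vec Bool 10
  base c = e012 c ∷ e013 c ∷ e023 c ∷ e123 c ∷ e014 c ∷ e024 c ∷ e124 c ∷ e034 c ∷ e134 c ∷ e234 c ∷ []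
  apex c = e015 c ∷ e025 c ∷ e125 c ∷ e035 c ∷ e135 c ∷ e235 c ∷ e045 c ∷ e145 c ∷ e245 c ∷ e345 c ∷ []

  allBits : ∀ k → (Vec Bool k → Bool) → Bool
  allBits zero    p = p []
  allBits (suc k) p = allBits k (p ∘ (false ∷_)) ∧ allBits k (p ∘ (true ∷_))

  bases : List (Vec Bool 10)
  bases =
    (f ∷ f ∷ f ∷ f ∷ f ∷ f ∷ f ∷ f ∷ f ∷ f ∷ []) ∷
    (t ∷ f ∷ f ∷ f ∷ f ∷ f ∷ f ∷ f ∷ f ∷ f ∷ []) ∷
    (t ∷ t ∷ f ∷ f ∷ f ∷ f ∷ f ∷ f ∷ f ∷ f ∷ []) ∷
    (t ∷ t ∷ t ∷ f ∷ f ∷ f ∷ f ∷ f ∷ f ∷ f ∷ []) ∷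
    (t ∷ t ∷ f ∷ f ∷ t ∷ f ∷ f ∷ f ∷ f ∷ f ∷ []) ∷
    (f ∷ f ∷ t ∷ f ∷ t ∷ f ∷ f ∷ f ∷ f ∷ f ∷ []) ∷
    (t ∷ f ∷ t ∷ f ∷ t ∷ f ∷ f ∷ f ∷ f ∷ f ∷ []) ∷
    (t ∷ t ∷ t ∷ f ∷ t ∷ f ∷ f ∷ f ∷ f ∷ f ∷ []) ∷
    (f ∷ f ∷ t ∷ t ∷ t ∷ f ∷ f ∷ f ∷ f ∷ f ∷ []) ∷
    (t ∷ f ∷ t ∷ t ∷ t ∷ f ∷ f ∷ f ∷ f ∷ f ∷ []) ∷
    (f ∷ t ∷ t ∷ f ∷ t ∷ t ∷ f ∷ f ∷ f ∷ f ∷ []) ∷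
    (t ∷ t ∷ t ∷ f ∷ t ∷ t ∷ f ∷ f ∷ f ∷ f ∷ []) ∷
    (f ∷ t ∷ f ∷ t ∷ t ∷ t ∷ f ∷ f ∷ f ∷ f ∷ []) ∷
    (t ∷ t ∷ f ∷ t ∷ t ∷ t ∷ f ∷ f ∷ f ∷ f ∷ []) ∷
    (f ∷ t ∷ t ∷ t ∷ t ∷ t ∷ f ∷ f ∷ f ∷ f ∷ []) ∷
    (f ∷ t ∷ t ∷ t ∷ t ∷ t ∷ t ∷ f ∷ f ∷ f ∷ []) ∷
    (t ∷ t ∷ t ∷ f ∷ t ∷ t ∷ f ∷ t ∷ f ∷ f ∷ []) ∷
    (f ∷ f ∷ f ∷ t ∷ t ∷ t ∷ f ∷ t ∷ f ∷ f ∷ []) ∷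
    (t ∷ f ∷ f ∷ t ∷ t ∷ t ∷ f ∷ t ∷ f ∷ f ∷ []) ∷
    (t ∷ t ∷ f ∷ t ∷ t ∷ t ∷ f ∷ t ∷ f ∷ f ∷ []) ∷
    (f ∷ f ∷ t ∷ t ∷ t ∷ f ∷ t ∷ t ∷ f ∷ f ∷ []) ∷
    (t ∷ f ∷ t ∷ t ∷ t ∷ f ∷ t ∷ t ∷ f ∷ f ∷ []) ∷
    (f ∷ t ∷ t ∷ t ∷ t ∷ t ∷ t ∷ t ∷ f ∷ f ∷ []) ∷ []
    where
    t f : Bool
    t = true
    f = false

  _==ᵇ_ : ∀ {k} → Vec Bool k → Vec Bool k → Bool
  [] ==ᵇ [] = true
  (true  ∷ x) ==ᵇ (true  ∷ y) = x ==ᵇ y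
  (false ∷ x) ==ᵇ (false ∷ y) = x ==ᵇ y
  (_ ∷ x) ==ᵇ (_ ∷ y) = false

  isBase : List (Vec Bool 10) → Vec Bool 10 → Bool
  isBase bs b = any (b ==ᵇ_) bs

  none : List (Colouring → Bool) → Colouring → Bool
  none [] c = true
  none (k ∷ ks) c = if k c then false else none ks c

  checkBaseAt : List (Colouring → Colouring) → List (Vec Bool 10) → Colouring → Bool
  checkBaseAt rs bs c = if none quads₅ c then any (λ r → isBase bs (base (r c))) rs else true

  checkBase : List (Colouring → Colouring) → List (Vec Bool 10) → Vec Bool 10 → Bool
  checkBase rs bs e = allBits 10 λ b → checkBaseAt rs bs (fromBits b e)

  checkBoundAt : List (Colouring → Bool) → List (Colouring → ℤ) → Colouring → Bool
  checkBoundAt ks fs c = if none ks c then evaluate fs c ≤ᵇ + 737280 else true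

  checkBound : List (Colouring → Bool) → List (Colouring → ℤ) → List (Vec Bool 10) → Bool
  checkBound ks fs bs = all (λ b → allBits 10 λ e → checkBoundAt ks fs (fromBits b e)) bs

  relabels₅ : List (Colouring → Colouring)
  relabels₅ = map (λ w → relabel (swaps w identity)) words₅

  -- The words in `words₅` fix the sixth point, so the relabelled base depends on the first ten bits
  -- alone. The last ten stay variables, and 1024 evaluations suffice.
  checkBase-true : ∀ a b c d e f g h i j →
    checkBase relabels₅ bases (a ∷ b ∷ c ∷ d ∷ e ∷ f ∷ g ∷ h ∷ i ∷ j ∷ []) ≡ true
  checkBase-true a b c d e f g h i j = refl

  -- This visits 23 · 1024 colourings in place of 2^20, and evaluates 60 + 45 + 60 terms at each
  -- K₄-free one.
  checkBound-true : checkBound quads₆ (terms arrangements₄ arrangements₂ arrangements₃) bases ≡ true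
  checkBound-true = refl

  -- Invariance under permutations of the six points

  sort₃-invariant : ∀ {X : Set} (f : Fin 6 → Fin 6 → Fin 6 → X) →
    (∀ i j k → f i j k ≡ f j i k) → (∀ i j k → f i j k ≡ f i k j) →
    ∀ i j k → let (p , q , r) = sort₃ i j k in f p q r ≡ f i j k
  sort₃-invariant f s₁ s₂ i j k with i <ᵇ j
  ... | true with j <ᵇ k
  ...   | true = refl
  ...   | false with i <ᵇ k
  ...     | true = s₂ i k j
  ...     | false = trans (s₁ k i j) (s₂ i k j)
  sort₃-invariant f s₁ s₂ i j k | false with i <ᵇ k
  ...   | true = s₁ j i k
  ...   | false with j <ᵇ k
  ...     | true = trans (s₂ j k i) (s₁ j i k)
  ...     | false = trans (s₁ k j i) (trans (s₂ j k i) (s₁ j i k))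

  _∈ᵇ_ : Triple → List (Triple × (Colouring → Bool)) → Bool
  t ∈ᵇ fs = any (λ f → does (t ≟ₜ proj₁ f)) fs

  degenerate : Fin 6 → Fin 6 → Fin 6 → Bool
  degenerate i j k = does (i Finₚ.≟ j) ∨ does (j Finₚ.≟ k) ∨ does (i Finₚ.≟ k)

  fields-complete : ∀ i j k → (sort₃ i j k ∈ᵇ fields) ∨ degenerate i j k ≡ true
  fields-complete = from-yes (Finₚ.all? λ i → Finₚ.all? λ j → Finₚ.all? λ k →
    ((sort₃ i j k ∈ᵇ fields) ∨ degenerate i j k) Boolₚ.≟ true)

  find-correct : ∀ (c : Colouring) (g : Triple → Bool) fs → All (λ f → proj₂ f c ≡ g (proj₁ f)) fs →
    ∀ t → t ∈ᵇ fs ≡ true → find fs t c ≡ g t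
  find-correct c g ((s , f) ∷ fs) (h ∷ hs) t t∈ with t ≟ₜ s
  ... | yes refl = h
  ... | no  _    = find-correct c g fs hs t t∈

  find-absent : ∀ c fs t → t ∈ᵇ fs ≡ false → find fs t c ≡ false
  find-absent c [] t t∉ = refl
  find-absent c ((s , f) ∷ fs) t t∉ with t ≟ₜ s
  find-absent c ((s , f) ∷ fs) t () | yes _
  ... | no  _ = find-absent c fs t t∉

  find-total : ∀ c g fs → All (λ f → proj₂ f c ≡ g (proj₁ f)) fs →
    ∀ t d → (t ∈ᵇ fs) ∨ d ≡ true → (d ≡ true → g t ≡ false) → find fs t c ≡ g t
  find-total c g fs h t d eq deg with t ∈ᵇ fs in eq′
  ... | true  = find-correct c g fs h t eq′
  ... | false = trans (find-absent c fs t eq′) (sym (deg eq))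

  swapAt-map : ∀ {A B : Set} {k} (f : A → B) i (x : Vec A (suc k)) →
    swapAt i (Vec.map f x) ≡ Vec.map f (swapAt i x)
  swapAt-map f zero (x ∷ y ∷ xs) = refl
  swapAt-map f (suc i) (x ∷ xs@(_ ∷ _)) = cong (f x ∷_) (swapAt-map f i xs)

  swaps-map : ∀ {A B : Set} {k} (f : A → B) w (x : Vec A (suc k)) →
    swaps w (Vec.map f x) ≡ Vec.map f (swaps w x)
  swaps-map f [] x = refl
  swaps-map f (i ∷ w) x = trans (cong (swaps w) (swapAt-map f i x)) (swaps-map f w (swapAt i x))

  -- Relabelling by a concrete arrangement computes on an arbitrary c. What remains is the symmetry
  -- of the counts when base points are permuted, and that of `W₄` when the flags are exchanged.
  apexTerm-moves : ∀ r → All (λ m → ∀ c → apexTerm r (relabel (proj₂ m identity) c) ≡ apexTerm r c) moves₄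
  apexTerm-moves r = first ∷ second ∷ first ∷ third ∷ []
    where
    cong₅ : ∀ {k k′ a a′ b b′ d d′ e e′} → k ≡ k′ → a ≡ a′ → b ≡ b′ → d ≡ d′ → e ≡ e′ →
            weight₄ r k a b d e ≡ weight₄ r k′ a′ b′ d′ e′
    cong₅ refl refl refl refl refl = refl
    ∧-swap : ∀ p q r → p ∧ q ∧ r ≡ q ∧ p ∧ r
    ∧-swap false false r = refl
    ∧-swap false true  r = refl
    ∧-swap true  q r = refl
    first : ∀ c → apexTerm r (relabel (swapAt 1F identity) c) ≡ apexTerm r c
    first c = cong₅ (cong (e012 c ∧_) (∧-swap (e023 c) (e013 c) _))
      (count₃-swapˡ (e024 c) (e014 c) _) (count₃-swapʳ (e124 c) _ _)
      (count₃-swapˡ (e025 c) (e015 c) _) (count₃-swapʳ (e125 c) _ _)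
    second : ∀ c → apexTerm r (relabel (swapAt 2F identity) c) ≡ apexTerm r c
    second c = cong₅ (∧-swap (e013 c) (e012 c) _)
      (count₃-swapʳ (e014 c) _ _) (count₃-swapˡ (e134 c) (e124 c) _)
      (count₃-swapʳ (e015 c) _ _) (count₃-swapˡ (e135 c) (e125 c) _)
    weight₄-sym : ∀ k a b d e → weight₄ r k a b d e ≡ weight₄ r k d e a b
    weight₄-sym false a b d e = refl
    weight₄-sym true  a b d e = cong (_+_ r) (W₄-sym a b d e)
    third : ∀ c → apexTerm r (relabel (swapAt 4F identity) c) ≡ apexTerm r c
    third c = weight₄-sym (e012 c ∧ e013 c ∧ e023 c ∧ not (e123 c)) _ _ _ _

  q₃-moves : All (λ m → ∀ c → q₃ (relabel (proj₂ m identity) c) ≡ q₃ c) moves₃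
  q₃-moves = first ∷ second ∷ first ∷ third ∷ []
    where
    first : ∀ c → q₃ (relabel (swapAt 0F identity) c) ≡ q₃ c
    first c = cong₂ (weight₃ (e012 c)) (count₃-swapʳ (e013 c) _ _) (count₃-swapʳ (e014 c) _ _)
    second : ∀ c → q₃ (relabel (swapAt 1F identity) c) ≡ q₃ c
    second c = cong₂ (weight₃ (e012 c)) (count₃-swapˡ (e023 c) (e013 c) _) (count₃-swapˡ (e024 c) (e014 c) _)
    weight₃-sym : ∀ k a b → weight₃ k a b ≡ weight₃ k b a
    weight₃-sym true  a b = refl
    weight₃-sym false a b = W₃-sym a b
    third : ∀ c → q₃ (relabel (swapAt 3F identity) c) ≡ q₃ c
    third c = weight₃-sym (e012 c) _ _

  q₂-moves : All (λ m → ∀ c → q₂ (relabel (proj₂ m identity) c) ≡ q₂ c) moves₂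
  q₂-moves = first ∷ second ∷ third ∷ fourth ∷ []
    where
    first : ∀ c → q₂ (relabel (swapAt 0F identity) c) ≡ q₂ c
    first c = cong₂ (λ a b → W₂ (count₂ (e012 c) (e013 c)) a (count₂ (e014 c) (e015 c)) b)
      (count₂-comm (e123 c) _) (count₂-comm (e145 c) _)
    second : ∀ c → q₂ (relabel (swapAt 2F identity) c) ≡ q₂ c
    second c = cong (λ a → W₂ a (count₂ (e023 c) (e123 c)) (count₂ (e014 c) (e015 c)) (count₂ (e045 c) (e145 c))) (count₂-comm (e013 c) (e012 c))
    third : ∀ c → q₂ (relabel (swapAt 4F identity) c) ≡ q₂ c
    third c = cong (λ a → W₂ (count₂ (e012 c) (e013 c)) (count₂ (e023 c) (e123 c)) a (count₂ (e045 c) (e145 c))) (count₂-comm (e015 c) (e014 c))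
    fourth : ∀ c → q₂ (relabel (exchange identity) c) ≡ q₂ c
    fourth c = W₂-sym (count₂ (e014 c) (e015 c)) _ _ _

  act : ∀ {X : Set} → Arrangement → Vec X 6 → Vec X 6
  act t x = Vec.map (lookup x) t

  act-act : ∀ {X : Set} s t (x : Vec X 6) → act s (act t x) ≡ act (act s t) x
  act-act s t x = begin
    Vec.map (lookup (Vec.map (lookup x) t)) s  ≡⟨ Vecₚ.map-cong (λ i → Vecₚ.lookup-map i (lookup x) t) s ⟩
    Vec.map (lookup x ∘ lookup t) s            ≡⟨ Vecₚ.map-∘ (lookup x) (lookup t) s ⟩
    Vec.map (lookup x) (Vec.map (lookup t) s)  ∎
    where open ≡-Reasoning

  act-identity : ∀ {X : Set} (x : Vec X 6) → act identity x ≡ x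
  act-identity = Vecₚ.map-lookup-allFin

  swaps-act : ∀ {X : Set} w (x : Vec X 6) → swaps w x ≡ act (swaps w identity) x
  swaps-act w x = trans (cong (swaps w) (sym (act-identity x))) (swaps-map (lookup x) w identity)

  remove : Arrangement → List Arrangement → Maybe (List Arrangement)
  remove t [] = nothing
  remove t (u ∷ us) = if does (t ≟ₐ u) then just us else Maybe.map (u ∷_) (remove t us)

  -- Equality as multisets, which is all that a sum over a list can see.
  sameElements : List Arrangement → List Arrangement → Bool
  sameElements [] [] = true
  sameElements [] (_ ∷ _) = false
  sameElements (t ∷ ts) us with remove t us
  ... | just us′ = sameElements ts us′
  ... | nothing  = false

  remove-∑ₗ : ∀ g t us {us′} → remove t us ≡ just us′ → ∑ₗ us g ≡ g t + ∑ₗ us′ g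
  remove-∑ₗ g t (u ∷ us) eq with t ≟ₐ u
  remove-∑ₗ g t (.t ∷ us) refl | yes refl = refl
  remove-∑ₗ g t (u ∷ us) eq | no _ with remove t us in eq′
  remove-∑ₗ g t (u ∷ us) refl | no _ | just us′ = begin
    g u + ∑ₗ us g           ≡⟨ cong (_+_ (g u)) (remove-∑ₗ g t us eq′) ⟩
    g u + (g t + ∑ₗ us′ g)  ≡⟨ solve 3 (λ a b c → a :+ (b :+ c) := b :+ (a :+ c)) refl (g u) (g t) (∑ₗ us′ g) ⟩
    g t + (g u + ∑ₗ us′ g)  ∎
    where open ≡-Reasoning

  sameElements-∑ₗ : ∀ g ts us → sameElements ts us ≡ true → ∑ₗ ts g ≡ ∑ₗ us g
  sameElements-∑ₗ g [] [] eq = refl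
  sameElements-∑ₗ g (t ∷ ts) us eq with remove t us in eq′
  ... | just us′ = trans (cong (_+_ (g t)) (sameElements-∑ₗ g ts us′ eq)) (sym (remove-∑ₗ g t us eq′))

  -- A transposition of the points acts on the values of an arrangement, while `tidy` acts on its
  -- positions. It therefore permutes the cosets, and the tidied images should form the same list up
  -- to order; evaluation confirms this without any group theory.
  stableUnder : List Move → List Arrangement → Fin 5 → Bool
  stableUnder ms l j = sameElements (map (λ t → tidy ms (act t (swapAt j identity))) l) l

  stable : List Move → List Arrangement → Bool
  stable ms l = all (stableUnder ms l) (0F ∷ 1F ∷ 2F ∷ 3F ∷ 4F ∷ [])

  stable₄ : stable moves₄ arrangements₄ ≡ true
  stable₄ = refl
  stable₃ : stable moves₃ arrangements₃ ≡ true
  stable₃ = refl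
  stable₂ : stable moves₂ arrangements₂ ≡ true
  stable₂ = refl

  length₄ : length arrangements₄ ≡ 60
  length₄ = refl
  length₃ : length arrangements₃ ≡ 60
  length₃ = refl
  length₂ : length arrangements₂ ≡ 45
  length₂ = refl

  -- Soundness of the exhaustive checks

  all-sound : ∀ {X : Set} (p : X → Bool) xs → all p xs ≡ true → All (λ x → p x ≡ true) xs
  all-sound p [] eq = []
  all-sound p (x ∷ xs) eq with p x in eq′
  ... | true = eq′ ∷ all-sound p xs eq

  any-elim : ∀ {X Q : Set} (p : X → Bool) {xs} → All (λ x → p x ≡ true → Q) xs → any p xs ≡ true → Q
  any-elim p {x ∷ xs} (h ∷ hs) eq with p x in eq′
  ... | true  = h refl
  ... | false = any-elim p hs eq

  allBits-sound : ∀ k (p : Vec Bool k → Bool) → allBits k p ≡ true → ∀ b → p b ≡ true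
  allBits-sound zero p eq [] = eq
  allBits-sound (suc k) p eq b with allBits k (p ∘ (false ∷_)) in eq₁ | allBits k (p ∘ (true ∷_)) in eq₂
  allBits-sound (suc k) p eq (false ∷ b) | true | true = allBits-sound k (p ∘ (false ∷_)) eq₁ b
  allBits-sound (suc k) p eq (true ∷ b)  | true | true = allBits-sound k (p ∘ (true ∷_)) eq₂ b

  ==ᵇ-sound : ∀ {k} (x y : Vec Bool k) → x ==ᵇ y ≡ true → x ≡ y
  ==ᵇ-sound [] [] eq = refl
  ==ᵇ-sound (true  ∷ x) (true  ∷ y) eq = cong (true ∷_) (==ᵇ-sound x y eq)
  ==ᵇ-sound (false ∷ x) (false ∷ y) eq = cong (false ∷_) (==ᵇ-sound x y eq)

  all-isBase : ∀ (p : Vec Bool 10 → Bool) bs b → all p bs ≡ true → isBase bs b ≡ true → p b ≡ true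
  all-isBase p bs b all≡ = any-elim (b ==ᵇ_)
    (All.map (λ {b′} pb′ b≡ → trans (cong p (==ᵇ-sound b b′ b≡)) pb′) (all-sound p bs all≡))

  if-true : ∀ {p q : Bool} → p ≡ true → (if p then q else true) ≡ true → q ≡ true
  if-true refl eq = eq

  -- A rearrangement of positions is determined by its effect on `identity`; this turns moves into
  -- instances of `act`.
  Natural : (Arrangement → Arrangement) → Set
  Natural m = ∀ t → m t ≡ act (m identity) t

  swapAt-natural : ∀ j → Natural (swapAt j)
  swapAt-natural j t = swaps-act (j ∷ []) t

  exchange-natural : Natural exchange
  exchange-natural (_ ∷ _ ∷ _ ∷ _ ∷ _ ∷ _ ∷ []) = refl

  natural₄ : All (Natural ∘ proj₂) moves₄
  natural₄ = swapAt-natural 1F ∷ swapAt-natural 2F ∷ swapAt-natural 1F ∷ swapAt-natural 4F ∷ []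

  natural₃ : All (Natural ∘ proj₂) moves₃
  natural₃ = swapAt-natural 0F ∷ swapAt-natural 1F ∷ swapAt-natural 0F ∷ swapAt-natural 3F ∷ []

  natural₂ : All (Natural ∘ proj₂) moves₂
  natural₂ = swapAt-natural 0F ∷ swapAt-natural 2F ∷ swapAt-natural 4F ∷ exchange-natural ∷ []

  -- Orbit sums of the terms

  ∑ₗ-++ : ∀ {X : Set} xs ys (f : X → ℤ) → ∑ₗ (xs ++ ys) f ≡ ∑ₗ xs f + ∑ₗ ys f
  ∑ₗ-++ [] ys f = sym (ℤₚ.+-identityˡ _)
  ∑ₗ-++ (x ∷ xs) ys f = trans (cong (_+_ (f x)) (∑ₗ-++ xs ys f)) (sym (ℤₚ.+-assoc (f x) _ _))

  ∑ₗ-map : ∀ {X Y : Set} (h : X → Y) xs (f : Y → ℤ) → ∑ₗ (map h xs) f ≡ ∑ₗ xs (f ∘ h)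
  ∑ₗ-map h [] f = refl
  ∑ₗ-map h (x ∷ xs) f = cong (_+_ (f (h x))) (∑ₗ-map h xs f)

  ∑ₗ-cong-All : ∀ {X : Set} {xs} {f g : X → ℤ} → All (λ x → f x ≡ g x) xs → ∑ₗ xs f ≡ ∑ₗ xs g
  ∑ₗ-cong-All [] = refl
  ∑ₗ-cong-All (h ∷ hs) = cong₂ _+_ h (∑ₗ-cong-All hs)

  orbit : (Colouring → ℤ) → List Arrangement → Colouring → ℤ
  orbit q l c = ∑ₗ l (λ t → q (relabel t c))

  evaluate-terms : ∀ l₄ l₂ l₃ c → evaluate (terms l₄ l₂ l₃) c ≡ orbit q₄ l₄ c + (orbit q₂ l₂ c + orbit q₃ l₃ c)
  evaluate-terms l₄ l₂ l₃ c = trans (∑ₗ-++ (map (λ t → after q₄ (relabel t)) l₄) _ (λ f → f c))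
    (cong₂ _+_ (∑ₗ-map (λ t → after q₄ (relabel t)) l₄ (λ f → f c))
    (trans (∑ₗ-++ (map (λ t → after q₂ (relabel t)) l₂) _ (λ f → f c))
      (cong₂ _+_ (∑ₗ-map (λ t → after q₂ (relabel t)) l₂ (λ f → f c))
                 (∑ₗ-map (λ t → after q₃ (relabel t)) l₃ (λ f → f c)))))

  module _ {n : ℕ} where

    ∑ᵛ-swaps : ∀ {k} w (F : Vec (Fin n) (suc k) → ℤ) → ∑ᵛ (suc k) (λ x → F (swaps w x)) ≡ ∑ᵛ (suc k) F
    ∑ᵛ-swaps [] F = refl
    ∑ᵛ-swaps (i ∷ w) F = trans (∑ᵛ-swapAt i (λ x → F (swaps w x))) (∑ᵛ-swaps w F)

    -- Each arrangement merely permutes the summation variables, so all contribute equally and only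
    -- their number survives.
    ∑ᵛ-representatives : ∀ ws ms (F : Vec (Fin n) 6 → ℤ) →
      ∑ₗ (representatives ws ms) (λ t → ∑ᵛ 6 (λ x → F (act t x))) ≡ + length (representatives ws ms) * ∑ᵛ 6 F
    ∑ᵛ-representatives ws ms F = trans
      (∑ₗ-cong-All {f = λ t → ∑ᵛ 6 (λ x → F (act t x))} (Allₚ.filter⁺ (λ t → tidy ms t ≟ₐ t) (Allₚ.map⁺ (All.universal invariant ws))))
      (∑ₗ-const (representatives ws ms) (∑ᵛ 6 F))
      where
      invariant : ∀ w → ∑ᵛ 6 (λ x → F (act (swaps w identity) x)) ≡ ∑ᵛ 6 F
      invariant w = trans (∑ᵛ-cong 6 (λ x → cong F (sym (swaps-act w x)))) (∑ᵛ-swaps w F)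

  module Link {n : ℕ} (A : Fin n → Fin n → Fin n → Bool)
    (A-swapˡ : ∀ x y z → A x y z ≡ A y x z) (A-swapʳ : ∀ x y z → A x y z ≡ A x z y)
    (A-irrefl : ∀ x y → A x x y ≡ false) where

    pattern-at : Vec (Fin n) 6 → Fin 6 → Fin 6 → Fin 6 → Bool
    pattern-at x i j k = A (lookup x i) (lookup x j) (lookup x k)

    enc : Vec (Fin n) 6 → Colouring
    enc x = colouringOf (pattern-at x)

    degenerate-false : ∀ x i j k → degenerate i j k ≡ true → pattern-at x i j k ≡ false
    degenerate-false x i j k eq with i Finₚ.≟ j | j Finₚ.≟ k | i Finₚ.≟ k
    ... | yes refl | _ | _ = A-irrefl _ _
    ... | no _ | yes refl | _ = trans (A-swapˡ _ _ _) (trans (A-swapʳ _ _ _) (A-irrefl _ _))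
    ... | no _ | no _ | yes refl = trans (A-swapʳ _ _ _) (A-irrefl _ _)

    fields-enc : ∀ x → All (λ f → proj₂ f (enc x) ≡ (let (i , j , k) = proj₁ f in pattern-at x i j k)) fields
    fields-enc x =
      refl ∷ refl ∷ refl ∷ refl ∷ refl ∷ refl ∷ refl ∷ refl ∷ refl ∷ refl ∷
      refl ∷ refl ∷ refl ∷ refl ∷ refl ∷ refl ∷ refl ∷ refl ∷ refl ∷ refl ∷ []

    edge-enc : ∀ x i j k → edge i j k (enc x) ≡ pattern-at x i j k
    edge-enc x i j k = trans
      (find-total (enc x) (λ (i , j , k) → pattern-at x i j k) fields (fields-enc x) (sort₃ i j k) (degenerate i j k)
        (fields-complete i j k) (λ deg → trans sorted (degenerate-false x i j k deg)))
      sorted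
      where
      sorted : (let (p , q , r) = sort₃ i j k in pattern-at x p q r) ≡ pattern-at x i j k
      sorted = sort₃-invariant (pattern-at x) (λ i j k → A-swapˡ _ _ _) (λ i j k → A-swapʳ _ _ _) i j k

    -- The bridge between permuting names in a colouring and permuting the tuple that it encodes. It
    -- is proved for every map t of positions; `A-irrefl` accounts for the non-injective ones.
    relabel-enc : ∀ t x → relabel t (enc x) ≡ enc (act t x)
    relabel-enc t@(_ ∷ _ ∷ _ ∷ _ ∷ _ ∷ _ ∷ []) x = colouringOf-cong
      {λ i j k → edge (lookup t i) (lookup t j) (lookup t k) (enc x)} {pattern-at (act t x)} λ i j k →
      trans (edge-enc x (lookup t i) (lookup t j) (lookup t k))
        (cong₃ A (at i) (at j) (at k))
      where
      at : ∀ i → lookup x (lookup t i) ≡ lookup (act t x) i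
      at i = sym (Vecₚ.lookup-map i (lookup x) t)
      cong₃ : ∀ (f : Fin n → Fin n → Fin n → Bool) {a a′ b b′ c c′} → a ≡ a′ → b ≡ b′ → c ≡ c′ → f a b c ≡ f a′ b′ c′
      cong₃ f refl refl refl = refl

    module Orbit (q : Colouring → ℤ) (ms : List Move)
      (natural : All (Natural ∘ proj₂) ms)
      (invariant : All (λ m → ∀ c → q (relabel (proj₂ m identity) c) ≡ q c) ms) where

      tidy-invariant : ∀ t x → q (enc (act (tidy ms t) x)) ≡ q (enc (act t x))
      tidy-invariant t x = sym (tidy-reflects (λ t′ → q (enc (act t′ x)) ≡ q (enc (act (tidy ms t) x))) ms
        (All.zipWith (λ { {m} (nat , inv) t′ eq → trans (sym (move (proj₂ m) nat inv t′)) eq }) (natural , invariant)) t refl)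
        where
        open ≡-Reasoning
        move : ∀ m → Natural m → (∀ c → q (relabel (m identity) c) ≡ q c) →
               ∀ t → q (enc (act (m t) x)) ≡ q (enc (act t x))
        move m nat inv t = begin
          q (enc (act (m t) x))                      ≡⟨ cong (λ s → q (enc (act s x))) (nat t) ⟩
          q (enc (act (act (m identity) t) x))       ≡⟨ cong (q ∘ enc) (act-act (m identity) t x) ⟨
          q (enc (act (m identity) (act t x)))       ≡⟨ cong q (relabel-enc (m identity) (act t x)) ⟨
          q (relabel (m identity) (enc (act t x)))   ≡⟨ inv _ ⟩
          q (enc (act t x))                          ∎

      orbit-enc : ∀ l x → orbit q l (enc x) ≡ ∑ₗ l (λ t → q (enc (act t x)))
      orbit-enc l x = ∑ₗ-cong l (λ t → cong q (relabel-enc t x))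

      -- The transposition moves from the tuple to the values of each arrangement; tidying keeps the
      -- term, and the tidied list is the old one up to order.
      orbit-swapAt : ∀ l j x → stableUnder ms l j ≡ true → orbit q l (enc (swapAt j x)) ≡ orbit q l (enc x)
      orbit-swapAt l j x st = begin
        orbit q l (enc (swapAt j x))                            ≡⟨ orbit-enc l (swapAt j x) ⟩
        ∑ₗ l (λ t → q (enc (act t (swapAt j x))))               ≡⟨ ∑ₗ-cong l step ⟩
        ∑ₗ l (λ t → q (enc (act (tidy ms (act t s)) x)))        ≡⟨ ∑ₗ-map (λ t → tidy ms (act t s)) l (λ t → q (enc (act t x))) ⟨
        ∑ₗ (map (λ t → tidy ms (act t s)) l) (λ t → q (enc (act t x)))
          ≡⟨ sameElements-∑ₗ (λ t → q (enc (act t x))) (map (λ t → tidy ms (act t s)) l) l st ⟩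
        ∑ₗ l (λ t → q (enc (act t x)))                          ≡⟨ orbit-enc l x ⟨
        orbit q l (enc x)                                       ∎
        where
        open ≡-Reasoning
        s : Arrangement
        s = swapAt j identity
        step : ∀ t → q (enc (act t (swapAt j x))) ≡ q (enc (act (tidy ms (act t s)) x))
        step t = begin
          q (enc (act t (swapAt j x)))           ≡⟨ cong (λ y → q (enc (act t y))) (swaps-act (j ∷ []) x) ⟩
          q (enc (act t (act s x)))              ≡⟨ cong (q ∘ enc) (act-act t s x) ⟩
          q (enc (act (act t s) x))              ≡⟨ tidy-invariant (act t s) x ⟨
          q (enc (act (tidy ms (act t s)) x))    ∎

      stable-at : ∀ l → stable ms l ≡ true → ∀ j → stableUnder ms l j ≡ true
      stable-at l st j with all-sound (stableUnder ms l) (0F ∷ 1F ∷ 2F ∷ 3F ∷ 4F ∷ []) st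
      stable-at l st 0F | h ∷ _ = h
      stable-at l st 1F | _ ∷ h ∷ _ = h
      stable-at l st 2F | _ ∷ _ ∷ h ∷ _ = h
      stable-at l st 3F | _ ∷ _ ∷ _ ∷ h ∷ _ = h
      stable-at l st 4F | _ ∷ _ ∷ _ ∷ _ ∷ h ∷ _ = h

      orbit-swaps : ∀ l → stable ms l ≡ true → ∀ w x → orbit q l (enc (swaps w x)) ≡ orbit q l (enc x)
      orbit-swaps l st [] x = refl
      orbit-swaps l st (j ∷ w) x = trans (orbit-swaps l st w (swapAt j x)) (orbit-swapAt l j x (stable-at l st j))

      ∑ᵛ-orbit : ∀ ws → ∑ᵛ 6 (λ x → orbit q (representatives ws ms) (enc x))
                      ≡ + length (representatives ws ms) * ∑ᵛ 6 (λ x → q (enc x))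
      ∑ᵛ-orbit ws = begin
        ∑ᵛ 6 (λ x → orbit q l (enc x))                          ≡⟨ ∑ᵛ-cong 6 (orbit-enc l) ⟩
        ∑ᵛ 6 (λ x → ∑ₗ l (λ t → q (enc (act t x))))             ≡⟨ ∑ᵛ-∑ₗ 6 l (λ t x → q (enc (act t x))) ⟩
        ∑ₗ l (λ t → ∑ᵛ 6 (λ x → q (enc (act t x))))             ≡⟨ ∑ᵛ-representatives ws ms (q ∘ enc) ⟩
        + length l * ∑ᵛ 6 (λ x → q (enc x))                ∎
        where
        open ≡-Reasoning
        l : List Arrangement
        l = representatives ws ms

  -- The inequality on six points

  none-true : ∀ c {ks} → All (λ k → k c ≡ false) ks → none ks c ≡ true
  none-true c [] = refl
  none-true c {k ∷ ks} (h ∷ hs) with k c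
  none-true c {k ∷ ks} (refl ∷ hs) | false = none-true c hs

  module Bound {n : ℕ} (A : Fin n → Fin n → Fin n → Bool)
    (A-swapˡ : ∀ x y z → A x y z ≡ A y x z) (A-swapʳ : ∀ x y z → A x y z ≡ A x z y)
    (A-irrefl : ∀ x y → A x x y ≡ false)
    (A-K₄-free : ∀ a b c d → A a b c ∧ A a b d ∧ A a c d ∧ A b c d ≡ false) where

    open Link A A-swapˡ A-swapʳ A-irrefl

    module O₄ = Orbit q₄ moves₄ natural₄ (apexTerm-moves (+ 82944))
    module O₃ = Orbit q₃ moves₃ natural₃ q₃-moves
    module O₂ = Orbit q₂ moves₂ natural₂ q₂-moves

    quads₅-false : ∀ x → All (λ k → k (enc x) ≡ false) quads₅
    quads₅-false x = A-K₄-free _ _ _ _ ∷ A-K₄-free _ _ _ _ ∷ A-K₄-free _ _ _ _ ∷ A-K₄-free _ _ _ _ ∷ A-K₄-free _ _ _ _ ∷ []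

    quads₆-false : ∀ x → All (λ k → k (enc x) ≡ false) quads₆
    quads₆-false x = Allₚ.++⁺ (quads₅-false x)
      (A-K₄-free _ _ _ _ ∷ A-K₄-free _ _ _ _ ∷ A-K₄-free _ _ _ _ ∷ A-K₄-free _ _ _ _ ∷ A-K₄-free _ _ _ _ ∷
       A-K₄-free _ _ _ _ ∷ A-K₄-free _ _ _ _ ∷ A-K₄-free _ _ _ _ ∷ A-K₄-free _ _ _ _ ∷ A-K₄-free _ _ _ _ ∷ [])

    value : (l₄ l₂ l₃ : List Arrangement) → Vec (Fin n) 6 → ℤ
    value l₄ l₂ l₃ x = evaluate (terms l₄ l₂ l₃) (enc x)

    value-orbits : ∀ l₄ l₂ l₃ x → value l₄ l₂ l₃ x ≡ orbit q₄ l₄ (enc x) + (orbit q₂ l₂ (enc x) + orbit q₃ l₃ (enc x))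
    value-orbits l₄ l₂ l₃ x = evaluate-terms l₄ l₂ l₃ (enc x)

    value-swaps : ∀ l₄ l₂ l₃ → stable moves₄ l₄ ≡ true → stable moves₂ l₂ ≡ true → stable moves₃ l₃ ≡ true →
      ∀ w x → value l₄ l₂ l₃ (swaps w x) ≡ value l₄ l₂ l₃ x
    value-swaps l₄ l₂ l₃ s₄ s₂ s₃ w x = begin
      value l₄ l₂ l₃ (swaps w x)  ≡⟨ value-orbits l₄ l₂ l₃ (swaps w x) ⟩
      _                           ≡⟨ cong₂ _+_ (O₄.orbit-swaps l₄ s₄ w x) (cong₂ _+_ (O₂.orbit-swaps l₂ s₂ w x) (O₃.orbit-swaps l₃ s₃ w x)) ⟩
      _                           ≡⟨ value-orbits l₄ l₂ l₃ x ⟨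
      value l₄ l₂ l₃ x            ∎
      where open ≡-Reasoning

    bound-at-base : ∀ fs bs → checkBound quads₆ fs bs ≡ true → ∀ x → isBase bs (base (enc x)) ≡ true →
      (evaluate fs (enc x) ≤ᵇ + 737280) ≡ true
    bound-at-base fs bs eq x isB = if-true (none-true (enc x) (quads₆-false x))
      (allBits-sound 10 (λ e → checkBoundAt quads₆ fs (fromBits (base (enc x)) e))
        (all-isBase (λ b → allBits 10 λ e → checkBoundAt quads₆ fs (fromBits b e)) bs (base (enc x)) eq isB) (apex (enc x)))

    -- The exhaustive check yields a word that carries the pattern on the first five entries to a
    -- listed one. The word is handed to a continuation of any result type.
    base-exists : ∀ {Q : Set} ws bs →
      (∀ a b c d e f g h i j → checkBase (map (λ w → relabel (swaps w identity)) ws) bs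
                                 (a ∷ b ∷ c ∷ d ∷ e ∷ f ∷ g ∷ h ∷ i ∷ j ∷ []) ≡ true) →
      ∀ x → (∀ w → isBase bs (base (enc (swaps w x))) ≡ true → Q) → Q
    base-exists ws bs eq x found = any-elim (λ r → isBase bs (base (r (enc x))))
      (Allₚ.map⁺ (All.universal (λ w h → found w
        (trans (cong (isBase bs ∘ base) (trans (cong enc (swaps-act w x)) (sym (relabel-enc (swaps w identity) x)))) h)) ws))
      (if-true (none-true (enc x) (quads₅-false x))
        (allBits-sound 10 (λ b → checkBaseAt (map (λ w → relabel (swaps w identity)) ws) bs (fromBits b (apex (enc x))))
          (eq _ _ _ _ _ _ _ _ _ _) (base (enc x))))

    -- Permuting the tuple keeps the value, and some permutation reaches a listed base, where the
    -- bound was evaluated. The lists stay variables until `value-bounded`.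
    value-bound : ∀ l₄ l₂ l₃ ws bs → stable moves₄ l₄ ≡ true → stable moves₂ l₂ ≡ true → stable moves₃ l₃ ≡ true →
      (∀ a b c d e f g h i j → checkBase (map (λ w → relabel (swaps w identity)) ws) bs
                                 (a ∷ b ∷ c ∷ d ∷ e ∷ f ∷ g ∷ h ∷ i ∷ j ∷ []) ≡ true) →
      checkBound quads₆ (terms l₄ l₂ l₃) bs ≡ true →
      ∀ x → value l₄ l₂ l₃ x ≤ + 737280
    value-bound l₄ l₂ l₃ ws bs s₄ s₂ s₃ eq₁ eq₂ x = base-exists ws bs eq₁ x λ w isB →
      subst (_≤ + 737280) (value-swaps l₄ l₂ l₃ s₄ s₂ s₃ w x)
        (ℤₚ.≤ᵇ⇒≤ (subst T (sym (bound-at-base (terms l₄ l₂ l₃) bs eq₂ (swaps w x) isB)) tt))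

    value-bounded : ∀ x → value arrangements₄ arrangements₂ arrangements₃ x ≤ + 737280
    value-bounded = value-bound arrangements₄ arrangements₂ arrangements₃ words₅ bases
      stable₄ stable₂ stable₃ checkBase-true checkBound-true

  -- Sorted tuples

  𝟙 : Bool → ℤ
  𝟙 true  = 1ℤ
  𝟙 false = 0ℤ

  module _ {n : ℕ} where

    lt : Fin n → Fin n → ℤ
    lt a b = 𝟙 (a <ᵇ b)

    lt-< : ∀ {a b} → a Fin.< b → lt a b ≡ 1ℤ
    lt-< {a} {b} a<b = cong 𝟙 (dec-true (a Finₚ.<? b) a<b)

    lt-≮ : ∀ {a b} → ¬ a Fin.< b → lt a b ≡ 0ℤ
    lt-≮ {a} {b} a≮b = cong 𝟙 (dec-false (a Finₚ.<? b) a≮b)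

    lt-total : ∀ {a b} → a ≢ b → lt a b + lt b a ≡ 1ℤ
    lt-total {a} {b} a≢b with Finₚ.<-cmp a b
    ... | tri< a<b _ b≮a = cong₂ _+_ (lt-< a<b) (lt-≮ b≮a)
    ... | tri≈ _ a≡b _   = ⊥-elim (a≢b a≡b)
    ... | tri> a≮b _ b<a = cong₂ _+_ (lt-≮ a≮b) (lt-< b<a)

    -- When a and d are distinct and both lie below b, d falls either before a or between a and b.
    lt-insert : ∀ {a d} b → d ≢ a → lt a b * lt d b ≡ lt d a * lt a b + lt a d * lt d b
    lt-insert {a} {d} b d≢a with Finₚ.<-cmp d a
    ... | tri≈ _ d≡a _ = ⊥-elim (d≢a d≡a)
    ... | tri< d<a _ a≮d with a Finₚ.<? b
    ...   | yes a<b rewrite lt-< d<a | lt-≮ a≮d | lt-< a<b | lt-< (Finₚ.<-trans d<a a<b) = refl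
    ...   | no a≮b rewrite lt-< d<a | lt-≮ a≮d | lt-≮ a≮b = sym (ℤₚ.+-identityʳ 0ℤ)
    lt-insert {a} {d} b d≢a | tri> d≮a _ a<d with d Finₚ.<? b
    ...   | yes d<b rewrite lt-< a<d | lt-≮ d≮a | lt-< d<b | lt-< (Finₚ.<-trans a<d d<b) = refl
    ...   | no d≮b rewrite lt-< a<d | lt-≮ d≮a | lt-≮ d≮b = ℤₚ.*-zeroʳ (lt a b)

    module Symmetrize (f : Vec (Fin n) 4 → ℤ)
      (f-swapAt : ∀ i x → f (swapAt i x) ≡ f x)
      (f-repeat : ∀ a c d → f (a ∷ a ∷ c ∷ d ∷ []) ≡ 0ℤ) where

      f-swaps : ∀ w x → f (swaps w x) ≡ f x
      f-swaps [] x = refl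
      f-swaps (i ∷ w) x = trans (f-swaps w (swapAt i x)) (f-swapAt i x)

      -- Insertion sort on indicators. The function with index k restricts f to tuples whose first k
      -- entries increase; the sums `E₁`, `E₂`, `E₃` run over the 2, 3 and 4 places where the next
      -- entry can be inserted, and 2 · 3 · 4 gives the factor 24 in `∑-sorted`.
      F₂ F₃ F₄ : Vec (Fin n) 4 → ℤ
      F₂ x@(a ∷ b ∷ _) = lt a b * f x
      F₃ x@(a ∷ b ∷ c ∷ _) = lt a b * lt b c * f x
      F₄ x@(a ∷ b ∷ c ∷ d ∷ []) = lt a b * lt b c * lt c d * f x

      E₁ E₂ E₃ : Vec (Fin n) 4 → ℤ
      E₁ x = F₂ x + F₂ (swaps (0F ∷ []) x)
      E₂ x = F₃ x + (F₃ (swaps (1F ∷ []) x) + F₃ (swaps (1F ∷ 0F ∷ []) x))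
      E₃ x = F₄ x + (F₄ (swaps (2F ∷ []) x) + (F₄ (swaps (2F ∷ 1F ∷ []) x) + F₄ (swaps (2F ∷ 1F ∷ 0F ∷ []) x)))

      f-zero : ∀ w x {a c d} → swaps w x ≡ a ∷ a ∷ c ∷ d ∷ [] → f x ≡ 0ℤ
      f-zero w x eq = trans (sym (f-swaps w x)) (trans (cong f eq) (f-repeat _ _ _))

      -- The indicator identities can fail only where entries coincide, and there f vanishes.
      scale : ∀ p q {z} → z ≡ 0ℤ ⊎ p ≡ q → p * z ≡ q * z
      scale p q (inj₁ refl) = trans (ℤₚ.*-zeroʳ p) (sym (ℤₚ.*-zeroʳ q))
      scale p q (inj₂ refl) = refl

      insert₁ : ∀ x → f x ≡ E₁ x
      insert₁ x@(a ∷ b ∷ c ∷ d ∷ []) = begin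
        f x                            ≡⟨ ℤₚ.*-identityˡ (f x) ⟨
        1ℤ * f x                       ≡⟨ scale 1ℤ (lt a b + lt b a) cases ⟩
        (lt a b + lt b a) * f x        ≡⟨ ℤₚ.*-distribʳ-+ (f x) (lt a b) (lt b a) ⟩
        lt a b * f x + lt b a * f x    ≡⟨ cong (λ z → lt a b * f x + lt b a * z) (f-swaps (0F ∷ []) x) ⟨
        F₂ x + F₂ (swaps (0F ∷ []) x)  ∎
        where
        open ≡-Reasoning
        cases : f x ≡ 0ℤ ⊎ 1ℤ ≡ lt a b + lt b a
        cases with a Finₚ.≟ b
        ... | yes refl = inj₁ (f-repeat a c d)
        ... | no a≢b   = inj₂ (sym (lt-total a≢b))

      insert₂ : ∀ x → F₂ x ≡ E₂ x
      insert₂ x@(a ∷ b ∷ c ∷ d ∷ []) = begin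
        lt a b * f x   ≡⟨ scale (lt a b) (lt a b * lt b c + (lt a c * lt c b + lt c a * lt a b)) cases ⟩
        (lt a b * lt b c + (lt a c * lt c b + lt c a * lt a b)) * f x
          ≡⟨ collect (lt a b * lt b c) (lt a c * lt c b) (lt c a * lt a b) (f x) ⟩
        lt a b * lt b c * f x + (lt a c * lt c b * f x + lt c a * lt a b * f x)
          ≡⟨ cong (_+_ (F₃ x)) (cong₂ _+_ (cong (lt a c * lt c b *_) (f-swaps (1F ∷ []) x))
                                            (cong (lt c a * lt a b *_) (f-swaps (1F ∷ 0F ∷ []) x))) ⟨
        F₃ x + (F₃ (swaps (1F ∷ []) x) + F₃ (swaps (1F ∷ 0F ∷ []) x)) ∎
        where
        open ≡-Reasoning
        collect : ∀ p q r z → (p + (q + r)) * z ≡ p * z + (q * z + r * z)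
        collect = solve 4 (λ p q r z → (p :+ (q :+ r)) :* z := p :* z :+ (q :* z :+ r :* z)) refl
        expand : ∀ p q r → p * (q + r) ≡ p * r + p * q
        expand = solve 3 (λ p q r → p :* (q :+ r) := p :* r :+ p :* q) refl
        weights : c ≢ a → c ≢ b → lt a b ≡ lt a b * lt b c + (lt a c * lt c b + lt c a * lt a b)
        weights c≢a c≢b = begin
          lt a b                                ≡⟨ ℤₚ.*-identityʳ (lt a b) ⟨
          lt a b * 1ℤ                           ≡⟨ cong (lt a b *_) (lt-total c≢b) ⟨
          lt a b * (lt c b + lt b c)            ≡⟨ expand (lt a b) (lt c b) (lt b c) ⟩
          lt a b * lt b c + lt a b * lt c b
            ≡⟨ cong (_+_ (lt a b * lt b c)) (trans (lt-insert b c≢a) (ℤₚ.+-comm (lt c a * lt a b) _)) ⟩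
          lt a b * lt b c + (lt a c * lt c b + lt c a * lt a b) ∎
        cases : f x ≡ 0ℤ ⊎ lt a b ≡ lt a b * lt b c + (lt a c * lt c b + lt c a * lt a b)
        cases with c Finₚ.≟ a | c Finₚ.≟ b
        ... | yes refl | _ = inj₁ (f-zero (1F ∷ []) x refl)
        ... | no _ | yes refl = inj₁ (f-zero (0F ∷ 1F ∷ []) x refl)
        ... | no c≢a | no c≢b = inj₂ (weights c≢a c≢b)

      insert₃ : ∀ x → F₃ x ≡ E₃ x
      insert₃ x@(a ∷ b ∷ c ∷ d ∷ []) = begin
        lt a b * lt b c * f x   ≡⟨ scale (lt a b * lt b c) (lt a b * lt b c * lt c d + (lt a b * lt b d * lt d c + (lt a d * lt d b * lt b c + lt d a * lt a b * lt b c))) cases ⟩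
        (lt a b * lt b c * lt c d + (lt a b * lt b d * lt d c + (lt a d * lt d b * lt b c + lt d a * lt a b * lt b c))) * f x
          ≡⟨ collect (lt a b * lt b c * lt c d) (lt a b * lt b d * lt d c) (lt a d * lt d b * lt b c) (lt d a * lt a b * lt b c) (f x) ⟩
        lt a b * lt b c * lt c d * f x + (lt a b * lt b d * lt d c * f x + (lt a d * lt d b * lt b c * f x + lt d a * lt a b * lt b c * f x))
          ≡⟨ cong (_+_ (F₄ x)) (cong₂ _+_ (cong (lt a b * lt b d * lt d c *_) (f-swaps (2F ∷ []) x))
               (cong₂ _+_ (cong (lt a d * lt d b * lt b c *_) (f-swaps (2F ∷ 1F ∷ []) x))
                          (cong (lt d a * lt a b * lt b c *_) (f-swaps (2F ∷ 1F ∷ 0F ∷ []) x)))) ⟨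
        F₄ x + (F₄ (swaps (2F ∷ []) x) + (F₄ (swaps (2F ∷ 1F ∷ []) x) + F₄ (swaps (2F ∷ 1F ∷ 0F ∷ []) x))) ∎
        where
        open ≡-Reasoning
        collect : ∀ p q r s z → (p + (q + (r + s))) * z ≡ p * z + (q * z + (r * z + s * z))
        collect = solve 5 (λ p q r s z → (p :+ (q :+ (r :+ s))) :* z := p :* z :+ (q :* z :+ (r :* z :+ s :* z))) refl
        step₁ : ∀ p q u v → p * q * (u + v) ≡ p * q * v + p * (q * u)
        step₁ = solve 4 (λ p q u v → p :* q :* (u :+ v) := p :* q :* v :+ p :* (q :* u)) refl
        step₂ : ∀ e p u q v w → e + p * (u * q + v * w) ≡ e + (p * v * w + p * u * q)
        step₂ = solve 6 (λ e p u q v w → e :+ p :* (u :* q :+ v :* w) := e :+ (p :* v :* w :+ p :* u :* q)) refl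
        step₃ : ∀ e g u p v w q → e + (g + (u * p + v * w) * q) ≡ e + (g + (v * w * q + u * p * q))
        step₃ = solve 7 (λ e g u p v w q → e :+ (g :+ (u :* p :+ v :* w) :* q) := e :+ (g :+ (v :* w :* q :+ u :* p :* q))) refl
        weights : d ≢ a → d ≢ b → d ≢ c → lt a b * lt b c ≡
          lt a b * lt b c * lt c d + (lt a b * lt b d * lt d c + (lt a d * lt d b * lt b c + lt d a * lt a b * lt b c))
        weights d≢a d≢b d≢c = begin
          lt a b * lt b c                      ≡⟨ ℤₚ.*-identityʳ (lt a b * lt b c) ⟨
          lt a b * lt b c * 1ℤ                 ≡⟨ cong (lt a b * lt b c *_) (lt-total d≢c) ⟨
          lt a b * lt b c * (lt d c + lt c d)  ≡⟨ step₁ (lt a b) (lt b c) (lt d c) (lt c d) ⟩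
          e + lt a b * (lt b c * lt d c)       ≡⟨ cong (λ z → e + lt a b * z) (lt-insert c d≢b) ⟩
          e + lt a b * (lt d b * lt b c + lt b d * lt d c)
            ≡⟨ step₂ e (lt a b) (lt d b) (lt b c) (lt b d) (lt d c) ⟩
          e + (lt a b * lt b d * lt d c + lt a b * lt d b * lt b c)
            ≡⟨ cong (λ z → e + (lt a b * lt b d * lt d c + z * lt b c)) (lt-insert b d≢a) ⟩
          e + (lt a b * lt b d * lt d c + (lt d a * lt a b + lt a d * lt d b) * lt b c)
            ≡⟨ step₃ e (lt a b * lt b d * lt d c) (lt d a) (lt a b) (lt a d) (lt d b) (lt b c) ⟩
          e + (lt a b * lt b d * lt d c + (lt a d * lt d b * lt b c + lt d a * lt a b * lt b c)) ∎
          where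
          e : ℤ
          e = lt a b * lt b c * lt c d
        cases : f x ≡ 0ℤ ⊎ lt a b * lt b c ≡ lt a b * lt b c * lt c d + (lt a b * lt b d * lt d c + (lt a d * lt d b * lt b c + lt d a * lt a b * lt b c))
        cases with d Finₚ.≟ a | d Finₚ.≟ b | d Finₚ.≟ c
        ... | yes refl | _ | _ = inj₁ (f-zero (2F ∷ 1F ∷ []) x refl)
        ... | no _ | yes refl | _ = inj₁ (f-zero (0F ∷ 2F ∷ 1F ∷ []) x refl)
        ... | no _ | no _ | yes refl = inj₁ (f-zero (1F ∷ 0F ∷ 2F ∷ 1F ∷ []) x refl)
        ... | no d≢a | no d≢b | no d≢c = inj₂ (weights d≢a d≢b d≢c)

      ∑-sorted : ∑ᵛ 4 f ≡ + 24 * ∑ᵛ 4 F₄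
      ∑-sorted = begin
        ∑ᵛ 4 f                        ≡⟨ ∑ᵛ-cong 4 {f} {E₁} insert₁ ⟩
        ∑ᵛ 4 E₁                       ≡⟨ split F₂ (λ x → F₂ (swaps (0F ∷ []) x)) refl (∑ᵛ-swaps (0F ∷ []) F₂) ⟩
        s₂ + s₂                       ≡⟨ cong (λ z → z + z) (trans (∑ᵛ-cong 4 {F₂} {E₂} insert₂) third) ⟩
        (s₃ + (s₃ + s₃)) + (s₃ + (s₃ + s₃))
          ≡⟨ cong (λ z → (z + (z + z)) + (z + (z + z))) (trans (∑ᵛ-cong 4 {F₃} {E₃} insert₃) fourth) ⟩
        _                             ≡⟨ total s₄ ⟩
        + 24 * s₄                     ∎
        where
        open ≡-Reasoning
        s₂ s₃ s₄ : ℤ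
        s₂ = ∑ᵛ 4 F₂
        s₃ = ∑ᵛ 4 F₃
        s₄ = ∑ᵛ 4 F₄
        split : ∀ (F G : Vec (Fin n) 4 → ℤ) {u v} → ∑ᵛ 4 F ≡ u → ∑ᵛ 4 G ≡ v → ∑ᵛ 4 (λ x → F x + G x) ≡ u + v
        split F G eq eq′ = trans (∑ᵛ-+ 4 F G) (cong₂ _+_ eq eq′)
        third : ∑ᵛ 4 E₂ ≡ s₃ + (s₃ + s₃)
        third = split F₃ (λ x → F₃ (swaps (1F ∷ []) x) + F₃ (swaps (1F ∷ 0F ∷ []) x)) refl
          (split (λ x → F₃ (swaps (1F ∷ []) x)) (λ x → F₃ (swaps (1F ∷ 0F ∷ []) x))
            (∑ᵛ-swaps (1F ∷ []) F₃) (∑ᵛ-swaps (1F ∷ 0F ∷ []) F₃))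
        fourth : ∑ᵛ 4 E₃ ≡ s₄ + (s₄ + (s₄ + s₄))
        fourth = split F₄ (λ x → F₄ (swaps (2F ∷ []) x) + (F₄ (swaps (2F ∷ 1F ∷ []) x) + F₄ (swaps (2F ∷ 1F ∷ 0F ∷ []) x))) refl
          (split (λ x → F₄ (swaps (2F ∷ []) x)) (λ x → F₄ (swaps (2F ∷ 1F ∷ []) x) + F₄ (swaps (2F ∷ 1F ∷ 0F ∷ []) x))
            (∑ᵛ-swaps (2F ∷ []) F₄)
            (split (λ x → F₄ (swaps (2F ∷ 1F ∷ []) x)) (λ x → F₄ (swaps (2F ∷ 1F ∷ 0F ∷ []) x))
              (∑ᵛ-swaps (2F ∷ 1F ∷ []) F₄) (∑ᵛ-swaps (2F ∷ 1F ∷ 0F ∷ []) F₄)))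
        total : ∀ z → ((z + (z + (z + z))) + ((z + (z + (z + z))) + (z + (z + (z + z))))) +
                      ((z + (z + (z + z))) + ((z + (z + (z + z))) + (z + (z + (z + z))))) ≡ + 24 * z
        total = solve 1 (λ z → let w = z :+ (z :+ (z :+ z)) in (w :+ (w :+ w)) :+ (w :+ (w :+ w)) := con (+ 24) :* z) refl

  -- Counting apexes

  apexAt : ∀ {n} → (Fin n → Fin n → Fin n → Bool) → Vec (Fin n) 4 → Bool
  apexAt A (a ∷ b ∷ c ∷ d ∷ []) = A a b c ∧ A a b d ∧ A a c d ∧ not (A b c d)

  apexCount : ∀ {n} → (Fin n → Fin n → Fin n → Bool) → ℤ
  apexCount A = ∑ᵛ 4 (λ y → 𝟙 (apexAt A y))

  module Density {n : ℕ} (A : Fin n → Fin n → Fin n → Bool)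
    (A-swapˡ : ∀ x y z → A x y z ≡ A y x z) (A-swapʳ : ∀ x y z → A x y z ≡ A x z y)
    (A-irrefl : ∀ x y → A x x y ≡ false)
    (A-K₄-free : ∀ a b c d → A a b c ∧ A a b d ∧ A a c d ∧ A b c d ≡ false) where

    open Link A A-swapˡ A-swapʳ A-irrefl
    open Bound A A-swapˡ A-swapʳ A-irrefl A-K₄-free

    ∑q₃-nonneg : 0ℤ ≤ ∑ᵛ 6 (λ x → q₃ (enc x))
    -- `q₃` lives on five points. The cyclic word sends the first summation variable to the sixth
    -- place, so that the two flag variables become the innermost sums.
    ∑q₃-nonneg = subst (0ℤ ≤_) (∑ᵛ-swaps (0F ∷ 1F ∷ 2F ∷ 3F ∷ 4F ∷ []) (λ x → q₃ (enc x)))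
      (∑ᵛ-nonneg 4 {λ { (v ∷ x ∷ y ∷ z ∷ []) → inner x y z }} λ { (v ∷ x ∷ y ∷ z ∷ []) → nonneg x y z (A x y z) })
      where
      joint : Fin n → Fin n → Fin n → Vec (Fin n) 1 → Fin 4
      joint x y z (u ∷ []) = count₃ (A x y u) (A x z u) (A y z u)
      inner : Fin n → Fin n → Fin n → ℤ
      inner x y z = ∑ᵛ 1 (λ u → ∑ᵛ 1 (λ w → weight₃ (A x y z) (joint x y z u) (joint x y z w)))
      nonneg : ∀ x y z b → 0ℤ ≤ ∑ᵛ 1 (λ u → ∑ᵛ 1 (λ w → weight₃ b (joint x y z u) (joint x y z w)))
      nonneg x y z true  = ∑ᵛ-nonneg 1 λ u → ∑ᵛ-nonneg 1 {λ w → weight₃ true (joint x y z u) (joint x y z w)} λ w → ℤₚ.≤-refl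
      nonneg x y z false = gram-nonneg W₃ 0 squares₃ gram₃ 1 (joint x y z)

    ∑q₂-nonneg : 0ℤ ≤ ∑ᵛ 6 (λ x → q₂ (enc x))
    ∑q₂-nonneg = ∑ᵛ-nonneg 2 {λ { (x ∷ y ∷ []) → ∑ᵛ 2 (λ p → ∑ᵛ 2 (λ r → pair₂ (joint x y p) (joint x y r))) }}
      λ { (x ∷ y ∷ []) → gram-nonneg pair₂ L₂ squares₂ gram₂ 2 (joint x y) }
      where
      joint : Fin n → Fin n → Vec (Fin n) 2 → Fin 3 × Fin 3
      joint x y (c ∷ d ∷ []) = count₂ (A x y c) (A x y d) , count₂ (A x c d) (A y c d)

    -- Over roots that form an induced K₄⁻ with its apex first, the two flag vertices take n²
    -- values, each bringing r, and the form adds a nonnegative amount. All other roots contribute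
    -- zero.
    ∑apexTerm-bound : ∀ r → r * ((+ n) ^ 2 * apexCount A) ≤ ∑ᵛ 6 (λ x → apexTerm r (enc x))
    ∑apexTerm-bound r = begin
      r * ((+ n) ^ 2 * apexCount A)
        ≡⟨ cong (r *_) (*-distribˡ-∑ᵛ 4 ((+ n) ^ 2) (λ y → 𝟙 (apexAt A y))) ⟩
      r * ∑ᵛ 4 (λ y → (+ n) ^ 2 * 𝟙 (apexAt A y))
        ≡⟨ *-distribˡ-∑ᵛ 4 r (λ y → (+ n) ^ 2 * 𝟙 (apexAt A y)) ⟩
      ∑ᵛ 4 (λ y → r * ((+ n) ^ 2 * 𝟙 (apexAt A y)))
        ≤⟨ ∑ᵛ-mono 4 {λ y → r * ((+ n) ^ 2 * 𝟙 (apexAt A y))} {λ y → inner y (apexAt A y)} (λ { y@(_ ∷ _ ∷ _ ∷ _ ∷ []) → bound y (apexAt A y) }) ⟩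
      ∑ᵛ 4 (λ y → inner y (apexAt A y))
        ≡⟨⟩
      ∑ᵛ 6 (λ x → apexTerm r (enc x))  ∎
      where
      open ℤₚ.≤-Reasoning
      joint : Vec (Fin n) 4 → Vec (Fin n) 1 → Fin 4 × Fin 4
      joint (a ∷ b ∷ c ∷ d ∷ []) (u ∷ []) =
        count₃ (A a b u) (A a c u) (A a d u) , count₃ (A b c u) (A b d u) (A c d u)
      weight : Bool → Fin 4 × Fin 4 → Fin 4 × Fin 4 → ℤ
      weight k (a , b) (c , d) = weight₄ r k a b c d
      inner : Vec (Fin n) 4 → Bool → ℤ
      inner y k = ∑ᵛ 1 (λ u → ∑ᵛ 1 (λ w → weight k (joint y u) (joint y w)))
      zero-left : ∀ r m → r * (m ^ 2 * 0ℤ) ≡ 0ℤ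
      zero-left = solve 2 (λ r m → r :* (m :^ 2 :* con 0ℤ) := con 0ℤ) refl
      rearrange : ∀ r m → r * (m ^ 2 * 1ℤ) ≡ m ^ 1 * (m ^ 1 * r)
      rearrange = solve 2 (λ r m → r :* (m :^ 2 :* con 1ℤ) := m :^ 1 :* (m :^ 1 :* r)) refl
      bound : ∀ y k → r * ((+ n) ^ 2 * 𝟙 k) ≤ inner y k
      bound y false = subst (_≤ inner y false) (sym (zero-left r (+ n)))
        (∑ᵛ-nonneg 1 λ u → ∑ᵛ-nonneg 1 {λ w → weight false (joint y u) (joint y w)} λ w → ℤₚ.≤-refl)
      bound y true = subst (_≤ inner y true) (sym (rearrange r (+ n)))
        (shifted-gram pair₄ L₄ squares₄ gram₄ 1 (joint y) r)

    ∑-value : ∀ ws k₄ k₂ k₃ → length (representatives ws moves₄) ≡ k₄ →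
      length (representatives ws moves₂) ≡ k₂ → length (representatives ws moves₃) ≡ k₃ →
      ∑ᵛ 6 (value (representatives ws moves₄) (representatives ws moves₂) (representatives ws moves₃))
      ≡ + k₄ * ∑ᵛ 6 (λ x → q₄ (enc x)) + (+ k₂ * ∑ᵛ 6 (λ x → q₂ (enc x)) + + k₃ * ∑ᵛ 6 (λ x → q₃ (enc x)))
    ∑-value ws k₄ k₂ k₃ l₄ l₂ l₃ = begin
      ∑ᵛ 6 (value r₄ r₂ r₃)
        ≡⟨ ∑ᵛ-cong 6 (value-orbits r₄ r₂ r₃) ⟩
      ∑ᵛ 6 (λ x → orbit q₄ r₄ (enc x) + (orbit q₂ r₂ (enc x) + orbit q₃ r₃ (enc x)))
        ≡⟨ ∑ᵛ-+ 6 (λ x → orbit q₄ r₄ (enc x)) (λ x → orbit q₂ r₂ (enc x) + orbit q₃ r₃ (enc x)) ⟩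
      ∑ᵛ 6 (λ x → orbit q₄ r₄ (enc x)) + ∑ᵛ 6 (λ x → orbit q₂ r₂ (enc x) + orbit q₃ r₃ (enc x))
        ≡⟨ cong (_+_ (∑ᵛ 6 (λ x → orbit q₄ r₄ (enc x)))) (∑ᵛ-+ 6 (λ x → orbit q₂ r₂ (enc x)) (λ x → orbit q₃ r₃ (enc x))) ⟩
      ∑ᵛ 6 (λ x → orbit q₄ r₄ (enc x)) + (∑ᵛ 6 (λ x → orbit q₂ r₂ (enc x)) + ∑ᵛ 6 (λ x → orbit q₃ r₃ (enc x)))
        ≡⟨ cong₂ _+_ (trans (O₄.∑ᵛ-orbit ws) (cong (λ k → + k * ∑ᵛ 6 (λ x → q₄ (enc x))) {length r₄} {k₄} l₄)) (cong₂ _+_ (trans (O₂.∑ᵛ-orbit ws) (cong (λ k → + k * ∑ᵛ 6 (λ x → q₂ (enc x))) {length r₂} {k₂} l₂)) (trans (O₃.∑ᵛ-orbit ws) (cong (λ k → + k * ∑ᵛ 6 (λ x → q₃ (enc x))) {length r₃} {k₃} l₃))) ⟩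
      + k₄ * ∑ᵛ 6 (λ x → q₄ (enc x)) + (+ k₂ * ∑ᵛ 6 (λ x → q₂ (enc x)) + + k₃ * ∑ᵛ 6 (λ x → q₃ (enc x))) ∎
      where
      open ≡-Reasoning
      r₄ r₂ r₃ : List Arrangement
      r₄ = representatives ws moves₄
      r₂ = representatives ws moves₂
      r₃ = representatives ws moves₃

    ∑-upper : ∀ ws k₄ k₂ k₃ B → length (representatives ws moves₄) ≡ k₄ →
      length (representatives ws moves₂) ≡ k₂ → length (representatives ws moves₃) ≡ k₃ →
      (∀ x → value (representatives ws moves₄) (representatives ws moves₂) (representatives ws moves₃) x ≤ B) →
      + k₄ * ∑ᵛ 6 (λ x → q₄ (enc x)) ≤ (+ n) ^ 6 * B
    ∑-upper ws k₄ k₂ k₃ B l₄ l₂ l₃ v≤B = begin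
      s₄                    ≡⟨ ℤₚ.+-identityʳ s₄ ⟨
      s₄ + 0ℤ               ≤⟨ ℤₚ.+-monoʳ-≤ s₄ (ℤₚ.+-mono-≤ (scaled k₂ ∑q₂-nonneg) (scaled k₃ ∑q₃-nonneg)) ⟩
      s₄ + (+ k₂ * ∑ᵛ 6 (λ x → q₂ (enc x)) + + k₃ * ∑ᵛ 6 (λ x → q₃ (enc x)))
                            ≡⟨ ∑-value ws k₄ k₂ k₃ l₄ l₂ l₃ ⟨
      ∑ᵛ 6 (value (representatives ws moves₄) (representatives ws moves₂) (representatives ws moves₃))
                            ≤⟨ ∑ᵛ-mono 6 {value (representatives ws moves₄) (representatives ws moves₂) (representatives ws moves₃)} v≤B ⟩
      ∑ᵛ 6 (λ (_ : Vec (Fin n) 6) → B)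
                            ≡⟨ ∑ᵛ-const {n} 6 B ⟩
      (+ n) ^ 6 * B         ∎
      where
      open ℤₚ.≤-Reasoning
      s₄ : ℤ
      s₄ = + k₄ * ∑ᵛ 6 (λ x → q₄ (enc x))
      scaled : ∀ k {z} → 0ℤ ≤ z → 0ℤ ≤ + k * z
      scaled k {z} 0≤z = subst (_≤ + k * z) (ℤₚ.*-zeroʳ (+ k)) (ℤₚ.*-monoˡ-≤-nonNeg (+ k) 0≤z)

    apexCount-scaled : + 60 * (+ 82944 * ((+ n) ^ 2 * apexCount A)) ≤ (+ n) ^ 6 * + 737280
    apexCount-scaled = ℤₚ.≤-trans (ℤₚ.*-monoˡ-≤-nonNeg (+ 60) (∑apexTerm-bound (+ 82944)))
      (∑-upper words₆ 60 45 60 (+ 737280) length₄ length₂ length₃ value-bounded)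

  cancel-scale : ∀ n a k l p s t → k * l ≡ p * s → t ≡ p * (+ 4) → .{{_ : ℤ.Positive p}} →
    k * (l * ((+ suc n) ^ 2 * a)) ≤ (+ suc n) ^ 6 * t → s * a ≤ + 4 * (+ suc n) ^ 4
  cancel-scale n a k l p s t kl≡ps t≡ h = ℤₚ.*-cancelˡ-≤-pos (s * a) (+ 4 * m ^ 4) p
    (ℤₚ.*-cancelˡ-≤-pos (p * (s * a)) (p * (+ 4 * m ^ 4)) (m ^ 2) (begin
    m ^ 2 * (p * (s * a))          ≡⟨ left p s m a ⟨
    (p * s) * (m ^ 2 * a)          ≡⟨ cong (_* (m ^ 2 * a)) kl≡ps ⟨
    (k * l) * (m ^ 2 * a)          ≡⟨ ℤₚ.*-assoc k l (m ^ 2 * a) ⟩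
    k * (l * (m ^ 2 * a))          ≤⟨ h ⟩
    m ^ 6 * t                      ≡⟨ cong (m ^ 6 *_) t≡ ⟩
    m ^ 6 * (p * + 4)              ≡⟨ right p (+ 4) m ⟩
    m ^ 2 * (p * (+ 4 * m ^ 4))    ∎))
    where
    open ℤₚ.≤-Reasoning
    m : ℤ
    m = + suc n
    left : ∀ p s m a → (p * s) * (m ^ 2 * a) ≡ m ^ 2 * (p * (s * a))
    left = solve 4 (λ p s m a → (p :* s) :* (m :^ 2 :* a) := m :^ 2 :* (p :* (s :* a))) refl
    right : ∀ p f m → m ^ 6 * (p * f) ≡ m ^ 2 * (p * (f * m ^ 4))
    right = solve 3 (λ p f m → m :^ 6 :* (p :* f) := m :^ 2 :* (p :* (f :* m :^ 4))) refl

  -- Induced copies of K₄⁻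

  ==-sym : ∀ {n} (x y : Fin n) → (x == y) ≡ (y == x)
  ==-sym x y with x Finₚ.≟ y | y Finₚ.≟ x
  ... | yes _   | yes _   = refl
  ... | no _    | no _    = refl
  ... | yes x≡y | no y≢x  = ⊥-elim (y≢x (sym x≡y))
  ... | no x≢y  | yes y≡x = ⊥-elim (x≢y (sym y≡x))

  distinct3-swapˡ : ∀ {n} (x y z : Fin n) → distinct3 x y z ≡ distinct3 y x z
  distinct3-swapˡ x y z = cong₂ _∧_ (cong not (==-sym x y)) (Boolₚ.∧-comm (not (y == z)) _)

  distinct3-swapʳ : ∀ {n} (x y z : Fin n) → distinct3 x y z ≡ distinct3 x z y
  distinct3-swapʳ x y z = begin
    p ∧ (q ∧ r)                ≡⟨ Boolₚ.∧-comm p (q ∧ r) ⟩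
    (q ∧ r) ∧ p                ≡⟨ cong (_∧ p) (Boolₚ.∧-comm q r) ⟩
    (r ∧ q) ∧ p                ≡⟨ Boolₚ.∧-assoc r q p ⟩
    r ∧ (q ∧ p)                ≡⟨ cong (λ b → r ∧ (not b ∧ p)) (==-sym y z) ⟩
    r ∧ (not (z == y) ∧ p)     ∎
    where
    open ≡-Reasoning
    p q r : Bool
    p = not (x == y)
    q = not (y == z)
    r = not (x == z)

  ==-refl : ∀ {n} (x : Fin n) → (x == x) ≡ true
  ==-refl x with x Finₚ.≟ x
  ... | yes _ = refl
  ... | no x≢x = ⊥-elim (x≢x refl)

  module _ {n : ℕ} (G : Graph3 n) where

    hasEdge-swapˡ : ∀ x y z → hasEdge G x y z ≡ hasEdge G y x z
    hasEdge-swapˡ x y z = cong₂ _∧_ (distinct3-swapˡ x y z) (cong G (begin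
      ⁅ x ⁆ ∪ (⁅ y ⁆ ∪ ⁅ z ⁆)  ≡⟨ Subsetₚ.∪-assoc ⁅ x ⁆ ⁅ y ⁆ ⁅ z ⁆ ⟨
      (⁅ x ⁆ ∪ ⁅ y ⁆) ∪ ⁅ z ⁆  ≡⟨ cong (_∪ ⁅ z ⁆) (Subsetₚ.∪-comm ⁅ x ⁆ ⁅ y ⁆) ⟩
      (⁅ y ⁆ ∪ ⁅ x ⁆) ∪ ⁅ z ⁆  ≡⟨ Subsetₚ.∪-assoc ⁅ y ⁆ ⁅ x ⁆ ⁅ z ⁆ ⟩
      ⁅ y ⁆ ∪ (⁅ x ⁆ ∪ ⁅ z ⁆)  ∎))
      where open ≡-Reasoning

    hasEdge-swapʳ : ∀ x y z → hasEdge G x y z ≡ hasEdge G x z y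
    hasEdge-swapʳ x y z = cong₂ _∧_ (distinct3-swapʳ x y z) (cong (λ S → G (⁅ x ⁆ ∪ S)) (Subsetₚ.∪-comm ⁅ y ⁆ ⁅ z ⁆))

    hasEdge-irrefl : ∀ x y → hasEdge G x x y ≡ false
    hasEdge-irrefl x y rewrite ==-refl x = refl

    hasEdge-distinct : ∀ x y z → hasEdge G x y z ≡ true → x ≢ y × y ≢ z × x ≢ z
    hasEdge-distinct x y z e with x Finₚ.≟ y | y Finₚ.≟ z | x Finₚ.≟ z
    ... | no x≢y | no y≢z | no x≢z = x≢y , y≢z , x≢z

  allF-cong : ∀ n {p q : Fin n → Bool} → (∀ x → p x ≡ q x) → allF n p ≡ allF n q
  allF-cong zero    p≗q = refl
  allF-cong (suc n) p≗q = cong₂ _∧_ (p≗q zero) (allF-cong n (p≗q ∘ suc))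

  anyF-cong : ∀ n {p q : Fin n → Bool} → (∀ x → p x ≡ q x) → anyF n p ≡ anyF n q
  anyF-cong zero    p≗q = refl
  anyF-cong (suc n) p≗q = cong₂ _∨_ (p≗q zero) (anyF-cong n (p≗q ∘ suc))

  allF-sound : ∀ n (p : Fin n → Bool) → allF n p ≡ true → ∀ x → p x ≡ true
  allF-sound (suc n) p eq x with p zero in eq₀
  allF-sound (suc n) p eq zero    | true = eq₀
  allF-sound (suc n) p eq (suc x) | true = allF-sound n (p ∘ suc) eq x

  isoPattern : Graph3 4 → (Fin 4 → Fin 4 → Fin 4 → Bool) → Bool
  isoPattern H β =
    anyF 4 λ i → anyF 4 λ j → anyF 4 λ k → anyF 4 λ l →
      let σ = lookup (i ∷ j ∷ k ∷ l ∷ []) in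
      injB σ ∧ (allF 4 λ x → allF 4 λ y → allF 4 λ z → hasEdge H x y z ⇔ᵇ β (σ x) (σ y) (σ z))

  isoPattern-cong : ∀ H {β γ} → (∀ x y z → β x y z ≡ γ x y z) → isoPattern H β ≡ isoPattern H γ
  isoPattern-cong H {β} {γ} β≗γ =
    anyF-cong 4 λ i → anyF-cong 4 λ j → anyF-cong 4 λ k → anyF-cong 4 λ l →
    let σ = lookup (i ∷ j ∷ k ∷ l ∷ []) in
    cong (injB σ ∧_) (allF-cong 4 λ x → allF-cong 4 λ y → allF-cong 4 λ z →
      cong (hasEdge H x y z ⇔ᵇ_) (β≗γ (σ x) (σ y) (σ z)))

  isoInduced-pattern : ∀ {n} H (G : Graph3 n) v → isoInducedB H G v ≡ isoPattern H (λ x y z → hasEdge G (v x) (v y) (v z))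
  isoInduced-pattern H G v = refl

  three : Bool → Bool → Bool → Bool → Bool
  three true  true  true  s = not s
  three true  true  false s = s
  three true  false true  s = s
  three false true  true  s = s
  three _     _     _     _ = false

  edge₄ : Colouring → Fin 4 → Fin 4 → Fin 4 → Bool
  edge₄ c x y z = edge (x ↑ˡ 2) (y ↑ˡ 2) (z ↑ˡ 2) c

  -- The isomorphism search runs over all 256 maps of four points but reads four edges only, so it
  -- is evaluated once for each of their 16 values.
  edge₄-K₄⁻ : ∀ c → isoPattern K4⁻ (edge₄ c) ≡ three (e012 c) (e013 c) (e023 c) (e123 c)
  edge₄-K₄⁻ (colouring true true true true _ _ _ _ _ _ _ _ _ _ _ _ _ _ _ _) = refl
  edge₄-K₄⁻ (colouring true true true false _ _ _ _ _ _ _ _ _ _ _ _ _ _ _ _) = refl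
  edge₄-K₄⁻ (colouring true true false true _ _ _ _ _ _ _ _ _ _ _ _ _ _ _ _) = refl
  edge₄-K₄⁻ (colouring true true false false _ _ _ _ _ _ _ _ _ _ _ _ _ _ _ _) = refl
  edge₄-K₄⁻ (colouring true false true true _ _ _ _ _ _ _ _ _ _ _ _ _ _ _ _) = refl
  edge₄-K₄⁻ (colouring true false true false _ _ _ _ _ _ _ _ _ _ _ _ _ _ _ _) = refl
  edge₄-K₄⁻ (colouring true false false true _ _ _ _ _ _ _ _ _ _ _ _ _ _ _ _) = refl
  edge₄-K₄⁻ (colouring true false false false _ _ _ _ _ _ _ _ _ _ _ _ _ _ _ _) = refl
  edge₄-K₄⁻ (colouring false true true true _ _ _ _ _ _ _ _ _ _ _ _ _ _ _ _) = refl
  edge₄-K₄⁻ (colouring false true true false _ _ _ _ _ _ _ _ _ _ _ _ _ _ _ _) = refl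
  edge₄-K₄⁻ (colouring false true false true _ _ _ _ _ _ _ _ _ _ _ _ _ _ _ _) = refl
  edge₄-K₄⁻ (colouring false true false false _ _ _ _ _ _ _ _ _ _ _ _ _ _ _ _) = refl
  edge₄-K₄⁻ (colouring false false true true _ _ _ _ _ _ _ _ _ _ _ _ _ _ _ _) = refl
  edge₄-K₄⁻ (colouring false false true false _ _ _ _ _ _ _ _ _ _ _ _ _ _ _ _) = refl
  edge₄-K₄⁻ (colouring false false false true _ _ _ _ _ _ _ _ _ _ _ _ _ _ _ _) = refl
  edge₄-K₄⁻ (colouring false false false false _ _ _ _ _ _ _ _ _ _ _ _ _ _ _ _) = refl

  edge₄-K₄ : ∀ c → e012 c ∧ e013 c ∧ e023 c ∧ e123 c ≡ true →
    allF 4 (λ x → allF 4 λ y → allF 4 λ z → not (hasEdge K4 x y z) ∨ edge₄ c x y z) ≡ true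
  edge₄-K₄ (colouring true true true true _ _ _ _ _ _ _ _ _ _ _ _ _ _ _ _) _ = refl

  K₄-pattern : ∀ {n} (G : Graph3 n) → Vec (Fin n) 4 → Fin 4 → Fin 4 → Fin 4 → Bool
  K₄-pattern G v x y z = hasEdge G (lookup v x) (lookup v y) (lookup v z)

  three-swap₁ : ∀ p q r s → three p q r s ≡ three q p r s
  three-swap₁ true  true  r s = refl
  three-swap₁ false false r s = refl
  three-swap₁ true  false true  s = refl
  three-swap₁ true  false false s = refl
  three-swap₁ false true  true  s = refl
  three-swap₁ false true  false s = refl

  three-swap₂ : ∀ p q r s → three p q r s ≡ three p r q s
  three-swap₂ true  true  true  s = refl
  three-swap₂ true  true  false s = refl
  three-swap₂ true  false true  s = refl
  three-swap₂ true  false false s = refl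
  three-swap₂ false true  true  s = refl
  three-swap₂ false true  false s = refl
  three-swap₂ false false true  s = refl
  three-swap₂ false false false s = refl

  three-swap₃ : ∀ p q r s → three p q r s ≡ three p q s r
  three-swap₃ true  true  true  true  = refl
  three-swap₃ true  true  true  false = refl
  three-swap₃ true  true  false true  = refl
  three-swap₃ true  true  false false = refl
  three-swap₃ true  false true  true  = refl
  three-swap₃ true  false true  false = refl
  three-swap₃ true  false false true  = refl
  three-swap₃ true  false false false = refl
  three-swap₃ false true  true  true  = refl
  three-swap₃ false true  true  false = refl
  three-swap₃ false true  false true  = refl
  three-swap₃ false true  false false = refl
  three-swap₃ false false true  true  = refl
  three-swap₃ false false true  false = refl
  three-swap₃ false false false true  = refl
  three-swap₃ false false false false = refl

  three-apexes : ∀ p q r s → 𝟙 (three p q r s) ≡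
    𝟙 (p ∧ q ∧ r ∧ not s) + (𝟙 (p ∧ q ∧ s ∧ not r) + (𝟙 (p ∧ r ∧ s ∧ not q) + 𝟙 (q ∧ r ∧ s ∧ not p)))
  three-apexes true  true  true  true  = refl
  three-apexes true  true  true  false = refl
  three-apexes true  true  false true  = refl
  three-apexes true  true  false false = refl
  three-apexes true  false true  true  = refl
  three-apexes true  false true  false = refl
  three-apexes true  false false true  = refl
  three-apexes true  false false false = refl
  three-apexes false true  true  true  = refl
  three-apexes false true  true  false = refl
  three-apexes false true  false true  = refl
  three-apexes false true  false false = refl
  three-apexes false false true  true  = refl
  three-apexes false false true  false = refl
  three-apexes false false false true  = refl
  three-apexes false false false false = refl

  +-sumF : ∀ n (f : Fin n → ℕ) → + sumF n f ≡ sum (λ i → + f i)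
  +-sumF zero    f = refl
  +-sumF (suc n) f = cong (_+_ (+ f zero)) (+-sumF n (f ∘ suc))

  module Counting {n : ℕ} (G : Graph3 n) where

    A : Fin n → Fin n → Fin n → Bool
    A = hasEdge G

    open Link A (hasEdge-swapˡ G) (hasEdge-swapʳ G) (hasEdge-irrefl G)

    -- The second and third a pad the quadruple to a six-tuple, so that the symmetric lookup of
    -- `edge` serves for four points too.
    pattern-edge₄ : ∀ a b c d x y z →
      K₄-pattern G (a ∷ b ∷ c ∷ d ∷ []) x y z ≡ edge₄ (enc (a ∷ b ∷ c ∷ d ∷ a ∷ a ∷ [])) x y z
    pattern-edge₄ a b c d x y z = trans
      (cong₃ (sym (at x)) (sym (at y)) (sym (at z)))
      (sym (edge-enc (v Vec.++ w) (x ↑ˡ 2) (y ↑ˡ 2) (z ↑ˡ 2)))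
      where
      v : Vec (Fin n) 4
      v = a ∷ b ∷ c ∷ d ∷ []
      w : Vec (Fin n) 2
      w = a ∷ a ∷ []
      at : ∀ i → lookup (v Vec.++ w) (i ↑ˡ 2) ≡ lookup v i
      at = Vecₚ.lookup-++ˡ v w
      cong₃ : ∀ {p p′ q q′ r r′} → p ≡ p′ → q ≡ q′ → r ≡ r′ → A p q r ≡ A p′ q′ r′
      cong₃ refl refl refl = refl

    threeAt : Vec (Fin n) 4 → Bool
    threeAt (a ∷ b ∷ c ∷ d ∷ []) = three (A a b c) (A a b d) (A a c d) (A b c d)

    isoInduced-three : ∀ a b c d → isoInducedB K4⁻ G (lookup (a ∷ b ∷ c ∷ d ∷ [])) ≡ threeAt (a ∷ b ∷ c ∷ d ∷ [])
    isoInduced-three a b c d = trans (isoInduced-pattern K4⁻ G (lookup (a ∷ b ∷ c ∷ d ∷ []))) (trans (isoPattern-cong K4⁻ (pattern-edge₄ a b c d))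
      (edge₄-K₄⁻ (enc (a ∷ b ∷ c ∷ d ∷ a ∷ a ∷ []))))

    f : Vec (Fin n) 4 → ℤ
    f x = 𝟙 (threeAt x)

    f-swapAt : ∀ i x → f (swapAt i x) ≡ f x
    f-swapAt 0F (a ∷ b ∷ c ∷ d ∷ [])
      rewrite hasEdge-swapˡ G b a c | hasEdge-swapˡ G b a d = cong 𝟙 (three-swap₃ (A a b c) (A a b d) (A b c d) (A a c d))
    f-swapAt 1F (a ∷ b ∷ c ∷ d ∷ [])
      rewrite hasEdge-swapʳ G a c b | hasEdge-swapˡ G c b d = cong 𝟙 (three-swap₂ (A a b c) (A a c d) (A a b d) (A b c d))
    f-swapAt 2F (a ∷ b ∷ c ∷ d ∷ [])
      rewrite hasEdge-swapʳ G a d c | hasEdge-swapʳ G b d c = cong 𝟙 (three-swap₁ (A a b d) (A a b c) (A a c d) (A b c d))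

    f-repeat : ∀ a c d → f (a ∷ a ∷ c ∷ d ∷ []) ≡ 0ℤ
    f-repeat a c d rewrite hasEdge-irrefl G a c | hasEdge-irrefl G a d = refl

    open Symmetrize f f-swapAt f-repeat

    eH4-sorted : + eH4 K4⁻ G ≡ ∑ᵛ 4 F₄
    eH4-sorted = step λ a → step λ b → step λ c → step λ d → term a b c d
      where
      step : ∀ {g : Fin n → ℕ} {h : Fin n → ℤ} → (∀ i → + g i ≡ h i) → + sumF n g ≡ sum h
      step {g} {h} eq = trans (+-sumF n g) (sum-cong-≗ {n} {λ i → + g i} {h} eq)
      indicator : ∀ p q r s → + (if p ∧ q ∧ r ∧ s then 1 else 0) ≡ 𝟙 p * 𝟙 q * 𝟙 r * 𝟙 s
      indicator false q r s = refl
      indicator true false r s = refl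
      indicator true true false s = refl
      indicator true true true false = refl
      indicator true true true true = refl
      term : ∀ a b c d → + (if (a <ᵇ b) ∧ (b <ᵇ c) ∧ (c <ᵇ d) ∧ isoInducedB K4⁻ G (lookup (a ∷ b ∷ c ∷ d ∷ [])) then 1 else 0)
                         ≡ F₄ (a ∷ b ∷ c ∷ d ∷ [])
      term a b c d = trans (indicator (a <ᵇ b) (b <ᵇ c) (c <ᵇ d) (isoInducedB K4⁻ G (lookup (a ∷ b ∷ c ∷ d ∷ []))))
        (cong (λ t → lt a b * lt b c * lt c d * 𝟙 t) (isoInduced-three a b c d))

    -- An induced K₄⁻ has exactly one apex. The words bring each of the four positions to the front
    -- in turn, which makes the four sums copies of `apexCount`.
    ∑f : ∑ᵛ 4 f ≡ + 4 * apexCount A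
    ∑f = begin
      ∑ᵛ 4 f   ≡⟨ ∑ᵛ-cong 4 {f} {λ x → g x + (g (swaps w₁ x) + (g (swaps w₂ x) + g (swaps w₃ x)))} pointwise ⟩
      ∑ᵛ 4 (λ x → g x + (g (swaps w₁ x) + (g (swaps w₂ x) + g (swaps w₃ x))))
        ≡⟨ split g (λ x → g (swaps w₁ x) + (g (swaps w₂ x) + g (swaps w₃ x))) refl
             (split (g ∘ swaps w₁) (λ x → g (swaps w₂ x) + g (swaps w₃ x)) (∑ᵛ-swaps w₁ g)
               (split (g ∘ swaps w₂) (g ∘ swaps w₃) (∑ᵛ-swaps w₂ g) (∑ᵛ-swaps w₃ g))) ⟩
      apexCount A + (apexCount A + (apexCount A + apexCount A))  ≡⟨ quadruple (apexCount A) ⟩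
      + 4 * apexCount A                           ∎
      where
      open ≡-Reasoning
      g : Vec (Fin n) 4 → ℤ
      g y = 𝟙 (apexAt A y)
      w₁ w₂ w₃ : List (Fin 3)
      w₁ = 0F ∷ []
      w₂ = 1F ∷ 0F ∷ []
      w₃ = 2F ∷ 1F ∷ 0F ∷ []
      split : ∀ (F H : Vec (Fin n) 4 → ℤ) {u v} → ∑ᵛ 4 F ≡ u → ∑ᵛ 4 H ≡ v → ∑ᵛ 4 (λ x → F x + H x) ≡ u + v
      split F H eq eq′ = trans (∑ᵛ-+ 4 F H) (cong₂ _+_ eq eq′)
      quadruple : ∀ z → z + (z + (z + z)) ≡ + 4 * z
      quadruple = solve 1 (λ z → z :+ (z :+ (z :+ z)) := con (+ 4) :* z) refl
      rotate : ∀ x y z → A z x y ≡ A x y z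
      rotate x y z = trans (hasEdge-swapˡ G z x y) (hasEdge-swapʳ G x z y)
      pointwise : ∀ x → f x ≡ g x + (g (swaps w₁ x) + (g (swaps w₂ x) + g (swaps w₃ x)))
      pointwise (a ∷ b ∷ c ∷ d ∷ [])
        rewrite hasEdge-swapˡ G b a c | hasEdge-swapˡ G b a d | rotate a b c | hasEdge-swapˡ G c a d | hasEdge-swapˡ G c b d
              | rotate a b d | rotate a c d | rotate b c d
        = three-apexes (A a b c) (A a b d) (A a c d) (A b c d)

    -- Of the 24 orderings of a copy, the 6 that put its apex first are counted by `apexCount`.
    eH4-apexes : + 6 * + eH4 K4⁻ G ≡ apexCount A
    eH4-apexes = ℤₚ.*-cancelˡ-≡ (+ 4) (+ 6 * + eH4 K4⁻ G) (apexCount A) (begin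
      + 4 * (+ 6 * + eH4 K4⁻ G)  ≡⟨ ℤₚ.*-assoc (+ 4) (+ 6) (+ eH4 K4⁻ G) ⟨
      + 24 * + eH4 K4⁻ G         ≡⟨ cong (+ 24 *_) eH4-sorted ⟩
      + 24 * ∑ᵛ 4 F₄             ≡⟨ ∑-sorted ⟨
      ∑ᵛ 4 f                     ≡⟨ ∑f ⟩
      + 4 * apexCount A               ∎)
      where open ≡-Reasoning

    Free⇒no-K₄ : Free G K4 → ∀ a b c d → A a b c ∧ A a b d ∧ A a c d ∧ A b c d ≡ false
    Free⇒no-K₄ free a b c d with A a b c ∧ A a b d ∧ A a c d ∧ A b c d in eq
    ... | false = refl
    ... | true  = ⊥-elim (free (lookup v , injective , edges))
      where
      v : Vec (Fin n) 4
      v = a ∷ b ∷ c ∷ d ∷ []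
      -- The edges abc, abd and bcd together separate all six pairs.
      ∧-true : ∀ p q r s → p ∧ q ∧ r ∧ s ≡ true → p ≡ true × q ≡ true × s ≡ true
      ∧-true true true true true _ = refl , refl , refl
      present : A a b c ≡ true × A a b d ≡ true × A b c d ≡ true
      present = ∧-true (A a b c) (A a b d) (A a c d) (A b c d) eq
      a≢b : a ≢ b
      a≢b = proj₁ (hasEdge-distinct G a b c (proj₁ present))
      b≢c : b ≢ c
      b≢c = proj₁ (proj₂ (hasEdge-distinct G a b c (proj₁ present)))
      a≢c : a ≢ c
      a≢c = proj₂ (proj₂ (hasEdge-distinct G a b c (proj₁ present)))
      b≢d : b ≢ d
      b≢d = proj₁ (proj₂ (hasEdge-distinct G a b d (proj₁ (proj₂ present))))
      a≢d : a ≢ d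
      a≢d = proj₂ (proj₂ (hasEdge-distinct G a b d (proj₁ (proj₂ present))))
      c≢d : c ≢ d
      c≢d = proj₁ (proj₂ (hasEdge-distinct G b c d (proj₂ (proj₂ present))))
      injective : Injective _≡_ _≡_ (lookup v)
      injective {0F} {0F} _ = refl
      injective {0F} {1F} e = ⊥-elim (a≢b e)
      injective {0F} {2F} e = ⊥-elim (a≢c e)
      injective {0F} {3F} e = ⊥-elim (a≢d e)
      injective {1F} {0F} e = ⊥-elim (a≢b (sym e))
      injective {1F} {1F} _ = refl
      injective {1F} {2F} e = ⊥-elim (b≢c e)
      injective {1F} {3F} e = ⊥-elim (b≢d e)
      injective {2F} {0F} e = ⊥-elim (a≢c (sym e))
      injective {2F} {1F} e = ⊥-elim (b≢c (sym e))
      injective {2F} {2F} _ = refl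
      injective {2F} {3F} e = ⊥-elim (c≢d e)
      injective {3F} {0F} e = ⊥-elim (a≢d (sym e))
      injective {3F} {1F} e = ⊥-elim (b≢d (sym e))
      injective {3F} {2F} e = ⊥-elim (c≢d (sym e))
      injective {3F} {3F} _ = refl
      code : Colouring
      code = enc (a ∷ b ∷ c ∷ d ∷ a ∷ a ∷ [])
      implied : ∀ p {q} → p ≡ true → not p ∨ q ≡ true → q ≡ true
      implied true refl eq = eq
      edges : ∀ x y z → hasEdge K4 x y z ≡ true → hasEdge G (lookup v x) (lookup v y) (lookup v z) ≡ true
      edges x y z e = trans (pattern-edge₄ a b c d x y z) (implied (hasEdge K4 x y z) e
        (allF-sound 4 (λ z → not (hasEdge K4 x y z) ∨ edge₄ code x y z)
          (allF-sound 4 (λ y → allF 4 λ z → not (hasEdge K4 x y z) ∨ edge₄ code x y z)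
            (allF-sound 4 (λ x → allF 4 λ y → allF 4 λ z → not (hasEdge K4 x y z) ∨ edge₄ code x y z)
              (edge₄-K₄ code eq) x) y) z))

    no-K₄⇒Free : (∀ a b c d → A a b c ∧ A a b d ∧ A a c d ∧ A b c d ≡ false) → Free G K4
    no-K₄⇒Free h (g , _ , edges) with trans (sym (h (g 0F) (g 1F) (g 2F) (g 3F)))
      (cong₂ _∧_ (edges 0F 1F 2F refl) (cong₂ _∧_ (edges 0F 1F 3F refl) (cong₂ _∧_ (edges 0F 2F 3F refl) (edges 1F 2F 3F refl))))
    ... | ()

  -- Turán's construction

  lookup-⁅⁆ : ∀ {n} (x u : Fin n) → lookup ⁅ x ⁆ u ≡ (x == u)
  lookup-⁅⁆ zero    zero    = refl
  lookup-⁅⁆ zero    (suc u) = Vecₚ.lookup-replicate u false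
  lookup-⁅⁆ (suc x) zero    = refl
  lookup-⁅⁆ (suc x) (suc u) = lookup-⁅⁆ x u

  sumF-cong : ∀ n {f g : Fin n → ℕ} → (∀ x → f x ≡ g x) → sumF n f ≡ sumF n g
  sumF-cong zero    f≗g = refl
  sumF-cong (suc n) f≗g = cong₂ ℕ._+_ (f≗g zero) (sumF-cong n (f≗g ∘ suc))

  sumF-+ : ∀ n (f g : Fin n → ℕ) → sumF n (λ x → f x ℕ.+ g x) ≡ sumF n f ℕ.+ sumF n g
  sumF-+ zero    f g = refl
  sumF-+ (suc n) f g = trans (cong (f zero ℕ.+ g zero ℕ.+_) (sumF-+ n (f ∘ suc) (g ∘ suc)))
    (interchange (f zero) (g zero) _ _)
    where open CommSemigroupₚ ℕₚ.+-commutativeSemigroup using (interchange)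

  sumF-zero : ∀ n → sumF n (λ _ → 0) ≡ 0
  sumF-zero zero    = refl
  sumF-zero (suc n) = sumF-zero n

  sumF-single : ∀ n (x : Fin n) (w : Fin n → ℕ) → sumF n (λ u → if x == u then w u else 0) ≡ w x
  sumF-single (suc n) zero    w = trans (cong (w zero ℕ.+_) (sumF-zero n)) (ℕₚ.+-identityʳ (w zero))
  sumF-single (suc n) (suc x) w = sumF-single n x (w ∘ suc)

  class : ∀ {n} → Fin n → Fin 3
  class zero                = 0F
  class (suc zero)          = 1F
  class (suc (suc zero))    = 2F
  class (suc (suc (suc x))) = class x

  -- Base 4 digits record how many of the three vertices lie in each class.
  digit : Fin 3 → ℕ
  digit 0F = 1
  digit 1F = 4
  digit 2F = 16

  -- 21, 6, 24 and 33 are the digit sums of the class patterns 012, 001, 112 and 220. A graph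
  -- receives an unordered set of vertices, so the pattern has to be read off a symmetric code.
  turánCode : ℕ → Bool
  turánCode m = (m ℕ.≡ᵇ 21) ∨ (m ℕ.≡ᵇ 6) ∨ (m ℕ.≡ᵇ 24) ∨ (m ℕ.≡ᵇ 33)

  turánClass : Fin 3 → Fin 3 → Fin 3 → Bool
  turánClass i j k = turánCode (digit i ℕ.+ (digit j ℕ.+ digit k))

  turán : ∀ n → Graph3 n
  turán n S = turánCode (sumF n (λ x → if lookup S x then digit (class x) else 0))

  hasEdge-turán : ∀ {n} (x y z : Fin n) →
    hasEdge (turán n) x y z ≡ distinct3 x y z ∧ turánClass (class x) (class y) (class z)
  hasEdge-turán {n} x y z with x Finₚ.≟ y | y Finₚ.≟ z | x Finₚ.≟ z
  ... | yes _ | _ | _ = refl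
  ... | no _ | yes _ | _ = refl
  ... | no _ | no _ | yes _ = refl
  ... | no x≢y | no y≢z | no x≢z = cong turánCode (begin
    sumF n (λ u → if lookup (⁅ x ⁆ ∪ ⁅ y ⁆ ∪ ⁅ z ⁆) u then w u else 0)
      ≡⟨ sumF-cong n pointwise ⟩
    sumF n (λ u → δ x u ℕ.+ (δ y u ℕ.+ δ z u))
      ≡⟨ trans (sumF-+ n (δ x) _) (cong (sumF n (δ x) ℕ.+_) (sumF-+ n (δ y) (δ z))) ⟩
    sumF n (δ x) ℕ.+ (sumF n (δ y) ℕ.+ sumF n (δ z))
      ≡⟨ cong₂ ℕ._+_ (sumF-single n x w) (cong₂ ℕ._+_ (sumF-single n y w) (sumF-single n z w)) ⟩
    w x ℕ.+ (w y ℕ.+ w z) ∎)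
    where
    open ≡-Reasoning
    w : Fin n → ℕ
    w u = digit (class u)
    δ : Fin n → Fin n → ℕ
    δ v u = if v == u then w u else 0
    member : ∀ u → lookup (⁅ x ⁆ ∪ ⁅ y ⁆ ∪ ⁅ z ⁆) u ≡ (x == u) ∨ (y == u) ∨ (z == u)
    member u = trans (Vecₚ.lookup-zipWith _∨_ u ⁅ x ⁆ _) (cong₂ _∨_ (lookup-⁅⁆ x u)
      (trans (Vecₚ.lookup-zipWith _∨_ u ⁅ y ⁆ ⁅ z ⁆) (cong₂ _∨_ (lookup-⁅⁆ y u) (lookup-⁅⁆ z u))))
    additive : ∀ u → (if (x == u) ∨ (y == u) ∨ (z == u) then w u else 0) ≡ δ x u ℕ.+ (δ y u ℕ.+ δ z u)
    additive u with x Finₚ.≟ u | y Finₚ.≟ u | z Finₚ.≟ u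
    ... | yes refl | yes y≡u | _ = ⊥-elim (x≢y (sym y≡u))
    ... | yes refl | _ | yes z≡u = ⊥-elim (x≢z (sym z≡u))
    ... | _ | yes refl | yes z≡u = ⊥-elim (y≢z (sym z≡u))
    ... | yes _ | no _ | no _ = sym (ℕₚ.+-identityʳ (w u))
    ... | no _ | yes _ | no _ = sym (ℕₚ.+-identityʳ (w u))
    ... | no _ | no _ | yes _ = refl
    ... | no _ | no _ | no _ = refl
    pointwise : ∀ u → (if lookup (⁅ x ⁆ ∪ ⁅ y ⁆ ∪ ⁅ z ⁆) u then w u else 0) ≡ δ x u ℕ.+ (δ y u ℕ.+ δ z u)
    pointwise u = trans (cong (λ b → if b then w u else 0) (member u)) (additive u)

  -- Classes may repeat, so 81 cases cover every quadruple of vertices.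
  turánClass-K₄-free : ∀ i j k l →
    turánClass i j k ∧ turánClass i j l ∧ turánClass i k l ∧ turánClass j k l ≡ false
  turánClass-K₄-free = from-yes (Finₚ.all? λ i → Finₚ.all? λ j → Finₚ.all? λ k → Finₚ.all? λ l →
    (turánClass i j k ∧ turánClass i j l ∧ turánClass i k l ∧ turánClass j k l) Boolₚ.≟ false)

  turán-K₄-free : ∀ n → Free (turán n) K4
  turán-K₄-free n = Counting.no-K₄⇒Free (turán n) λ a b c d →
    trans (cong₂ _∧_ (hasEdge-turán a b c) (cong₂ _∧_ (hasEdge-turán a b d)
            (cong₂ _∧_ (hasEdge-turán a c d) (hasEdge-turán b c d))))
      (weaken (distinct3 a b c) (distinct3 a b d) (distinct3 a c d) (distinct3 b c d)
        (turánClass-K₄-free (class a) (class b) (class c) (class d)))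
    where
    weaken : ∀ p q r s {t u v w} → t ∧ u ∧ v ∧ w ≡ false → (p ∧ t) ∧ (q ∧ u) ∧ (r ∧ v) ∧ (s ∧ w) ≡ false
    weaken false q r s eq = refl
    weaken true false r s {t} eq = Boolₚ.∧-zeroʳ t
    weaken true true false s {t} {u} eq = trans (cong (t ∧_) (Boolₚ.∧-zeroʳ u)) (Boolₚ.∧-zeroʳ t)
    weaken true true true false {t} {u} {v} eq =
      trans (cong (λ z → t ∧ u ∧ z) (Boolₚ.∧-zeroʳ v)) (trans (cong (t ∧_) (Boolₚ.∧-zeroʳ u)) (Boolₚ.∧-zeroʳ t))
    weaken true true true true eq = eq

  -- Only the six events "two of the vertices coincide" can spoil a tuple whose classes form a K₄⁻.
  apex-from-classes : ∀ p q r s t u i j k l →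
    𝟙 (i ∧ j ∧ k ∧ not l) ≤
    𝟙 (((not p ∧ not s ∧ not q) ∧ i) ∧ ((not p ∧ not t ∧ not r) ∧ j) ∧ ((not q ∧ not u ∧ not r) ∧ k) ∧
       not ((not s ∧ not u ∧ not t) ∧ l)) +
    (𝟙 p + (𝟙 q + (𝟙 r + (𝟙 s + (𝟙 t + (𝟙 u + 0ℤ))))))
  apex-from-classes p q r s t u i j k l = ℤₚ.≤ᵇ⇒≤ (subst T (sym (allBits-sound 10 test refl
    (p ∷ q ∷ r ∷ s ∷ t ∷ u ∷ i ∷ j ∷ k ∷ l ∷ []))) tt)
    where
    test : Vec Bool 10 → Bool
    test (p ∷ q ∷ r ∷ s ∷ t ∷ u ∷ i ∷ j ∷ k ∷ l ∷ []) = 𝟙 (i ∧ j ∧ k ∧ not l) ≤ᵇ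
      𝟙 (((not p ∧ not s ∧ not q) ∧ i) ∧ ((not p ∧ not t ∧ not r) ∧ j) ∧ ((not q ∧ not u ∧ not r) ∧ k) ∧
         not ((not s ∧ not u ∧ not t) ∧ l)) +
      (𝟙 p + (𝟙 q + (𝟙 r + (𝟙 s + (𝟙 t + (𝟙 u + 0ℤ))))))

  -- `class` has period 3: the first 3k vertices meet each class k times, and the last r terms are
  -- nonnegative.
  sum-class : ∀ k r (g : Fin 3 → ℤ) → (∀ i → 0ℤ ≤ g i) → + k * sum g ≤ sum {k ℕ.* 3 ℕ.+ r} (g ∘ class)
  sum-class zero r g 0≤g = subst (_≤ sum {r} (g ∘ class)) (sym (ℤₚ.*-zeroˡ (sum g))) (sum-nonneg r)
    where
    sum-nonneg : ∀ m → 0ℤ ≤ sum {m} (g ∘ class)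
    sum-nonneg m = subst (_≤ sum {m} (g ∘ class)) (trans (sum-const m 0ℤ) (ℤₚ.*-zeroʳ (+ m))) (sum-mono {m} (0≤g ∘ class))
  sum-class (suc k) r g 0≤g = begin
    + suc k * sum g                        ≡⟨ ℤₚ.suc-* (+ k) (sum g) ⟩
    sum g + + k * sum g                    ≤⟨ ℤₚ.+-monoʳ-≤ (sum g) (sum-class k r g 0≤g) ⟩
    sum g + rest                           ≡⟨ regroup (g 0F) (g 1F) (g 2F) rest ⟩
    g 0F + (g 1F + (g 2F + rest))          ∎
    where
    open ℤₚ.≤-Reasoning
    rest : ℤ
    rest = sum {k ℕ.* 3 ℕ.+ r} (g ∘ class)
    regroup : ∀ a b c z → (a + (b + (c + 0ℤ))) + z ≡ a + (b + (c + z))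
    regroup = solve 4 (λ a b c z → (a :+ (b :+ (c :+ con 0ℤ))) :+ z := a :+ (b :+ (c :+ z))) refl

  ∑ᵛ-class : ∀ k r j (g : Vec (Fin 3) j → ℤ) → (∀ x → 0ℤ ≤ g x) →
    (+ k) ^ j * ∑ᵛ j g ≤ ∑ᵛ {k ℕ.* 3 ℕ.+ r} j (λ x → g (Vec.map class x))
  ∑ᵛ-class k r zero g 0≤g = ℤₚ.≤-reflexive (ℤₚ.*-identityˡ (g []))
  ∑ᵛ-class k r (suc j) g 0≤g = begin
    + k * (+ k) ^ j * ∑ᵛ (suc j) g
      ≡⟨ ℤₚ.*-assoc (+ k) ((+ k) ^ j) (∑ᵛ (suc j) g) ⟩
    + k * ((+ k) ^ j * ∑ᵛ (suc j) g)
      ≡⟨ cong (+ k *_) (*-distribˡ-sum ((+ k) ^ j) (λ i → ∑ᵛ j (λ x → g (i ∷ x)))) ⟩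
    + k * sum h
      ≤⟨ sum-class k r h (λ i → subst (_≤ h i) (ℤₚ.*-zeroʳ ((+ k) ^ j)) (mono (∑ᵛ-nonneg j λ x → 0≤g (i ∷ x)))) ⟩
    sum {k ℕ.* 3 ℕ.+ r} (h ∘ class)
      ≤⟨ sum-mono {k ℕ.* 3 ℕ.+ r} (λ a → ∑ᵛ-class k r j (λ x → g (class a ∷ x)) (λ x → 0≤g (class a ∷ x))) ⟩
    ∑ᵛ {k ℕ.* 3 ℕ.+ r} (suc j) (λ x → g (Vec.map class x)) ∎
    where
    open ℤₚ.≤-Reasoning
    h : Fin 3 → ℤ
    h i = (+ k) ^ j * ∑ᵛ j (λ x → g (i ∷ x))
    power-nonneg : ∀ j → 0ℤ ≤ (+ k) ^ j
    power-nonneg zero = ℤ.+≤+ ℕ.z≤n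
    power-nonneg (suc j) = subst (_≤ + k * (+ k) ^ j) (ℤₚ.*-zeroʳ (+ k)) (ℤₚ.*-monoˡ-≤-nonNeg (+ k) (power-nonneg j))
    mono : ∀ {u v} → u ≤ v → (+ k) ^ j * u ≤ (+ k) ^ j * v
    mono = ℤₚ.*-monoˡ-≤-nonNeg ((+ k) ^ j) {{ℤ.nonNegative (power-nonneg j)}}

  sum-== : ∀ n (x : Fin n) → sum (λ u → 𝟙 (x == u)) ≡ 1ℤ
  sum-== (suc n) zero    = cong (_+_ 1ℤ) (trans (sum-const n 0ℤ) (ℤₚ.*-zeroʳ (+ n)))
  sum-== (suc n) (suc x) = trans (ℤₚ.+-identityˡ _) (sum-== n x)

  -- Each word moves one of the six pairs of positions to the front.
  pairs : List (List (Fin 3))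
  pairs = [] ∷ (1F ∷ []) ∷ (2F ∷ 1F ∷ []) ∷ (0F ∷ 1F ∷ []) ∷ (0F ∷ 2F ∷ 1F ∷ []) ∷ (1F ∷ 0F ∷ 2F ∷ 1F ∷ []) ∷ []

  module _ (n : ℕ) where

    coincide : Vec (Fin n) 4 → ℤ
    coincide (a ∷ b ∷ _) = 𝟙 (a == b)

    ∑-coincide : ∑ᵛ 4 coincide ≡ (+ n) ^ 3
    ∑-coincide = begin
      sum {n} (λ a → sum {n} (λ b → ∑ᵛ {n} 2 (λ _ → 𝟙 (a == b))))
        ≡⟨ sum-cong-≗ {n} {λ a → sum {n} (λ b → ∑ᵛ {n} 2 (λ _ → 𝟙 (a == b)))} inner ⟩
      sum {n} (λ _ → (+ n) ^ 2)
        ≡⟨ sum-const n ((+ n) ^ 2) ⟩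
      (+ n) ^ 3 ∎
      where
      open ≡-Reasoning
      inner : ∀ a → sum {n} (λ b → ∑ᵛ {n} 2 (λ _ → 𝟙 (a == b))) ≡ (+ n) ^ 2
      inner a = begin
        sum {n} (λ b → ∑ᵛ {n} 2 (λ _ → 𝟙 (a == b)))
          ≡⟨ sum-cong-≗ {n} {λ b → ∑ᵛ {n} 2 (λ _ → 𝟙 (a == b))} {λ b → (+ n) ^ 2 * 𝟙 (a == b)} (λ b → ∑ᵛ-const {n} 2 (𝟙 (a == b))) ⟩
        sum {n} (λ b → (+ n) ^ 2 * 𝟙 (a == b))
          ≡⟨ *-distribˡ-sum {n} ((+ n) ^ 2) (λ b → 𝟙 (a == b)) ⟨
        (+ n) ^ 2 * sum {n} (λ b → 𝟙 (a == b))
          ≡⟨ cong ((+ n) ^ 2 *_) (sum-== n a) ⟩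
        (+ n) ^ 2 * 1ℤ
          ≡⟨ ℤₚ.*-identityʳ ((+ n) ^ 2) ⟩
        (+ n) ^ 2 ∎

    coincidences : Vec (Fin n) 4 → ℤ
    coincidences x = ∑ₗ pairs (λ w → coincide (swaps w x))

    ∑-coincidences : ∑ᵛ 4 coincidences ≡ + 6 * (+ n) ^ 3
    ∑-coincidences = begin
      ∑ᵛ 4 coincidences                                     ≡⟨ ∑ᵛ-∑ₗ 4 pairs (λ w x → coincide (swaps w x)) ⟩
      ∑ₗ pairs (λ w → ∑ᵛ 4 (λ x → coincide (swaps w x)))    ≡⟨ ∑ₗ-cong pairs (λ w → trans (∑ᵛ-swaps w coincide) ∑-coincide) ⟩
      ∑ₗ pairs (λ _ → (+ n) ^ 3)                            ≡⟨ ∑ₗ-const pairs ((+ n) ^ 3) ⟩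
      + 6 * (+ n) ^ 3                                       ∎
      where open ≡-Reasoning

    apexAt-turán : ∀ x → 𝟙 (apexAt turánClass (Vec.map class x)) ≤ 𝟙 (apexAt (hasEdge (turán n)) x) + coincidences x
    apexAt-turán (a ∷ b ∷ c ∷ d ∷ [])
      rewrite hasEdge-turán a b c | hasEdge-turán a b d | hasEdge-turán a c d | hasEdge-turán b c d
      = apex-from-classes (a == b) (a == c) (a == d) (b == c) (b == d) (c == d)
          (turánClass (class a) (class b) (class c)) (turánClass (class a) (class b) (class d))
          (turánClass (class a) (class c) (class d)) (turánClass (class b) (class c) (class d))

  turán-apexes : ∀ n k r → n ≡ k ℕ.* 3 ℕ.+ r →
    + 12 * (+ k) ^ 4 ≤ apexCount (hasEdge (turán n)) + + 6 * (+ n) ^ 3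
  turán-apexes n k r refl = begin
    + 12 * (+ k) ^ 4                           ≡⟨ ℤₚ.*-comm (+ 12) ((+ k) ^ 4) ⟩
    -- The sum over class quadruples evaluates to 12. For each of three apex classes i + 1 modulo 3,
    -- the base classes are i, i, i in one order or i, i, i - 1 in three.
    (+ k) ^ 4 * ∑ᵛ 4 (λ x → 𝟙 (apexAt turánClass x))
      ≤⟨ ∑ᵛ-class k r 4 (λ x → 𝟙 (apexAt turánClass x)) (λ x → 𝟙-nonneg (apexAt turánClass x)) ⟩
    ∑ᵛ {n} 4 (λ x → 𝟙 (apexAt turánClass (Vec.map class x)))
      ≤⟨ ∑ᵛ-mono 4 {λ x → 𝟙 (apexAt turánClass (Vec.map class x))} (apexAt-turán n) ⟩
    ∑ᵛ 4 (λ x → 𝟙 (apexAt (hasEdge (turán n)) x) + coincidences n x)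
      ≡⟨ ∑ᵛ-+ 4 (λ x → 𝟙 (apexAt (hasEdge (turán n)) x)) (coincidences n) ⟩
    apexCount (hasEdge (turán n)) + ∑ᵛ 4 (coincidences n)
      ≡⟨ cong (_+_ (apexCount (hasEdge (turán n)))) (∑-coincidences n) ⟩
    apexCount (hasEdge (turán n)) + + 6 * (+ n) ^ 3 ∎
    where
    open ℤₚ.≤-Reasoning
    𝟙-nonneg : ∀ b → 0ℤ ≤ 𝟙 b
    𝟙-nonneg true  = ℤ.+≤+ ℕ.z≤n
    𝟙-nonneg false = ℤₚ.≤-refl

  -- Extremal graphs

  hasEdge-cong : ∀ {n} {G H : Graph3 n} → (∀ S → G S ≡ H S) → ∀ x y z → hasEdge G x y z ≡ hasEdge H x y z
  hasEdge-cong G≗H x y z = cong (distinct3 x y z ∧_) (G≗H _)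

  isoInduced-cong : ∀ {n} F {G H : Graph3 n} → (∀ S → G S ≡ H S) → ∀ v → isoInducedB F G v ≡ isoInducedB F H v
  isoInduced-cong F {G} {H} G≗H v = trans (isoInduced-pattern F G v) (trans
    (isoPattern-cong F (λ x y z → hasEdge-cong {G = G} {H} G≗H (v x) (v y) (v z))) (sym (isoInduced-pattern F H v)))

  eH4-cong : ∀ {n} F {G H : Graph3 n} → (∀ S → G S ≡ H S) → eH4 F G ≡ eH4 F H
  eH4-cong {n} F {G} {H} G≗H = sumF-cong n λ a → sumF-cong n λ b → sumF-cong n λ c → sumF-cong n λ d →
    cong (λ t → if (a <ᵇ b) ∧ (b <ᵇ c) ∧ (c <ᵇ d) ∧ t then 1 else 0)
      (isoInduced-cong F {G} {H} G≗H (lookup (a ∷ b ∷ c ∷ d ∷ [])))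

  Free-cong : ∀ {n} {G H : Graph3 n} → (∀ S → G S ≡ H S) → Free G K4 → Free H K4
  Free-cong {n} {G} {H} G≗H free (f , injective , edges) =
    free (f , injective , λ x y z e → trans (hasEdge-cong {G = G} {H} G≗H (f x) (f y) (f z)) (edges x y z e))

  free? : ∀ {n} (G : Graph3 n) → Dec (Free G K4)
  free? G = map′ (Counting.no-K₄⇒Free G) (Counting.Free⇒no-K₄ G)
    (Finₚ.all? λ a → Finₚ.all? λ b → Finₚ.all? λ c → Finₚ.all? λ d →
      (hasEdge G a b c ∧ hasEdge G a b d ∧ hasEdge G a c d ∧ hasEdge G b c d) Boolₚ.≟ false)

  branch : ∀ {n} → Graph3 n → Graph3 n → Graph3 (suc n)
  branch G H (false ∷ S) = G S
  branch G H (true  ∷ S) = H S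

  -- An attained maximum calls for a finite list to search. Graphs are listed up to pointwise
  -- equality, branching on whether vertex 0 lies in the set; the congruence lemmas above make this
  -- sufficient.
  graphs : ∀ n → List (Graph3 n)
  graphs zero    = (λ _ → false) ∷ (λ _ → true) ∷ []
  graphs (suc n) = cartesianProductWith branch (graphs n) (graphs n)

  graphs-complete : ∀ n (G : Graph3 n) → Any (λ H → ∀ S → H S ≡ G S) (graphs n)
  graphs-complete zero G with G [] in eq
  ... | false = here λ { [] → sym eq }
  ... | true  = there (here λ { [] → sym eq })
  graphs-complete (suc n) G = Anyₚ.cartesianProductWith⁺ branch
    (λ p q → λ { (false ∷ S) → p S ; (true ∷ S) → q S })
    (graphs-complete n (G ∘ (false ∷_))) (graphs-complete n (G ∘ (true ∷_)))

  maximiser : ∀ n (f : Graph3 n → ℕ) (P : Graph3 n → Set) → (∀ G → Dec (P G)) →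
    (∀ {G H} → (∀ S → G S ≡ H S) → f G ≡ f H) → (∀ {G H} → (∀ S → G S ≡ H S) → P G → P H) →
    ∀ G₀ → P G₀ → Σ (Graph3 n) λ G → P G × (∀ H → P H → f H ℕ.≤ f G)
  maximiser n f P P? f-cong P-cong G₀ PG₀ =
    argmax f G₀ candidates , argmax-all f {P = P} {G₀} {candidates} PG₀ (Allₚ.all-filter P? (graphs n)) , bound
    where
    candidates : List (Graph3 n)
    candidates = filter P? (graphs n)
    bound : ∀ H → P H → f H ℕ.≤ f (argmax f G₀ candidates)
    bound H PH = let (H′ , H′∈ , H′≗H) = Membership.find (graphs-complete n H) in
      subst (ℕ._≤ f (argmax f G₀ candidates)) (f-cong H′≗H)
        (All.lookup (f[xs]≤f[argmax] {f = f} G₀ candidates)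
          (Membershipₚ.∈-filter⁺ P? H′∈ (P-cong (λ S → sym (H′≗H S)) PH)))

  ex-exists : ∀ n → Σ (Graph3 n) λ G → Free G K4 × (∀ H → Free H K4 → eH4 K4⁻ H ℕ.≤ eH4 K4⁻ G)
  ex-exists n = maximiser n (eH4 K4⁻) (λ G → Free G K4) free?
    (λ {G} {H} → eH4-cong K4⁻ {G} {H}) (λ {G} {H} → Free-cong {n} {G} {H}) (turán n) (turán-K₄-free n)

  -- Natural number bounds and the limit

  pos-^ : ∀ n k → (+ n) ^ k ≡ + (n ℕ.^ k)
  pos-^ n zero    = refl
  pos-^ n (suc k) = trans (cong (+ n *_) (pos-^ n k)) (sym (ℤₚ.pos-* n (n ℕ.^ k)))

  to-ℕ : ∀ {i j a b} → i ≤ j → i ≡ + a → j ≡ + b → a ℕ.≤ b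
  to-ℕ i≤j refl refl = ℤₚ.drop‿+≤+ i≤j

  eH4-upper : ∀ n (G : Graph3 (suc n)) → Free G K4 → 27 ℕ.* (6 ℕ.* eH4 K4⁻ G) ℕ.≤ 4 ℕ.* suc n ℕ.^ 4
  eH4-upper n G free = to-ℕ scaled
    (trans (cong (+ 27 *_) (trans (sym (Counting.eH4-apexes G)) (sym (ℤₚ.pos-* 6 (eH4 K4⁻ G)))))
      (sym (ℤₚ.pos-* 27 (6 ℕ.* eH4 K4⁻ G))))
    (trans (cong (+ 4 *_) (pos-^ (suc n) 4)) (sym (ℤₚ.pos-* 4 (suc n ℕ.^ 4))))
    where
    scaled : + 27 * apexCount (hasEdge G) ≤ + 4 * (+ suc n) ^ 4
    -- 184320 is the common factor: 60 · 82944 = 184320 · 27 and 737280 = 184320 · 4.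
    scaled = cancel-scale n (apexCount (hasEdge G)) (+ 60) (+ 82944) (+ 184320) (+ 27) (+ 737280) refl refl
      (Density.apexCount-scaled (hasEdge G) (hasEdge-swapˡ G) (hasEdge-swapʳ G) (hasEdge-irrefl G)
        (Counting.Free⇒no-K₄ G free))

  eH4-turán : ∀ n k r → n ≡ k ℕ.* 3 ℕ.+ r → 12 ℕ.* k ℕ.^ 4 ℕ.≤ 6 ℕ.* eH4 K4⁻ (turán n) ℕ.+ 6 ℕ.* n ℕ.^ 3
  eH4-turán n k r n≡ = to-ℕ (turán-apexes n k r n≡)
    (trans (cong (+ 12 *_) (pos-^ k 4)) (sym (ℤₚ.pos-* 12 (k ℕ.^ 4))))
    (trans (cong₂ _+_ (trans (sym (Counting.eH4-apexes (turán n))) (sym (ℤₚ.pos-* 6 (eH4 K4⁻ (turán n)))))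
      (trans (cong (+ 6 *_) (pos-^ n 3)) (sym (ℤₚ.pos-* 6 (n ℕ.^ 3))))) (sym (ℤₚ.pos-+ (6 ℕ.* eH4 K4⁻ (turán n)) (6 ℕ.* n ℕ.^ 3))))

  extremal-ratio : ∀ j P Q .(cop : Coprime (suc P) (suc Q)) → 173 ℕ.* suc Q ℕ.≤ j →
    (Σ (Graph3 (3 ℕ.+ j)) λ G → Free G K4 × (∀ H → Free H K4 → eH4 K4⁻ H ℕ.≤ eH4 K4⁻ G)) →
    Σ ℕ λ m → IsEx K4⁻ K4 (3 ℕ.+ j) m × ℚ.∣ ratio m ((3 ℕ.+ j) C 4) ℚ.- (+ 16) ℚ./ 27 ∣ ℚ.< mkℚ +[1+ P ] Q cop
  extremal-ratio j P Q cop large (G , free , maximal) = eH4 K4⁻ G , ((G , free , refl) , maximal) ,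
    Arithmetic.ratio-bound j (eH4 K4⁻ G) k r P Q cop n≡ (DivMod.m%n<n (3 ℕ.+ j) 3) large (eH4-upper (2 ℕ.+ j) G free) lower
    where
    k r : ℕ
    k = (3 ℕ.+ j) DivMod./ 3
    r = (3 ℕ.+ j) DivMod.% 3
    n≡ : 3 ℕ.+ j ≡ k ℕ.* 3 ℕ.+ r
    n≡ = trans (DivMod.m≡m%n+[m/n]*n (3 ℕ.+ j) 3) (ℕₚ.+-comm r (k ℕ.* 3))
    lower : 12 ℕ.* k ℕ.^ 4 ℕ.≤ 6 ℕ.* eH4 K4⁻ G ℕ.+ 6 ℕ.* (3 ℕ.+ j) ℕ.^ 3
    lower = ℕₚ.≤-trans
      (eH4-turán (3 ℕ.+ j) k r n≡)
      (ℕₚ.+-monoˡ-≤ (6 ℕ.* (3 ℕ.+ j) ℕ.^ 3) (ℕₚ.*-monoʳ-≤ 6 (maximal (turán (3 ℕ.+ j)) (turán-K₄-free (3 ℕ.+ j)))))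

  density-limit : (ε : ℚ) → ℚ.0ℚ ℚ.< ε →
    Σ ℕ λ N → (n : ℕ) → N ℕ.≤ n →
    Σ ℕ λ m → IsEx K4⁻ K4 n m × ℚ.∣ ratio m (n C 4) ℚ.- (+ 16) ℚ./ 27 ∣ ℚ.< ε
  -- Since (P + 1)/(Q + 1) is at least 1/(Q + 1), a threshold linear in Q serves for every P; the
  -- summand 3 is the shift n = 3 + j.
  density-limit (mkℚ +[1+ P ] Q cop) 0<ε = 3 ℕ.+ 173 ℕ.* suc Q , large
    where
    large : ∀ n → 3 ℕ.+ 173 ℕ.* suc Q ℕ.≤ n →
      Σ ℕ λ m → IsEx K4⁻ K4 n m × ℚ.∣ ratio m (n C 4) ℚ.- (+ 16) ℚ./ 27 ∣ ℚ.< mkℚ +[1+ P ] Q cop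
    large (suc (suc (suc j))) (ℕ.s≤s (ℕ.s≤s (ℕ.s≤s N≤j))) = extremal-ratio j P Q cop N≤j (ex-exists (3 ℕ.+ j))
  density-limit (mkℚ (+ zero) Q cop) (ℚ.*<* (ℤ.+<+ ()))
  density-limit (mkℚ ℤ.-[1+ P ] Q cop) (ℚ.*<* ())

open import Data.Nat using (ℕ; _≤_)
open import Data.Nat.Combinatorics using (_C_)
open import Data.Product using (Σ; _×_)
open import Data.Integer using (+_)
open import Data.Rational using (ℚ; _/_; _<_; _-_; ∣_∣; 0ℚ)

theorem2p3 : (ε : ℚ) → 0ℚ < ε →
    Σ ℕ λ N → (n : ℕ) → N ≤ n →
    Σ ℕ λ m → IsEx K4⁻ K4 n m × ∣ ratio m (n C 4) - (+ 16) / 27 ∣ < ε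
theorem2p3 = Extremal.density-limit
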